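{- Let $(\mathcal A,\varphi)$ be a noncommutative probability space over a commutative ring $\mathbb K$, let $I$ be an index set, let $(X_i)_{i\in I}$ be elements of $\mathcal A$, and let $\boldsymbol{\tau}\colon\mathsf{BPT}(I)\to\mathbb K$ be a weighted troupe. The following are equivalent: (i) for all $n\ge1$ and all $i_1,\dots,i_n\in I$, $-K_n(X_{i_1},\dots,X_{i_n})=\sum_{T\in\mathsf{DBPT}(i_1,\dots,i_n)}\boldsymbol{\tau}(T)$; (ii) for all $n\ge1$ and all $i_1,\dots,i_n\in I$, $-R_n(X_{i_1},\dots,X_{i_n})=\sum_{T\in\mathsf{BPT}(i_1,\dots,i_n)}\boldsymbol{\tau}(T)$; (iii) for all $n\ge1$ and all $i_1,\dots,i_n\in I$, $-B_n(X_{i_1},\dots,X_{i_n})=\sum_{T\in\mathsf{Branch}(i_1,\dots,i_n)}\boldsymbol{\tau}(T)$.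
   Context: A noncommutative probability space over $\mathbb K$ is a pair $(\mathcal A,\varphi)$ where $\mathcal A$ is a unital associative $\mathbb K$-algebra and $\varphi\colon\mathcal A\to\mathbb K$ is a $\mathbb K$-linear map with $\varphi(1)=1$. For $n\ge1$, the classical, free and Boolean cumulants $K_n,R_n,B_n\colon\mathcal A^n\to\mathbb K$ are the unique multilinear functionals such that for all $n\ge1$ and $X_1,\dots,X_n\in\mathcal A$: $\varphi(X_1\cdots X_n)=\sum_{\pi\in\Pi(n)}K_\pi=\sum_{\pi\in\mathrm{NC}(n)}R_\pi=\sum_{\pi\in\mathrm{Int}(n)}B_\pi$, where $\Pi(n)$ is the set of all set partitions of $[n]=\{1,\dots,n\}$; $\mathrm{NC}(n)$ is the set of noncrossing ones (no $a<b<c<d$ with $a,c$ in one block and $b,d$ in a different block); $\mathrm{Int}(n)$ is the set of interval partitions (every block is a set of consecutive integers); and $K_\pi=\prod_{U\in\pi}K_U$, where for $U=\{u_1<\dots<u_k\}$, $K_U=K_k(X_{u_1},\dots,X_{u_k})$ (similarly $R_\pi$, $B_\pi$). A binary plane tree is a rooted tree in which each child of a vertex is a left child or a right child, no vertex having more than one of each; trees are up to isomorphism and the empty tree $\varnothing$ is allowed. A branch is a nonempty binary plane tree in which every vertex has at most one child. Postorder on a tree: for each vertex $v$, all vertices of its left subtree precede all vertices of its right subtree, which precede $v$. Let $\boxminus$ be a special symbol. An $I$-coloring of a tree $T$ is a function $\chi\colon T\sqcup\{\boxminus\}\to I$; $\mathsf{BPT}(I)$ is the set of $I$-colored binary plane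 trees (including $\varnothing$). For $i_1,\dots,i_n\in I$: $\mathsf{BPT}(i_1,\dots,i_n)$ is the set of $I$-colored binary plane trees with $n-1$ vertices whose vertex colors read in postorder are $i_1,\dots,i_{n-1}$ and with $\chi(\boxminus)=i_n$; $\mathsf{Branch}(i_1,\dots,i_n)$ is the set of branches in $\mathsf{BPT}(i_1,\dots,i_n)$; $\mathsf{DBPT}(i_1,\dots,i_n)$ is the set of $I$-colored binary plane trees $T$ with $n-1$ vertices equipped with a decreasing standard labeling $\mathcal L\colon T\to[n-1]$ (a bijection with each vertex's label larger than its children's labels) such that $\chi(v)=i_{\mathcal L(v)}$ for all vertices $v$ and $\chi(\boxminus)=i_n$; two such labeled trees are identified iff there is a label- and color-preserving isomorphism. For $T\in\mathsf{DBPT}(i_1,\dots,i_n)$, $\boldsymbol{\tau}(T)$ means $\boldsymbol{\tau}$ of the underlying $I$-colored tree. Insertion: for nonempty $I$-colored trees $T_1,T_2$ with colorings $\chi_1,\chi_2$ and a vertex $v$ of $T_1$, $\nabla_v(T_1,T_2)$ is formed by creating a new vertex $v^*$ taking the place of $v$ in $T_1$, making $v$ (with its subtrees) the left child of $v^*$, and attaching $T_2$ as the right subtree of $v^*$; the coloring is $\chi_1$ on $T_1\sqcup\{\boxminus\}$, $\chi_2$ on vertices of $T_2$, and $v^*$ gets color $\chi_2(\boxminus)$. A weighted troupe is a function $\boldsymbol{\tau}\colon\mathsf{BPT}(I)\to\mathbb K$ with $\boldsymbol{\tau}(\varnothing)=0$ and $\boldsymbol{\tau}(\nabla_v(T_1,T_2))=\boldsymbol{\tau}(T_1)\boldsymbol{\tau}(T_2)$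 for all nonempty $T_1,T_2$ and vertices $v$ of $T_1$. -}

module Defs where

open import Level using (Level; _⊔_) renaming (suc to lsuc)
open import Algebra.Bundles using (CommutativeRing; Ring)
open import Algebra.Module.Bundles using (LeftModule)
open import Algebra.Module.Structures using (IsLeftModule)
import Algebra.Module.Construct.TensorUnit as TensorUnit
open import Algebra.Module.Morphism.Structures using (module LeftModuleMorphisms)
open import Data.Bool.Base using (true; false)
import Data.Bool.Properties as Bool
open import Data.Empty using (⊥-elim)
open import Data.Fin.Base as Fin using (Fin)
import Data.Fin.Properties as Fin
open import Data.Fin.Subset as Subset using (Subset; Side; inside; outside; ∣_∣; Nonempty; Empty; _∩_)
import Data.Fin.Subset.Properties as Subset
open import Data.List.Base as List using (List; []; _∷_; _++_; length; foldr; concatMap; upTo; allFin)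
import Data.List.Properties as List
open import Data.List.Membership.Propositional using (_∈_)
import Data.List.Membership.Propositional.Properties as ∈
open import Data.List.Relation.Unary.All as All using (All; []; _∷_)
import Data.List.Relation.Unary.All.Properties as All
open import Data.List.Relation.Unary.Any as Any using (Any; here; there)
open import Data.List.Relation.Unary.AllPairs as AllPairs using (AllPairs; []; _∷_)
import Data.List.Relation.Unary.AllPairs.Properties as AllPairs
open import Data.List.Relation.Binary.Disjoint.Propositional using (Disjoint)
open import Data.List.Relation.Unary.Unique.Propositional using (Unique)
import Data.List.Relation.Unary.Unique.Propositional.Properties as Unique
open import Data.Nat.Base as ℕ using (ℕ; zero; suc; _≤_; s≤s; z≤n)
import Data.Nat.Properties as ℕ
open import Data.Product using (∃; _×_; _,_; proj₁; proj₂)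
open import Data.Unit.Base using (⊤; tt)
open import Data.Vec.Base as Vec using (Vec; []; _∷_; lookup; toList; init; last; _[_]≔_)
import Data.Vec.Properties as Vec
open import Data.Vec.Relation.Binary.Pointwise.Inductive using (Pointwise)
open import Function.Base using (_∘_)
open import Function.Definitions using (Bijective)
open import Relation.Binary.Definitions using (DecidableEquality)
open import Relation.Binary.PropositionalEquality
  using (_≡_; _≢_; refl; sym; trans; cong; subst)
open import Relation.Nullary using (¬_; Dec; yes; no)
open import Relation.Nullary.Decidable as Dec using (_×-dec_; _→-dec_; ¬?)
open import Relation.Unary using (Pred; Decidable; _⊆_)

private
  variable
    a b c p q ℓ k ℓk : Level
    A : Set a
    B : Set b
    n m : ℕ

-- Finite sets, given as predicates together with a repetition-free list
-- of exactly the elements satisfying the predicate.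
record Enumeration {A : Set a} (P : Pred A p) : Set (a ⊔ p) where
  field
    elements : List A
    unique   : Unique elements
    sound    : ∀ {x} → x ∈ elements → P x
    complete : ∀ {x} → P x → x ∈ elements

open Enumeration public

respE : {P : Pred A p} {Q : Pred A q} → P ⊆ Q → Q ⊆ P → Enumeration P → Enumeration Q
respE P⊆Q Q⊆P E = record
  { elements = elements E
  ; unique   = unique E
  ; sound    = P⊆Q ∘ sound E
  ; complete = complete E ∘ Q⊆P
  }

emptyE : {P : Pred A p} → (∀ {x} → ¬ P x) → Enumeration P
emptyE ¬P = record
  { elements = [] ; unique = [] ; sound = λ () ; complete = λ px → ⊥-elim (¬P px) }

singletonE : (x : A) → Enumeration (_≡ x)
singletonE x = record
  { elements = x ∷ []
  ; unique   = [] ∷ []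
  ; sound    = λ { (here eq) → eq }
  ; complete = here
  }

filterE : {P : Pred A p} {Q : Pred A q} → Decidable Q → Enumeration P →
          Enumeration (λ x → P x × Q x)
filterE Q? E = record
  { elements = List.filter Q? (elements E)
  ; unique   = Unique.filter⁺ Q? (unique E)
  ; sound    = λ x∈ → let x∈E , qx = ∈.∈-filter⁻ Q? x∈ in sound E x∈E , qx
  ; complete = λ (px , qx) → ∈.∈-filter⁺ Q? (complete E px) qx
  }

mapE : {P : Pred A p} (f : A → B) → (∀ {x y} → f x ≡ f y → x ≡ y) → Enumeration P →
       Enumeration (λ y → ∃ λ x → P x × y ≡ f x)
mapE f inj E = record
  { elements = List.map f (elements E)
  ; unique   = Unique.map⁺ inj (unique E)
  ; sound    = λ y∈ → let x , x∈ , eq = ∈.∈-map⁻ f y∈ in x , sound E x∈ , eq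
  ; complete = λ { (x , px , refl) → ∈.∈-map⁺ f (complete E px) }
  }

concatMapE : {P : Pred A p} {Q : A → Pred B q} → Enumeration P →
             (∀ x → Enumeration (Q x)) →
             (∀ {x y z} → Q x z → Q y z → x ≡ y) →
             Enumeration (λ z → ∃ λ x → P x × Q x z)
concatMapE E F disj = record
  { elements = concatMap (elements ∘ F) (elements E)
  ; unique   = Unique.concat⁺
      (All.map⁺ (All.tabulate (λ {x} _ → unique (F x))))
      (AllPairs.map⁺ (AllPairs.map disjoint (unique E)))
  ; sound    = λ z∈ →
      let x , x∈ , z∈x = find∈ (∈.∈-concatMap⁻ (elements ∘ F) {xs = elements E} z∈)
      in x , sound E x∈ , sound (F x) z∈x
  ; complete = λ (x , px , qz) →
      ∈.∈-concatMap⁺ (elements ∘ F)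
        (Any.map (λ { refl → complete (F x) qz }) (complete E px))
  }
  where
  open import Data.List.Membership.Propositional using () renaming (find to find∈)
  disjoint : ∀ {x y} → x ≢ y → Disjoint (elements (F x)) (elements (F y))
  disjoint {x} {y} x≢y (z∈x , z∈y) = x≢y (disj (sound (F x) z∈x) (sound (F y) z∈y))

sidesE : Enumeration {A = Side} (λ _ → ⊤)
sidesE = record
  { elements = inside ∷ outside ∷ []
  ; unique   = ((λ ()) ∷ []) ∷ [] ∷ []
  ; sound    = λ _ → tt
  ; complete = λ { {true} _ → here refl ; {false} _ → there (here refl) }
  }

subsetsE : ∀ n → Enumeration {A = Subset n} (λ _ → ⊤)
subsetsE zero    = respE (λ _ → tt) (λ { {[]} _ → refl }) (singletonE [])
subsetsE (suc n) = respE (λ _ → tt) (λ { {s ∷ U} _ → s , tt , U , tt , refl })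
  (concatMapE sidesE (λ s → mapE (s ∷_) Vec.∷-injectiveʳ (subsetsE n))
    λ { (_ , _ , refl) (_ , _ , refl) → refl })

wordsE : {P : Pred A p} → Enumeration P → ∀ n →
         Enumeration (λ w → All P w × length w ≡ n)
wordsE E zero    = respE (λ { refl → [] , refl }) (λ { {[]} _ → refl }) (singletonE [])
wordsE E (suc n) =
  respE (λ { (x , px , w , (pw , eq) , refl) → px ∷ pw , cong suc eq })
        (λ { {x ∷ w} (px ∷ pw , eq) → x , px , w , (pw , ℕ.suc-injective eq) , refl })
  (concatMapE E (λ x → mapE (x ∷_) List.∷-injectiveʳ (wordsE E n))
    λ { (_ , _ , refl) (_ , _ , refl) → refl })

splitsE : (w : List A) → Enumeration (λ ((u , v) : List A × List A) → u ++ v ≡ w)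
splitsE w = record
  { elements = splits w ; unique = uniq w ; sound = snd w _ ; complete = λ { {u , v} refl → cmp u v } }
  where
  cons : A → List A × List A → List A × List A
  cons x (u , v) = x ∷ u , v

  splits : List A → List (List A × List A)
  splits []      = ([] , []) ∷ []
  splits (x ∷ w) = ([] , x ∷ w) ∷ List.map (cons x) (splits w)

  uniq : ∀ w → Unique (splits w)
  uniq []      = [] ∷ []
  uniq (x ∷ w) = All.map⁺ (All.tabulate (λ _ ()))
               ∷ Unique.map⁺ (λ { refl → refl }) (uniq w)

  snd : ∀ w uv → uv ∈ splits w → proj₁ uv ++ proj₂ uv ≡ w
  snd []      _ (here refl) = refl
  snd (x ∷ w) _ (here refl) = refl
  snd (x ∷ w) _ (there uv∈) with ∈.∈-map⁻ (cons x) uv∈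
  ... | uv′ , uv′∈ , refl = cong (x ∷_) (snd w uv′ uv′∈)

  cmp : ∀ u v → (u , v) ∈ splits (u ++ v)
  cmp []      []      = here refl
  cmp []      (x ∷ v) = here refl
  cmp (x ∷ u) v       = there (∈.∈-map⁺ (cons x) (cmp u v))

-- A set partition is represented by the list of its blocks, in order of
-- increasing least element; this fixes one list for each set of blocks.

_≺_ : Subset n → Subset n → Set
U ≺ V = ∃ λ x → x Subset.∈ U × (∀ y → y Subset.∈ V → x Fin.< y)

record IsPartition {n} (π : List (Subset n)) : Set where
  field
    nonempty : All Nonempty π
    disjoint : AllPairs (λ U V → Empty (U ∩ V)) π
    covering : ∀ x → Any (x Subset.∈_) π
    ordered  : AllPairs _≺_ π

Crossing : List (Subset n) → Set
Crossing {n} π =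
  ∃ λ (a : Fin n) → ∃ λ (b : Fin n) → ∃ λ (c : Fin n) → ∃ λ (d : Fin n) →
  (a Fin.< b × b Fin.< c × c Fin.< d) ×
  Any (λ U → (a Subset.∈ U × c Subset.∈ U) ×
    Any (λ V → V ≢ U × b Subset.∈ V × d Subset.∈ V) π) π

IsNoncrossing : List (Subset n) → Set
IsNoncrossing π = IsPartition π × ¬ Crossing π

IsInterval : List (Subset n) → Set
IsInterval π = IsPartition π ×
  All (λ U → ∀ a b c → a Fin.≤ b → b Fin.≤ c → a Subset.∈ U → c Subset.∈ U → b Subset.∈ U) π

isPartition? : Decidable (IsPartition {n})
isPartition? π = Dec.map′
  (λ (ne , dj , cv , od) → record
    { nonempty = ne ; disjoint = dj ; covering = cv ; ordered = od })
  (λ P → let open IsPartition P in nonempty , disjoint , covering , ordered)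
  (All.all? Subset.nonempty? π
    ×-dec AllPairs.allPairs? (λ U V → ¬? (Subset.nonempty? (U ∩ V))) π
    ×-dec Fin.all? (λ x → Any.any? (x Subset.∈?_) π)
    ×-dec AllPairs.allPairs? (λ U V → Fin.any? λ x →
      (x Subset.∈? U) ×-dec Fin.all? (λ y → (y Subset.∈? V) →-dec (x Fin.<? y))) π)

crossing? : Decidable (Crossing {n})
crossing? π =
  Fin.any? λ a → Fin.any? λ b → Fin.any? λ c → Fin.any? λ d →
  ((a Fin.<? b) ×-dec (b Fin.<? c) ×-dec (c Fin.<? d)) ×-dec
  Any.any? (λ U → ((a Subset.∈? U) ×-dec (c Subset.∈? U)) ×-dec
    Any.any? (λ V → ¬? (Vec.≡-dec Bool._≟_ V U) ×-dec (b Subset.∈? V) ×-dec (d Subset.∈? V)) π) π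

partition-length : {π : List (Subset n)} → IsPartition π → length π ≤ n
partition-length {n} {π} P = Fin.injective⇒≤ {f = rep} rep-injective
  where
  open IsPartition P
  U : Fin (length π) → Subset n
  U = List.lookup π

  rep : Fin (length π) → Fin n
  rep i = proj₁ (All.lookup nonempty (∈.∈-lookup {xs = π} i))

  rep∈ : ∀ i → rep i Subset.∈ U i
  rep∈ i = proj₂ (All.lookup nonempty (∈.∈-lookup {xs = π} i))

  meet : ∀ {σ : List (Subset n)} → AllPairs (λ U V → Empty (U ∩ V)) σ → ∀ i j {x} →
         x Subset.∈ List.lookup σ i → x Subset.∈ List.lookup σ j → i ≡ j
  meet (_ ∷ _) Fin.zero    Fin.zero    _ _ = refl
  meet {σ = _ ∷ σ} (d ∷ _) Fin.zero (Fin.suc j) x y =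
    ⊥-elim (All.lookup d (∈.∈-lookup {xs = σ} j) (_ , Subset.x∈p∩q⁺ (x , y)))
  meet {σ = _ ∷ σ} (d ∷ _) (Fin.suc i) Fin.zero x y =
    ⊥-elim (All.lookup d (∈.∈-lookup {xs = σ} i) (_ , Subset.x∈p∩q⁺ (y , x)))
  meet (_ ∷ ds) (Fin.suc i) (Fin.suc j) x y = cong Fin.suc (meet ds i j x y)

  rep-injective : ∀ {i j} → rep i ≡ rep j → i ≡ j
  rep-injective {i} {j} eq =
    meet disjoint i j (rep∈ i) (subst (Subset._∈ U j) (sym eq) (rep∈ j))

Π : ∀ n → Enumeration (IsPartition {n})
Π n = respE proj₂
  (λ {π} P → (length π , s≤s (partition-length P) , All.universal (λ _ → tt) π , refl) , P)
  (filterE isPartition?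
    (concatMapE ≤n (wordsE (subsetsE n)) λ { (_ , refl) (_ , refl) → refl }))
  where
  ≤n : Enumeration (ℕ._< suc n)
  ≤n = record
    { elements = upTo (suc n)
    ; unique   = Unique.upTo⁺ (suc n)
    ; sound    = ∈.∈-upTo⁻
    ; complete = ∈.∈-upTo⁺
    }

NC : ∀ n → Enumeration (IsNoncrossing {n})
NC n = filterE (¬? ∘ crossing?) (Π n)

Int : ∀ n → Enumeration (IsInterval {n})
Int n = filterE (λ π → All.all? (λ U → Fin.all? λ a → Fin.all? λ b → Fin.all? λ c →
    (a Fin.≤? b) →-dec (b Fin.≤? c) →-dec
    (a Subset.∈? U) →-dec (c Subset.∈? U) →-dec (b Subset.∈? U)) π)
  (Π n)

-- (x_{u₁}, …, x_{uₖ}) for U = {u₁ < … < uₖ}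
restrict : (U : Subset n) → Vec A n → Vec A ∣ U ∣
restrict []            []       = []
restrict (inside  ∷ U) (x ∷ xs) = x ∷ restrict U xs
restrict (outside ∷ U) (x ∷ xs) = restrict U xs

-- Binary plane trees whose vertices are decorated by elements of A.
data Tree (A : Set a) : Set a where
  empty : Tree A
  node  : (l : Tree A) (x : A) (r : Tree A) → Tree A

data Vertex {A : Set a} : Tree A → Set a where
  root  : ∀ {l x r} → Vertex (node l x r)
  left  : ∀ {l x r} → Vertex l → Vertex (node l x r)
  right : ∀ {l x r} → Vertex r → Vertex (node l x r)

at : (T : Tree A) → Vertex T → A
at (node l x r) root      = x
at (node l x r) (left v)  = at l v
at (node l x r) (right v) = at r v

data _ChildOf_ {A : Set a} : {T : Tree A} → Vertex T → Vertex T → Set a where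
  leftChild  : ∀ {l x r y s} → _ChildOf_ {T = node (node l x r) y s} (left root) root
  rightChild : ∀ {l x r y s} → _ChildOf_ {T = node s y (node l x r)} (right root) root
  left       : ∀ {l x r} {v w : Vertex l} → v ChildOf w →
               _ChildOf_ {T = node l x r} (left v) (left w)
  right      : ∀ {l x r} {v w : Vertex r} → v ChildOf w →
               _ChildOf_ {T = node l x r} (right v) (right w)

size : Tree A → ℕ
size empty        = 0
size (node l x r) = suc (size l ℕ.+ size r)

postorder : Tree A → List A
postorder empty        = []
postorder (node l x r) = postorder l ++ postorder r ++ x ∷ []

mapTree : (A → B) → Tree A → Tree B
mapTree f empty        = empty
mapTree f (node l x r) = node (mapTree f l) (f x) (mapTree f r)

-- The new vertex v* receives the decoration x.
insert : (T : Tree A) → Vertex T → A → Tree A → Tree A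
insert T@(node l y r) root      x S = node T x S
insert (node l y r)   (left v)  x S = node (insert l v x S) y r
insert (node l y r)   (right v) x S = node l y (insert r v x S)

-- An I-coloured tree; the second component is the colour of ⊟.
BPT : Set a → Set a
BPT I = Tree I × I

∇ : {I : Set a} (T₁ : BPT I) → Vertex (proj₁ T₁) → BPT I → BPT I
∇ (T₁ , c₁) v (T₂ , c₂) = insert T₁ v c₂ T₂ , c₁

record _∈BPT_ {I : Set a} (T : BPT I) (i : Vec I (suc m)) : Set a where
  field
    vertex-colours : postorder (proj₁ T) ≡ toList (init i)
    ⊟-colour       : proj₂ T ≡ last i

IsBranch : Tree A → Set _
IsBranch T = T ≢ empty × (∀ (u v w : Vertex T) → u ChildOf w → v ChildOf w → u ≡ v)

_∈Branch_ : {I : Set a} → BPT I → Vec I (suc m) → Set a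
T ∈Branch i = T ∈BPT i × IsBranch (proj₁ T)

-- An I-coloured tree whose vertices also carry labels in Fin m.
LabelledBPT : Set a → ℕ → Set a
LabelledBPT I m = Tree (I × Fin m) × I

underlying : {I : Set a} → LabelledBPT I m → BPT I
underlying (T , c) = mapTree proj₁ T , c

colour : {I : Set a} (T : Tree (I × Fin m)) → Vertex T → I
colour T = proj₁ ∘ at T

label : {I : Set a} (T : Tree (I × Fin m)) → Vertex T → Fin m
label T = proj₂ ∘ at T

IsDecreasing : {I : Set a} → Tree (I × Fin m) → Set a
IsDecreasing T = ∀ (u v : Vertex T) → u ChildOf v → label T u Fin.< label T v

record _∈DBPT_ {I : Set a} (T : LabelledBPT I m) (i : Vec I (suc m)) : Set a where
  field
    vertices   : size (proj₁ T) ≡ m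
    standard   : Bijective _≡_ _≡_ (label (proj₁ T))
    decreasing : IsDecreasing (proj₁ T)
    colours    : ∀ v → colour (proj₁ T) v ≡ lookup (init i) (label (proj₁ T) v)
    ⊟-colour   : proj₂ T ≡ last i

left-injective : ∀ {l r : Tree A} {x} {u v : Vertex l} →
                 _≡_ {A = Vertex (node l x r)} (left u) (left v) → u ≡ v
left-injective refl = refl

right-injective : ∀ {l r : Tree A} {x} {u v : Vertex r} →
                  _≡_ {A = Vertex (node l x r)} (right u) (right v) → u ≡ v
right-injective refl = refl

_≟V_ : {T : Tree A} → DecidableEquality (Vertex T)
root    ≟V root    = yes refl
root    ≟V left _  = no λ ()
root    ≟V right _ = no λ ()
left _  ≟V root    = no λ ()
left u  ≟V left v  = Dec.map′ (cong left) left-injective (u ≟V v)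
left _  ≟V right _ = no λ ()
right _ ≟V root    = no λ ()
right _ ≟V left _  = no λ ()
right u ≟V right v = Dec.map′ (cong right) right-injective (u ≟V v)

allV? : (T : Tree A) {P : Pred (Vertex T) p} → Decidable P → Dec (∀ v → P v)
allV? empty        P? = yes λ ()
allV? (node l x r) P? = Dec.map′
  (λ { (p , ps , qs) → λ { root → p ; (left v) → ps v ; (right v) → qs v } })
  (λ f → f root , f ∘ left , f ∘ right)
  (P? root ×-dec allV? l (P? ∘ left) ×-dec allV? r (P? ∘ right))

anyV? : (T : Tree A) {P : Pred (Vertex T) p} → Decidable P → Dec (∃ P)
anyV? T P? with allV? T (¬? ∘ P?)
... | yes ∀¬P = no λ (v , pv) → ∀¬P v pv
... | no ¬∀¬P = yes (witness T P? ¬∀¬P)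
  where
  witness : (T : Tree A) {P : Pred (Vertex T) p} → Decidable P → ¬ (∀ v → ¬ P v) → ∃ P
  witness empty        P? ¬∀ = ⊥-elim (¬∀ λ ())
  witness (node l x r) P? ¬∀ with P? root
  ... | yes p = root , p
  ... | no ¬p with allV? l (¬? ∘ P? ∘ left)
  ... | no ¬∀l = let v , pv = witness l (P? ∘ left) ¬∀l in left v , pv
  ... | yes ∀l = let v , pv = witness r (P? ∘ right)
                                (λ ∀r → ¬∀ λ { root → ¬p ; (left v) → ∀l v ; (right v) → ∀r v })
                 in right v , pv

_ChildOf?_ : {T : Tree A} (u v : Vertex T) → Dec (u ChildOf v)
root          ChildOf? root    = no λ ()
root          ChildOf? left _  = no λ ()
root          ChildOf? right _ = no λ ()
left root     ChildOf? root    = yes leftChild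
left (left _)  ChildOf? root   = no λ ()
left (right _) ChildOf? root   = no λ ()
left u        ChildOf? left v  = Dec.map′ left (λ { (left d) → d }) (u ChildOf? v)
left _        ChildOf? right _ = no λ ()
right root    ChildOf? root    = yes rightChild
right (left _)  ChildOf? root  = no λ ()
right (right _) ChildOf? root  = no λ ()
right _       ChildOf? left _  = no λ ()
right u       ChildOf? right v = Dec.map′ right (λ { (right d) → d }) (u ChildOf? v)

isBranch? : Decidable (IsBranch {A = A})
isBranch? T = nonempty? T ×-dec
  (allV? T λ u → allV? T λ v → allV? T λ w →
    (u ChildOf? w) →-dec (v ChildOf? w) →-dec (u ≟V v))
  where
  nonempty? : Decidable (_≢ empty)
  nonempty? empty        = no λ ≢ → ≢ refl
  nonempty? (node _ _ _) = yes λ ()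

isDecreasing? : {I : Set a} → Decidable (IsDecreasing {m = m} {I = I})
isDecreasing? T = allV? T λ u → allV? T λ v →
  (u ChildOf? v) →-dec (label T u Fin.<? label T v)

isStandard? : {I : Set a} (T : Tree (I × Fin m)) → Dec (Bijective _≡_ _≡_ (label T))
isStandard? {m = m} T = Dec.map′ to from
  ((allV? T λ u → allV? T λ v → (label T u Fin.≟ label T v) →-dec (u ≟V v))
    ×-dec Fin.all? (λ y → anyV? T λ v → label T v Fin.≟ y))
  where
  Std : Set _
  Std = (∀ u v → label T u ≡ label T v → u ≡ v) × (∀ (y : Fin m) → ∃ λ v → label T v ≡ y)

  to : Std → Bijective _≡_ _≡_ (label T)
  to (inj , sur) = (λ {u} {v} → inj u v) , λ y → proj₁ (sur y) , λ { refl → proj₂ (sur y) }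

  from : Bijective _≡_ _≡_ (label T) → Std
  from (inj , sur) = (λ u v → inj {u} {v}) , λ y → proj₁ (sur y) , proj₂ (sur y) refl

height : Tree A → ℕ
height empty        = 0
height (node l x r) = suc (height l ℕ.⊔ height r)

length-postorder : (T : Tree A) → length (postorder T) ≡ size T
length-postorder empty        = refl
length-postorder (node l x r)
  rewrite List.length-++ (postorder l) {postorder r ++ x ∷ []}
        | List.length-++ (postorder r) {x ∷ []}
        | length-postorder l | length-postorder r
        | ℕ.+-comm (size r) 1
  = ℕ.+-suc (size l) (size r)

height≤size : (T : Tree A) → height T ≤ size T
height≤size empty        = z≤n
height≤size (node l x r) = s≤s (ℕ.≤-trans
  (ℕ.m⊔n≤m+n (height l) (height r)) (ℕ.+-mono-≤ (height≤size l) (height≤size r)))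

private
  post-nonempty : ∀ (l : Tree A) x r → postorder (node l x r) ≢ []
  post-nonempty l x r eq =
    List.++-conicalʳ (postorder r) (x ∷ []) (List.++-conicalʳ (postorder l) _ eq) ≢[]
    where
    _≢[] : ∀ {x : A} {xs : List A} → x ∷ xs ≢ []
    _≢[] ()

  singleE : (t : List A) → Enumeration (λ x → x ∷ [] ≡ t)
  singleE []          = emptyE λ ()
  singleE (x ∷ [])    = respE (λ { refl → refl }) (λ { refl → refl }) (singletonE x)
  singleE (_ ∷ _ ∷ _) = emptyE λ ()

boundedTreesE : ∀ n (w : List A) → Enumeration (λ T → postorder T ≡ w × height T ≤ n)
boundedTreesE n [] = respE (λ { refl → refl , z≤n })
  (λ { {empty} _ → refl ; {node l x r} (eq , _) → ⊥-elim (post-nonempty l x r eq) })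
  (singletonE empty)
boundedTreesE zero (_ ∷ _) = emptyE λ { {empty} (() , _) ; {node l x r} (_ , ()) }
boundedTreesE (suc n) w@(_ ∷ _) = respE
  (λ { (_ , eq , _ , refl , x , refl , l , (refl , hl) , r , (refl , hr) , refl) →
       eq , s≤s (ℕ.⊔-lub hl hr) })
  (λ { {empty} (() , _)
     ; {node l x r} (eq , s≤s h) →
       (postorder l , postorder r ++ x ∷ []) , eq , (postorder r , x ∷ []) , refl , x , refl ,
       l , (refl , ℕ.m⊔n≤o⇒m≤o (height l) (height r) h) ,
       r , (refl , ℕ.m⊔n≤o⇒n≤o (height l) (height r) h) , refl })
  (concatMapE (splitsE w) (λ (u , s) →
     concatMapE (splitsE s) (λ (v , t) →
       concatMapE (singleE t) (λ x →
         concatMapE (boundedTreesE n u) (λ l →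
           mapE (node l x) (λ { refl → refl }) (boundedTreesE n v))
         λ { (_ , _ , refl) (_ , _ , refl) → refl })
       λ { (_ , _ , _ , _ , refl) (_ , _ , _ , _ , refl) → refl })
     λ { (_ , refl , _ , _ , _ , (refl , _) , refl) (_ , refl , _ , _ , _ , (refl , _) , refl) → refl })
   λ { (_ , refl , _ , refl , _ , (refl , _) , _ , (refl , _) , refl)
       (_ , refl , _ , refl , _ , (refl , _) , _ , (refl , _) , refl) → refl })

treesE : (w : List A) → Enumeration (λ T → postorder T ≡ w)
treesE w = respE proj₁
  (λ { {T} refl → refl , ℕ.≤-trans (height≤size T) (ℕ.≤-reflexive (sym (length-postorder T))) })
  (boundedTreesE (length w) w)

at⇒postorder : {P : Pred A p} (T : Tree A) → (∀ v → P (at T v)) → All P (postorder T)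
at⇒postorder empty        f = []
at⇒postorder (node l x r) f = All.++⁺ (at⇒postorder l (f ∘ left))
  (All.++⁺ (at⇒postorder r (f ∘ right)) (f root ∷ []))

postorder⇒at : {P : Pred A p} (T : Tree A) → All P (postorder T) → ∀ v → P (at T v)
postorder⇒at (node l x r) ps v with All.++⁻ (postorder l) ps
... | pl , prx with All.++⁻ (postorder r) prx
postorder⇒at (node l x r) ps root      | pl , prx | pr , px ∷ [] = px
postorder⇒at (node l x r) ps (left v)  | pl , prx | pr , _       = postorder⇒at l pl v
postorder⇒at (node l x r) ps (right v) | pl , prx | pr , _       = postorder⇒at r pr v

module _ {I : Set a} where

  BPTs : (i : Vec I (suc m)) → Enumeration (_∈BPT i)
  BPTs i = respE
    (λ { (T , eq , refl) → record { vertex-colours = eq ; ⊟-colour = refl } })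
    (λ { {T , _} record { vertex-colours = eq ; ⊟-colour = refl } → T , eq , refl })
    (mapE (_, last i) (λ { refl → refl }) (treesE (toList (init i))))

  Branches : (i : Vec I (suc m)) → Enumeration (_∈Branch i)
  Branches i = filterE (isBranch? ∘ proj₁) (BPTs i)

  DBPTs : (i : Vec I (suc m)) → Enumeration (_∈DBPT i)
  DBPTs {m} i = respE
    (λ { (T , ((w , (pw , len) , refl) , std , dec) , refl) → record
         { vertices = trans (sym (length-postorder T)) len ; standard = std
         ; decreasing = dec ; colours = postorder⇒at T pw ; ⊟-colour = refl } })
    (λ { {T , _} record { vertices = sz ; standard = std ; decreasing = dec
                        ; colours = col ; ⊟-colour = refl } →
         T , ((postorder T , (at⇒postorder T col , trans (length-postorder T) sz) , refl)
             , std , dec) , refl })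
    (mapE (_, last i) (λ { refl → refl })
      (filterE (λ T → isStandard? T ×-dec isDecreasing? T)
        (concatMapE (wordsE decorations m) treesE (λ { refl refl → refl }))))
    where
    finsE : Enumeration {A = Fin m} (λ _ → ⊤)
    finsE = record
      { elements = allFin m ; unique = Unique.allFin⁺ m
      ; sound = λ _ → tt ; complete = λ _ → ∈.∈-allFin _ }

    decorations : Enumeration (λ ((c , l) : I × Fin m) → c ≡ lookup (init i) l)
    decorations = respE (λ { (_ , _ , refl) → refl }) (λ { {_ , l} refl → l , tt , refl })
      (mapE (λ l → lookup (init i) l , l) (cong proj₂) finsE)

record UnitalAlgebra (K : CommutativeRing k ℓk) a ℓ : Set (k ⊔ ℓk ⊔ lsuc (a ⊔ ℓ)) where
  private module K = CommutativeRing K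
  infixr 7 _*ₗ_
  field
    ring : Ring a ℓ
  open Ring ring public
  field
    _*ₗ_         : K.Carrier → Carrier → Carrier
    isLeftModule : IsLeftModule K.ring _≈_ _+_ 0# -_ _*ₗ_
    *ₗ-*-assoc   : ∀ r x y → ((r *ₗ x) * y) ≈ (r *ₗ (x * y))
    *-*ₗ-comm    : ∀ r x y → (x * (r *ₗ y)) ≈ (r *ₗ (x * y))

  leftModule : LeftModule K.ring a ℓ
  leftModule = record { isLeftModule = isLeftModule }

record NCProbabilitySpace (K : CommutativeRing k ℓk) a ℓ : Set (k ⊔ ℓk ⊔ lsuc (a ⊔ ℓ)) where
  private module K = CommutativeRing K
  field
    algebra : UnitalAlgebra K a ℓ
  open UnitalAlgebra algebra public
  open LeftModuleMorphisms (LeftModule.rawLeftModule leftModule)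
                           (TensorUnit.rawLeftModule {R = K.rawRing})
  field
    φ        : Carrier → K.Carrier
    φ-linear : IsLeftModuleHomomorphism φ
    φ-unital : φ 1# K.≈ K.1#

module _ (K : CommutativeRing k ℓk) where
  open CommutativeRing K

  ∑ : {P : Pred A p} → Enumeration P → (A → Carrier) → Carrier
  ∑ E f = foldr _+_ 0# (List.map f (elements E))

  record IsWeightedTroupe {I : Set a} (τ : BPT I → Carrier) : Set (a ⊔ ℓk) where
    field
      τ-empty : ∀ c → τ (empty , c) ≈ 0#
      τ-∇     : ∀ T₁ T₂ → proj₁ T₁ ≢ empty → proj₁ T₂ ≢ empty →
                ∀ v → τ (∇ T₁ v T₂) ≈ τ T₁ * τ T₂

module _ {K : CommutativeRing k ℓk} (𝓐 : NCProbabilitySpace K a ℓ) where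
  private
    module K = CommutativeRing K
    module 𝓐 = NCProbabilitySpace 𝓐

  -- The component at n = 0 is irrelevant: blocks of partitions are nonempty.
  Functionals : Set (k ⊔ a)
  Functionals = ∀ n → Vec 𝓐.Carrier n → K.Carrier

  _at-partition_ : Functionals → List (Subset n) → Vec 𝓐.Carrier n → K.Carrier
  (C at-partition π) xs = foldr K._*_ K.1# (List.map (λ U → C ∣ U ∣ (restrict U xs)) π)

  record IsMultilinear (f : Vec 𝓐.Carrier n → K.Carrier) : Set (k ⊔ ℓk ⊔ a ⊔ ℓ) where
    field
      f-cong  : ∀ {xs ys} → Pointwise 𝓐._≈_ xs ys → f xs K.≈ f ys
      +-homo  : ∀ xs j x y →
                f (xs [ j ]≔ (x 𝓐.+ y)) K.≈ (f (xs [ j ]≔ x) K.+ f (xs [ j ]≔ y))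
      *ₗ-homo : ∀ xs j r x →
                f (xs [ j ]≔ (r 𝓐.*ₗ x)) K.≈ (r K.* f (xs [ j ]≔ x))

  record IsCumulants {P : ∀ n → Pred (List (Subset n)) p}
                     (partitions : ∀ n → Enumeration (P n))
                     (C : Functionals) : Set (k ⊔ ℓk ⊔ a ⊔ ℓ) where
    field
      multilinear    : ∀ n → IsMultilinear (C n)
      moment-formula : ∀ m (xs : Vec 𝓐.Carrier (suc m)) →
        𝓐.φ (Vec.foldr _ 𝓐._*_ 𝓐.1# xs) K.≈ ∑ K (partitions (suc m)) (λ π → (C at-partition π) xs)

  IsClassicalCumulants IsFreeCumulants IsBooleanCumulants : Functionals → Set (k ⊔ ℓk ⊔ a ⊔ ℓ)
  IsClassicalCumulants = IsCumulants Π
  IsFreeCumulants      = IsCumulants NC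
  IsBooleanCumulants   = IsCumulants Int

{-# OPTIONS --safe #-}
module Submission where

-- Each of the three conditions is equivalent to the moments being given by one and the same
-- recursion. Expand a moment along the block of its last letter z; write τ_z(T) = τ(T, z). If the
-- cumulants are −∑ τ over trees, this gives a sum over trees T filling the rest of that block, with
-- f = τ_z, weighted by moments of what lies outside. Look at the letter x before z. Either x ends
-- another block, and then the moment outside is itself −∑ over trees S with weight τ_x; or x is the
-- root of T. In the latter case T is a leaf, or has one subtree, or is node L x S with L and S
-- nonempty, and then f(node L x S) = f(L) τ_x(S) since node L x S is the insertion of S at the root
-- of L. The last contribution cancels the first, so the signed sum obeys a recursion involving only
-- f on trees whose root has at most one child, the same for all, noncrossing and interval
-- partitions; every functional f = τ_z(C[–]) with C a path has the same multiplicativity, so the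
-- recursion closes up.

open import Level using (Level; _⊔_)
open import Algebra.Bundles using (CommutativeRing)
import Algebra.Properties.CommutativeSemigroup as SemigroupProperties
import Algebra.Properties.Ring as RingProperties
open import Data.Bool.Base using (Bool; true; false)
import Data.Bool.Properties as Bool
open import Data.Empty using (⊥-elim)
open import Data.Fin.Base as Fin using (Fin)
import Data.Fin.Properties as Fin
open import Data.Fin.Subset as Subset using (Subset; inside; outside; ∣_∣; Nonempty; Empty; _∩_)
  renaming (_∈_ to _∈ₛ_)
import Data.Fin.Subset.Properties as Subset
open import Data.List.Base as List
  using (List; []; _∷_; _++_; _ʳ++_; concatMap; filter; foldr; length; reverse)
import Data.List.Properties as List
open import Data.List.Membership.Propositional using (_∈_; find; lose)
import Data.List.Membership.Propositional.Properties as ∈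
open import Data.List.Membership.Propositional.Properties.WithK using (unique∧set⇒bag)
open import Data.List.Relation.Binary.BagAndSetEquality using (∼bag⇒↭)
open import Data.List.Relation.Binary.Permutation.Propositional as Perm
  using (_↭_; prep; swap; ↭-refl; ↭-sym; ↭-trans; ↭-reflexive; ↭⇒↭ₛ)
import Data.List.Relation.Binary.Permutation.Propositional.Properties as Perm
import Data.List.Relation.Binary.Permutation.Setoid.Properties as SetoidPerm
open import Data.List.Relation.Unary.All as All using (All; []; _∷_)
import Data.List.Relation.Unary.All.Properties as All
open import Data.List.Relation.Unary.AllPairs as AllPairs using (AllPairs; []; _∷_)
import Data.List.Relation.Unary.AllPairs.Properties as AllPairs
open import Data.List.Relation.Unary.Any as Any using (Any; here; there)
import Data.List.Relation.Unary.Any.Properties as Any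
open import Data.List.Relation.Unary.Unique.Propositional using (Unique)
import Data.List.Relation.Unary.Unique.Propositional.Properties as Unique
open import Data.Nat.Base as ℕ using (ℕ; zero; suc; _≤_; _<_; z≤n; s≤s)
import Data.Nat.Properties as ℕ
open import Data.Product using (∃; _×_; _,_; proj₁; proj₂; map₁; map₂; uncurry)
open import Data.Sum.Base using (_⊎_; inj₁; inj₂; [_,_]′)
open import Data.Unit.Base using (⊤)
open import Data.Vec.Base as Vec
  using (Vec; []; _∷_; _∷ʳ_; toList; fromList; init; last; lookup; map)
import Data.Vec.Properties as Vec
open import Function.Base using (_∘_; id; case_of_)
open import Function.Bundles using (_⇔_; mk⇔)
open import Function.Construct.Composition using (_⇔-∘_)
open import Function.Construct.Symmetry using (⇔-sym)
open import Relation.Binary.Definitions using (Symmetric; tri<; tri≈; tri>)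
open import Relation.Binary.PropositionalEquality as ≡ using (_≡_; _≢_)
open import Relation.Nullary using (¬_; Dec; yes; no; does)
open import Relation.Nullary.Decidable using (_×-dec_; ¬?; does-⇔; dec-true; dec-false)
open import Relation.Unary using (Pred; Decidable; _⊆_)
open import Defs

private
  variable
    a b p q s ℓ ι k ℓk : Level
    A : Set a
    B : Set b
    m n : ℕ

-- Sums over words

-- The tree formulas are never compared with each other: each is shown equivalent to `moments`
-- agreeing with the one functional `moment`. Returning from moments to cumulants needs no division,
-- because the expansion along the block of the last letter is triangular in word length with
-- leading coefficient `moment [] = 1#`. All words are read from the end. The colour of ⊟ is the
-- last letter and the root is the last vertex in postorder, so both are then met first, and adding
-- a new least element to a partition amounts to reading one more letter. The cancellation requires
-- that filling a block by two words multiplied together be the same as placing the block of one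
-- word outside the block of the other. For noncrossing partitions this is why `gapSum` has a
-- separate functional `φ` for the gap before the first chosen letter: the second block, with all
-- its own gaps, has to fit into that gap. The given enumerations of partitions and trees are not
-- organised by these recursions. The lists are therefore rebuilt recursively, and the sums are
-- compared through `∑-unique`.

deconcatenations : List A → List (List A × List A)
deconcatenations []      = ([] , []) ∷ []
deconcatenations (x ∷ w) = ([] , x ∷ w) ∷ List.map (map₁ (x ∷_)) (deconcatenations w)

unshuffles : List A → List (List A × List A)
unshuffles []      = ([] , []) ∷ []
unshuffles (x ∷ w) = List.map (map₁ (x ∷_)) (unshuffles w) ++ List.map (map₂ (x ∷_)) (unshuffles w)

unshuffles-length : (w : List A) →
  All (λ (u , v) → length u ≤ length w × length v ≤ length w) (unshuffles w)
unshuffles-length []      = (z≤n , z≤n) ∷ []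
unshuffles-length (x ∷ w) = All.++⁺
  (All.map⁺ (All.map (λ (u≤ , v≤) → s≤s u≤ , ℕ.m≤n⇒m≤1+n v≤) (unshuffles-length w)))
  (All.map⁺ (All.map (λ (u≤ , v≤) → ℕ.m≤n⇒m≤1+n u≤ , s≤s v≤) (unshuffles-length w)))

deconcatenations-length : (w : List A) →
  All (λ (u , v) → length v ≤ length w) (deconcatenations w)
deconcatenations-length []      = z≤n ∷ []
deconcatenations-length (x ∷ w) =
  ℕ.≤-refl ∷ All.map⁺ (All.map ℕ.m≤n⇒m≤1+n (deconcatenations-length w))

module Sum (𝕂 : CommutativeRing k ℓk) where
  open CommutativeRing 𝕂
  open RingProperties ring
  open SemigroupProperties +-commutativeSemigroup using (interchange; x∙yz≈y∙xz)
  open import Relation.Binary.Reasoning.Setoid setoid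

  sum : List A → (A → Carrier) → Carrier
  sum xs f = foldr _+_ 0# (List.map f xs)

  sum-congᴬ : {f g : A → Carrier} {xs : List A} → All (λ x → f x ≈ g x) xs →
              sum xs f ≈ sum xs g
  sum-congᴬ []         = refl
  sum-congᴬ (eq ∷ eqs) = +-cong eq (sum-congᴬ eqs)

  sum-cong : {f g : A → Carrier} (xs : List A) → (∀ x → f x ≈ g x) → sum xs f ≈ sum xs g
  sum-cong xs f≈g = sum-congᴬ (All.universal f≈g xs)

  sum-++ : (xs ys : List A) (f : A → Carrier) → sum (xs ++ ys) f ≈ sum xs f + sum ys f
  sum-++ []       ys f = sym (+-identityˡ _)
  sum-++ (x ∷ xs) ys f = trans (+-congˡ (sum-++ xs ys f)) (sym (+-assoc _ _ _))

  sum-map : (g : B → A) (xs : List B) (f : A → Carrier) → sum (List.map g xs) f ≈ sum xs (f ∘ g)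
  sum-map g xs f = reflexive (≡.cong (foldr _+_ 0#) (≡.sym (List.map-∘ xs)))

  sum-concatMap : (g : B → List A) (xs : List B) (f : A → Carrier) →
                  sum (concatMap g xs) f ≈ sum xs (λ x → sum (g x) f)
  sum-concatMap g []       f = refl
  sum-concatMap g (x ∷ xs) f = trans (sum-++ (g x) _ f) (+-congˡ (sum-concatMap g xs f))

  sum-0 : (xs : List A) {f : A → Carrier} → (∀ x → f x ≈ 0#) → sum xs f ≈ 0#
  sum-0 []       f≈0 = refl
  sum-0 (x ∷ xs) f≈0 = trans (+-cong (f≈0 x) (sum-0 xs f≈0)) (+-identityˡ 0#)

  sum-+ : (xs : List A) (f g : A → Carrier) → sum xs (λ x → f x + g x) ≈ sum xs f + sum xs g
  sum-+ []       f g = sym (+-identityˡ 0#)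
  sum-+ (x ∷ xs) f g = trans (+-congˡ (sum-+ xs f g)) (interchange _ _ _ _)

  sum-*ˡ : (xs : List A) (c : Carrier) (f : A → Carrier) → sum xs (λ x → c * f x) ≈ c * sum xs f
  sum-*ˡ []       c f = sym (zeroʳ c)
  sum-*ˡ (x ∷ xs) c f = trans (+-congˡ (sum-*ˡ xs c f)) (sym (distribˡ c _ _))

  sum-*ʳ : (xs : List A) (c : Carrier) (f : A → Carrier) → sum xs (λ x → f x * c) ≈ sum xs f * c
  sum-*ʳ []       c f = sym (zeroˡ c)
  sum-*ʳ (x ∷ xs) c f = trans (+-congˡ (sum-*ʳ xs c f)) (sym (distribʳ c _ _))

  sum-neg : (xs : List A) (f : A → Carrier) → sum xs (λ x → - f x) ≈ - sum xs f
  sum-neg []       f = sym -0#≈0#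
  sum-neg (x ∷ xs) f = trans (+-congˡ (sum-neg xs f)) (-‿+-comm _ _)

  sum-↭ : {xs ys : List A} → xs ↭ ys → (f : A → Carrier) → sum xs f ≈ sum ys f
  sum-↭ Perm.refl         f = refl
  sum-↭ (Perm.prep x p)   f = +-congˡ (sum-↭ p f)
  sum-↭ (Perm.swap x y p) f = trans (+-congˡ (+-congˡ (sum-↭ p f))) (x∙yz≈y∙xz _ _ _)
  sum-↭ (Perm.trans p q)  f = trans (sum-↭ p f) (sum-↭ q f)

  ∑-unique : {P : Pred A p} (E E′ : Enumeration P) (f : A → Carrier) → ∑ 𝕂 E f ≈ ∑ 𝕂 E′ f
  ∑-unique E E′ f = sum-↭ (∼bag⇒↭ (unique∧set⇒bag (unique E) (unique E′)
    (mk⇔ (complete E′ ∘ sound E) (complete E ∘ sound E′)))) f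

  sum-unshuffles-∷ : (x : A) (w : List A) (f : List A × List A → Carrier) →
    sum (unshuffles (x ∷ w)) f ≈
    sum (unshuffles w) (λ (u , v) → f (x ∷ u , v)) + sum (unshuffles w) (λ (u , v) → f (u , x ∷ v))
  sum-unshuffles-∷ x w f = trans (sum-++ (List.map (map₁ (x ∷_)) (unshuffles w)) _ f)
    (+-cong (sum-map (map₁ (x ∷_)) (unshuffles w) f) (sum-map (map₂ (x ∷_)) (unshuffles w) f))

  sum-deconcatenations-∷ : (x : A) (w : List A) (f : List A × List A → Carrier) →
    sum (deconcatenations (x ∷ w)) f ≈
    f ([] , x ∷ w) + sum (deconcatenations w) (λ (u , v) → f (x ∷ u , v))
  sum-deconcatenations-∷ x w f = +-congˡ (sum-map (map₁ (x ∷_)) (deconcatenations w) f)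

-- Products of functionals on words, and sums over the content of a block

module Words (𝕂 : CommutativeRing k ℓk) (I : Set ι) where
  open CommutativeRing 𝕂
  open RingProperties ring
  open Sum 𝕂
  open SemigroupProperties +-commutativeSemigroup using (interchange)
  open SemigroupProperties *-commutativeSemigroup using () renaming (x∙yz≈y∙xz to *-swapˡ)
  open import Relation.Binary.Reasoning.Setoid setoid

  Functional : Set (k ⊔ ι)
  Functional = List I → Carrier

  δ : Functional
  δ []      = 1#
  δ (_ ∷ _) = 0#

  infixl 7 _⊙_ _⧢_

  _⊙_ _⧢_ : Functional → Functional → Functional
  (g ⊙ h) w = sum (deconcatenations w) (λ (u , v) → g u * h v)
  (g ⧢ h) w = sum (unshuffles w) (λ (u , v) → g u * h v)

  -- The sum over all ways of choosing a subword u of w of h u times the product of φ at the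
  -- gap before u and F at all later gaps.
  gapSum : (F h φ : Functional) → Functional
  gapSum F h φ []      = h [] * φ []
  gapSum F h φ (x ∷ w) = gapSum F h (φ ∘ (x ∷_)) w + φ [] * gapSum F (h ∘ (x ∷_)) F w

  -- Operators expressing a moment as a sum over the block of the last element: h is applied to the
  -- rest of that block and F, φ to what remains outside.
  record BlockSum (op : (F h φ : Functional) → Functional) : Set (k ⊔ ℓk ⊔ ι) where
    field
      local-cong : ∀ {F F′ h h′ φ φ′} w →
        (∀ u → length u ≤ length w → F u ≈ F′ u) → (∀ u → h u ≈ h′ u) →
        (∀ u → length u ≤ length w → φ u ≈ φ′ u) → op F h φ w ≈ op F′ h′ φ′ w
      op-+       : ∀ F h h′ φ w → op F (λ u → h u + h′ u) φ w ≈ op F h φ w + op F h′ φ w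
      op-negˡ    : ∀ F h φ w → op F (-_ ∘ h) φ w ≈ - op F h φ w
      op-δ       : ∀ F c w → op F (λ u → c * δ u) F w ≈ c * F w
      op-[]      : ∀ F h φ → op F h φ [] ≈ h [] * φ []
      triangular : ∀ F h φ w → F [] ≈ 1# → (∀ u → length u < length w → h u ≈ 0#) →
        op F h φ w ≈ h w * φ []

  -- What the cancellation uses. `op-∷`: the next letter lies outside the block or in it; taking
  -- `φ = F` with `F [] ≈ 1#` makes the closed gap in front of a chosen letter contribute 1.
  -- `op-mul`: a block filled by a product is a block filled by the second factor, with a block of
  -- the first factor in its outside. The product `_⊙_` for interval partitions has no such `op-∷`,
  -- since there a block cannot continue after a letter outside it; hence the separate `BlockSum`.
  record Peeling (op : (F h φ : Functional) → Functional)
                 (mul : Functional → Functional → Functional) : Set (k ⊔ ℓk ⊔ ι) where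
    field
      blockSum : BlockSum op
      op-negʳ  : ∀ F h φ w → op F h (-_ ∘ φ) w ≈ - op F h φ w
      op-∷     : ∀ F h x w → F [] ≈ 1# →
        op F h F (x ∷ w) ≈ op F h (F ∘ (x ∷_)) w + op F (h ∘ (x ∷_)) F w
      op-mul   : ∀ F g h φ w → op F (mul g h) φ w ≈ op F h (op F g φ) w
    open BlockSum blockSum public

  ⧢-local-cong : ∀ {h h′ φ φ′} w → (∀ u → h u ≈ h′ u) →
    (∀ u → length u ≤ length w → φ u ≈ φ′ u) → (h ⧢ φ) w ≈ (h′ ⧢ φ′) w
  ⧢-local-cong w h≈ φ≈ = sum-congᴬ
    (All.map (λ {(u , v)} (_ , v≤) → *-cong (h≈ u) (φ≈ v v≤)) (unshuffles-length w))

  ⧢-∷ : ∀ h φ x w → (h ⧢ φ) (x ∷ w) ≈ ((h ∘ (x ∷_)) ⧢ φ) w + (h ⧢ (φ ∘ (x ∷_))) w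
  ⧢-∷ h φ x w = sum-unshuffles-∷ x w _

  ⧢-+ˡ : ∀ h h′ φ w → ((λ u → h u + h′ u) ⧢ φ) w ≈ (h ⧢ φ) w + (h′ ⧢ φ) w
  ⧢-+ˡ h h′ φ w = trans (sum-cong (unshuffles w) λ (u , v) → distribʳ _ _ _) (sum-+ (unshuffles w) _ _)

  ⧢-+ʳ : ∀ h φ φ′ w → (h ⧢ (λ u → φ u + φ′ u)) w ≈ (h ⧢ φ) w + (h ⧢ φ′) w
  ⧢-+ʳ h φ φ′ w = trans (sum-cong (unshuffles w) λ (u , v) → distribˡ _ _ _) (sum-+ (unshuffles w) _ _)

  ⧢-zeroˡ : ∀ {h} φ w → (∀ u → length u ≤ length w → h u ≈ 0#) → (h ⧢ φ) w ≈ 0#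
  ⧢-zeroˡ φ w h≈0 = trans
    (sum-congᴬ (All.map (λ {(u , v)} (u≤ , _) → trans (*-congʳ (h≈0 u u≤)) (zeroˡ _)) (unshuffles-length w)))
    (sum-0 (unshuffles w) λ _ → refl)

  ⧢-δ : ∀ c F w → ((λ u → c * δ u) ⧢ F) w ≈ c * F w
  ⧢-δ c F []      = trans (+-identityʳ _) (*-congʳ (*-identityʳ c))
  ⧢-δ c F (x ∷ w) = begin
    ((λ u → c * δ u) ⧢ F) (x ∷ w)
      ≈⟨ ⧢-∷ _ F x w ⟩
    ((λ u → c * 0#) ⧢ F) w + ((λ u → c * δ u) ⧢ (F ∘ (x ∷_))) w
      ≈⟨ +-cong (⧢-zeroˡ F w (λ _ _ → zeroʳ c)) (⧢-δ c (F ∘ (x ∷_)) w) ⟩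
    0# + c * F (x ∷ w)
      ≈⟨ +-identityˡ _ ⟩
    c * F (x ∷ w) ∎

  -- Both sides distribute the letters of `w` over three subwords, one for each functional; the
  -- first letter goes to one of the three. The factors are permuted to fit `op-mul`.
  ⧢-assoc : ∀ g h φ w → ((g ⧢ h) ⧢ φ) w ≈ (h ⧢ (g ⧢ φ)) w
  ⧢-assoc g h φ [] = begin
    (g [] * h [] + 0#) * φ [] + 0#   ≈⟨ +-identityʳ _ ⟩
    (g [] * h [] + 0#) * φ []        ≈⟨ *-congʳ (+-identityʳ _) ⟩
    (g [] * h []) * φ []             ≈⟨ *-congʳ (*-comm _ _) ⟩
    (h [] * g []) * φ []             ≈⟨ *-assoc _ _ _ ⟩
    h [] * (g [] * φ [])             ≈⟨ *-congˡ (+-identityʳ _) ⟨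
    h [] * (g [] * φ [] + 0#)        ≈⟨ +-identityʳ _ ⟨
    h [] * (g [] * φ [] + 0#) + 0#   ∎
  ⧢-assoc g h φ (x ∷ w) = begin
    ((g ⧢ h) ⧢ φ) (x ∷ w)
      ≈⟨ ⧢-∷ (g ⧢ h) φ x w ⟩
    (((g ⧢ h) ∘ (x ∷_)) ⧢ φ) w + ((g ⧢ h) ⧢ (φ ∘ (x ∷_))) w
      ≈⟨ +-congʳ (⧢-local-cong w (⧢-∷ g h x) (λ _ _ → refl)) ⟩
    ((λ u → (gₓ ⧢ h) u + (g ⧢ hₓ) u) ⧢ φ) w + ((g ⧢ h) ⧢ φₓ) w
      ≈⟨ +-congʳ (⧢-+ˡ _ _ φ w) ⟩
    ((gₓ ⧢ h) ⧢ φ) w + ((g ⧢ hₓ) ⧢ φ) w + ((g ⧢ h) ⧢ φₓ) w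
      ≈⟨ +-cong (+-cong (⧢-assoc gₓ h φ w) (⧢-assoc g hₓ φ w)) (⧢-assoc g h φₓ w) ⟩
    (h ⧢ (gₓ ⧢ φ)) w + (hₓ ⧢ (g ⧢ φ)) w + (h ⧢ (g ⧢ φₓ)) w
      ≈⟨ +-congʳ (+-comm _ _) ⟩
    (hₓ ⧢ (g ⧢ φ)) w + (h ⧢ (gₓ ⧢ φ)) w + (h ⧢ (g ⧢ φₓ)) w
      ≈⟨ +-assoc _ _ _ ⟩
    (hₓ ⧢ (g ⧢ φ)) w + ((h ⧢ (gₓ ⧢ φ)) w + (h ⧢ (g ⧢ φₓ)) w)
      ≈⟨ +-congˡ (⧢-+ʳ h _ _ w) ⟨
    (hₓ ⧢ (g ⧢ φ)) w + (h ⧢ (λ u → (gₓ ⧢ φ) u + (g ⧢ φₓ) u)) w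
      ≈⟨ +-congˡ (⧢-local-cong w (λ _ → refl) (λ u _ → ⧢-∷ g φ x u)) ⟨
    (hₓ ⧢ (g ⧢ φ)) w + (h ⧢ ((g ⧢ φ) ∘ (x ∷_))) w
      ≈⟨ ⧢-∷ h (g ⧢ φ) x w ⟨
    (h ⧢ (g ⧢ φ)) (x ∷ w) ∎
    where
    gₓ = g ∘ (x ∷_)
    hₓ = h ∘ (x ∷_)
    φₓ = φ ∘ (x ∷_)

  ⧢-triangular : ∀ h φ w → (∀ u → length u < length w → h u ≈ 0#) → (h ⧢ φ) w ≈ h w * φ []
  ⧢-triangular h φ []      h≈0 = +-identityʳ _
  ⧢-triangular h φ (x ∷ w) h≈0 = begin
    (h ⧢ φ) (x ∷ w)
      ≈⟨ ⧢-∷ h φ x w ⟩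
    ((h ∘ (x ∷_)) ⧢ φ) w + (h ⧢ (φ ∘ (x ∷_))) w
      ≈⟨ +-cong (⧢-triangular _ φ w (λ u u< → h≈0 (x ∷ u) (s≤s u<)))
                (⧢-zeroˡ _ w (λ u u≤ → h≈0 u (s≤s u≤))) ⟩
    h (x ∷ w) * φ [] + 0#
      ≈⟨ +-identityʳ _ ⟩
    h (x ∷ w) * φ [] ∎

  ⧢-peeling : Peeling (λ _ → _⧢_) _⧢_
  ⧢-peeling = record
    { blockSum = record
      { local-cong = λ w _ h≈ φ≈ → ⧢-local-cong w h≈ φ≈
      ; op-+       = λ _ → ⧢-+ˡ
      ; op-negˡ    = λ _ h φ w → trans
          (sum-cong (unshuffles w) λ (u , v) → sym (-‿distribˡ-* _ _)) (sum-neg (unshuffles w) _)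
      ; op-δ       = λ F c w → ⧢-δ c F w
      ; op-[]      = λ _ _ _ → +-identityʳ _
      ; triangular = λ _ h φ w _ → ⧢-triangular h φ w
      }
    ; op-negʳ  = λ _ h φ w → trans
        (sum-cong (unshuffles w) λ (u , v) → sym (-‿distribʳ-* _ _)) (sum-neg (unshuffles w) _)
    ; op-∷     = λ F h x w _ → trans (⧢-∷ h F x w) (+-comm _ _)
    ; op-mul   = λ _ → ⧢-assoc
    }

  gapSum-local-cong : ∀ {F F′ h h′ φ φ′} w → (∀ u → length u ≤ length w → F u ≈ F′ u) →
    (∀ u → h u ≈ h′ u) → (∀ u → length u ≤ length w → φ u ≈ φ′ u) →
    gapSum F h φ w ≈ gapSum F′ h′ φ′ w
  gapSum-local-cong []      F≈ h≈ φ≈ = *-cong (h≈ []) (φ≈ [] z≤n)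
  gapSum-local-cong (x ∷ w) F≈ h≈ φ≈ = +-cong
    (gapSum-local-cong w F≈′ h≈ (λ u u≤ → φ≈ (x ∷ u) (s≤s u≤)))
    (*-cong (φ≈ [] z≤n) (gapSum-local-cong w F≈′ (h≈ ∘ (x ∷_)) F≈′))
    where F≈′ = λ u u≤ → F≈ u (ℕ.m≤n⇒m≤1+n u≤)

  gapSum-cong : ∀ {F h h′ φ φ′} w → (∀ u → h u ≈ h′ u) → (∀ u → φ u ≈ φ′ u) →
    gapSum F h φ w ≈ gapSum F h′ φ′ w
  gapSum-cong w h≈ φ≈ = gapSum-local-cong w (λ _ _ → refl) h≈ (λ u _ → φ≈ u)

  gapSum-+ˡ : ∀ F h h′ φ w → gapSum F (λ u → h u + h′ u) φ w ≈ gapSum F h φ w + gapSum F h′ φ w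
  gapSum-+ˡ F h h′ φ []      = distribʳ _ _ _
  gapSum-+ˡ F h h′ φ (x ∷ w) = trans
    (+-cong (gapSum-+ˡ F h h′ _ w) (trans (*-congˡ (gapSum-+ˡ F _ _ F w)) (distribˡ _ _ _)))
    (interchange _ _ _ _)

  gapSum-+ʳ : ∀ F h φ φ′ w → gapSum F h (λ u → φ u + φ′ u) w ≈ gapSum F h φ w + gapSum F h φ′ w
  gapSum-+ʳ F h φ φ′ []      = distribˡ _ _ _
  gapSum-+ʳ F h φ φ′ (x ∷ w) = trans
    (+-cong (gapSum-+ʳ F h _ _ w) (distribʳ _ _ _))
    (interchange _ _ _ _)

  gapSum-*ʳ : ∀ F h c φ w → gapSum F h (λ u → c * φ u) w ≈ c * gapSum F h φ w
  gapSum-*ʳ F h c φ []      = *-swapˡ _ _ _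
  gapSum-*ʳ F h c φ (x ∷ w) = trans
    (+-cong (gapSum-*ʳ F h c _ w) (*-assoc _ _ _))
    (sym (distribˡ _ _ _))

  gapSum-*ˡ : ∀ F c h φ w → gapSum F (λ u → c * h u) φ w ≈ c * gapSum F h φ w
  gapSum-*ˡ F c h φ []      = *-assoc _ _ _
  gapSum-*ˡ F c h φ (x ∷ w) = trans
    (+-cong (gapSum-*ˡ F c h _ w) (trans (*-congˡ (gapSum-*ˡ F c _ F w)) (*-swapˡ _ _ _)))
    (sym (distribˡ _ _ _))

  gapSum-zeroˡ : ∀ F {h} φ w → (∀ u → length u ≤ length w → h u ≈ 0#) → gapSum F h φ w ≈ 0#
  gapSum-zeroˡ F φ []      h≈0 = trans (*-congʳ (h≈0 [] z≤n)) (zeroˡ _)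
  gapSum-zeroˡ F φ (x ∷ w) h≈0 = trans
    (+-cong (gapSum-zeroˡ F _ w (λ u u≤ → h≈0 u (ℕ.m≤n⇒m≤1+n u≤)))
            (trans (*-congˡ (gapSum-zeroˡ F F w (λ u u≤ → h≈0 (x ∷ u) (s≤s u≤)))) (zeroʳ _)))
    (+-identityˡ 0#)

  gapSum-δ : ∀ F c φ w → gapSum F (λ u → c * δ u) φ w ≈ c * φ w
  gapSum-δ F c φ []      = *-congʳ (*-identityʳ c)
  gapSum-δ F c φ (x ∷ w) = trans
    (+-cong (gapSum-δ F c _ w)
            (trans (*-congˡ (gapSum-zeroˡ F F w (λ _ _ → zeroʳ c))) (zeroʳ _)))
    (+-identityʳ _)

  ⊙-∷ : ∀ g h x w → (g ⊙ h) (x ∷ w) ≈ g [] * h (x ∷ w) + ((g ∘ (x ∷_)) ⊙ h) w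
  ⊙-∷ g h x w = sum-deconcatenations-∷ x w _

  -- Cut the chosen subword into a part for `g` followed by a part for `h`. Everything before the
  -- first letter of the second part, namely the letters for `g` and the gaps around them, is the
  -- first gap seen by `h`.
  gapSum-⊙ : ∀ F g h φ w → gapSum F (g ⊙ h) φ w ≈ gapSum F h (gapSum F g φ) w
  gapSum-⊙ F g h φ [] = begin
    (g [] * h [] + 0#) * φ []   ≈⟨ *-congʳ (+-identityʳ _) ⟩
    (g [] * h []) * φ []        ≈⟨ *-congʳ (*-comm _ _) ⟩
    (h [] * g []) * φ []        ≈⟨ *-assoc _ _ _ ⟩
    h [] * (g [] * φ [])        ∎
  gapSum-⊙ F g h φ (x ∷ w) = begin
    gapSum F (g ⊙ h) φₓ w + φ [] * gapSum F ((g ⊙ h) ∘ (x ∷_)) F w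
      ≈⟨ +-congˡ (*-congˡ (gapSum-cong w (⊙-∷ g h x) (λ _ → refl))) ⟩
    gapSum F (g ⊙ h) φₓ w + φ [] * gapSum F (λ u → g [] * hₓ u + (gₓ ⊙ h) u) F w
      ≈⟨ +-congˡ (*-congˡ (gapSum-+ˡ F _ _ F w)) ⟩
    gapSum F (g ⊙ h) φₓ w + φ [] * (gapSum F (λ u → g [] * hₓ u) F w + gapSum F (gₓ ⊙ h) F w)
      ≈⟨ +-cong (gapSum-⊙ F g h φₓ w)
                (*-congˡ (+-cong (gapSum-*ˡ F (g []) hₓ F w) (gapSum-⊙ F gₓ h F w))) ⟩
    gapSum F h (gapSum F g φₓ) w + φ [] * (g [] * gapSum F hₓ F w + gapSum F h (gapSum F gₓ F) w)
      ≈⟨ +-congˡ (trans (distribˡ _ _ _) (+-comm _ _)) ⟩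
    gapSum F h (gapSum F g φₓ) w
      + (φ [] * gapSum F h (gapSum F gₓ F) w + φ [] * (g [] * gapSum F hₓ F w))
      ≈⟨ +-assoc _ _ _ ⟨
    gapSum F h (gapSum F g φₓ) w + φ [] * gapSum F h (gapSum F gₓ F) w
      + φ [] * (g [] * gapSum F hₓ F w)
      ≈⟨ +-cong (trans (gapSum-+ʳ F h _ _ w) (+-congˡ (gapSum-*ʳ F h (φ []) _ w)))
                (trans (*-congʳ (*-comm _ _)) (*-assoc _ _ _)) ⟨
    gapSum F h (gapSum F g φ ∘ (x ∷_)) w + g [] * φ [] * gapSum F hₓ F w ∎
    where
    gₓ = g ∘ (x ∷_)
    hₓ = h ∘ (x ∷_)
    φₓ = φ ∘ (x ∷_)

  -- Only the choice of all letters survives. Every gap is then empty, and each gap after the first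
  -- contributes `F [] ≈ 1#`.
  gapSum-triangular : ∀ F h φ w → F [] ≈ 1# → (∀ u → length u < length w → h u ≈ 0#) →
    gapSum F h φ w ≈ h w * φ []
  gapSum-triangular F h φ []      F1 h≈0 = refl
  gapSum-triangular F h φ (x ∷ w) F1 h≈0 = begin
    gapSum F h (φ ∘ (x ∷_)) w + φ [] * gapSum F (h ∘ (x ∷_)) F w
      ≈⟨ +-cong (gapSum-zeroˡ F _ w (λ u u≤ → h≈0 u (s≤s u≤)))
                (*-congˡ (gapSum-triangular F _ F w F1 (λ u u< → h≈0 (x ∷ u) (s≤s u<)))) ⟩
    0# + φ [] * (h (x ∷ w) * F [])
      ≈⟨ +-identityˡ _ ⟩
    φ [] * (h (x ∷ w) * F [])
      ≈⟨ *-congˡ (trans (*-congˡ F1) (*-identityʳ _)) ⟩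
    φ [] * h (x ∷ w)
      ≈⟨ *-comm _ _ ⟩
    h (x ∷ w) * φ [] ∎

  gapSum-negˡ : ∀ F h φ w → gapSum F (-_ ∘ h) φ w ≈ - gapSum F h φ w
  gapSum-negˡ F h φ w = trans (gapSum-cong w (λ u → sym (-1*x≈-x _)) (λ _ → refl))
    (trans (gapSum-*ˡ F (- 1#) h φ w) (-1*x≈-x _))

  gapSum-negʳ : ∀ F h φ w → gapSum F h (-_ ∘ φ) w ≈ - gapSum F h φ w
  gapSum-negʳ F h φ w = trans (gapSum-cong w (λ _ → refl) (λ u → sym (-1*x≈-x _)))
    (trans (gapSum-*ʳ F h (- 1#) φ w) (-1*x≈-x _))

  gapSum-peeling : Peeling gapSum _⊙_
  gapSum-peeling = record
    { blockSum = record
      { local-cong = gapSum-local-cong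
      ; op-+       = gapSum-+ˡ
      ; op-negˡ    = gapSum-negˡ
      ; op-δ       = λ F c w → gapSum-δ F c F w
      ; op-[]      = λ _ _ _ → refl
      ; triangular = gapSum-triangular
      }
    ; op-negʳ  = gapSum-negʳ
    ; op-∷     = λ F h x w F1 → +-congˡ (trans (*-congʳ F1) (*-identityˡ _))
    ; op-mul   = gapSum-⊙
    }

  ⊙-local-cong : ∀ {h h′ φ φ′} w → (∀ u → h u ≈ h′ u) →
    (∀ u → length u ≤ length w → φ u ≈ φ′ u) → (h ⊙ φ) w ≈ (h′ ⊙ φ′) w
  ⊙-local-cong w h≈ φ≈ = sum-congᴬ
    (All.map (λ {(u , v)} v≤ → *-cong (h≈ u) (φ≈ v v≤)) (deconcatenations-length w))

  ⊙-δ : ∀ c F w → ((λ u → c * δ u) ⊙ F) w ≈ c * F w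
  ⊙-δ c F []      = trans (+-identityʳ _) (*-congʳ (*-identityʳ c))
  ⊙-δ c F (x ∷ w) = trans (⊙-∷ (λ u → c * δ u) F x w) (trans
    (+-cong (*-congʳ (*-identityʳ c))
            (sum-0 (deconcatenations w) λ _ → trans (*-congʳ (zeroʳ c)) (zeroˡ _)))
    (+-identityʳ _))

  ⊙-triangular : ∀ h φ w → (∀ u → length u < length w → h u ≈ 0#) → (h ⊙ φ) w ≈ h w * φ []
  ⊙-triangular h φ []      h≈0 = +-identityʳ _
  ⊙-triangular h φ (x ∷ w) h≈0 = trans (⊙-∷ h φ x w) (trans
    (+-cong (trans (*-congʳ (h≈0 [] (s≤s z≤n))) (zeroˡ _))
            (⊙-triangular _ φ w (λ u u< → h≈0 (x ∷ u) (s≤s u<))))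
    (+-identityˡ _))

  ⊙-blockSum : BlockSum (λ _ → _⊙_)
  ⊙-blockSum = record
    { local-cong = λ w _ h≈ φ≈ → ⊙-local-cong w h≈ φ≈
    ; op-+       = λ _ h h′ φ w → trans
        (sum-cong (deconcatenations w) λ (u , v) → distribʳ _ _ _) (sum-+ (deconcatenations w) _ _)
    ; op-negˡ    = λ _ h φ w → trans
        (sum-cong (deconcatenations w) λ (u , v) → sym (-‿distribˡ-* _ _))
        (sum-neg (deconcatenations w) _)
    ; op-δ       = λ F c w → ⊙-δ c F w
    ; op-[]      = λ _ _ _ → +-identityʳ _
    ; triangular = λ _ h φ w _ → ⊙-triangular h φ w
    }

-- The recursion for moments attached to a weighted troupe

module Troupe (𝕂 : CommutativeRing k ℓk) {I : Set ι} (τ : BPT I → CommutativeRing.Carrier 𝕂)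
              (τ-troupe : IsWeightedTroupe 𝕂 τ) where
  open CommutativeRing 𝕂
  open RingProperties ring
  open Sum 𝕂
  open Words 𝕂 I
  open IsWeightedTroupe τ-troupe
  open import Relation.Binary.Reasoning.Setoid setoid

  Weight : Set (k ⊔ ι)
  Weight = Tree I → Carrier

  τ[_] : I → Weight
  τ[ z ] T = τ (T , z)

  onLeft onRight : I → Weight → Weight
  onLeft  x f T = f (node T x empty)
  onRight x f T = f (node empty x T)

  leaf : I → Tree I
  leaf x = node empty x empty

  -- Only `S` has to be assumed nonempty, as the vertex `v` already makes `T` nonempty.
  Multiplicative : Weight → Set (ℓk ⊔ ι)
  Multiplicative f = ∀ T v y S → S ≢ empty → f (insert T v y S) ≈ f T * τ[ y ] S

  τ[]-multiplicative : ∀ z → Multiplicative τ[ z ]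
  τ[]-multiplicative z T@(node _ _ _) v y S S≢ = τ-∇ (T , z) (S , y) (λ ()) S≢ v

  -- Insertion at `v` inside the subtree `T` is by definition insertion at `left v` in the whole
  -- tree.
  onLeft-multiplicative : ∀ x {f} → Multiplicative f → Multiplicative (onLeft x f)
  onLeft-multiplicative x f-mult T v = f-mult (node T x empty) (left v)

  onRight-multiplicative : ∀ x {f} → Multiplicative f → Multiplicative (onRight x f)
  onRight-multiplicative x f-mult T v = f-mult (node empty x T) (right v)

  multiplicative-root : ∀ {f} → Multiplicative f → ∀ {L} x {R} → L ≢ empty → R ≢ empty →
                        f (node L x R) ≈ f L * τ[ x ] R
  multiplicative-root f-mult {empty}        x L≢ R≢ = ⊥-elim (L≢ ≡.refl)
  multiplicative-root f-mult {L@(node _ _ _)} x L≢ R≢ = f-mult L root x _ R≢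

  -- Words are read backwards. The moments are those determined by the Boolean cumulants
  -- −∑ τ over branches; lastBlock f sums f over all branches filling the last block.
  moment    : Functional
  lastBlock : Weight → Functional
  moment []           = 1#
  moment (z ∷ w)      = - lastBlock τ[ z ] w
  lastBlock f []      = 0#
  lastBlock f (x ∷ w) = f (leaf x) * moment w + (lastBlock (onLeft x f) w + lastBlock (onRight x f) w)

  -- Decomposition at the root `x`: no subtree, a left one, a right one, or both. `mul` describes
  -- how the letters below the root are shared between two nonempty subtrees. The right subtree,
  -- weighted by `τ[ x ]`, is the first factor because backward reading meets it before the left
  -- one.
  record TreeSum (mul : Functional → Functional → Functional) (S : Weight → Functional) :
                 Set (k ⊔ ℓk ⊔ ι) where
    field
      S-[] : ∀ f → S f [] ≈ 0#
      S-∷  : ∀ {f} → Multiplicative f → ∀ x w → S f (x ∷ w) ≈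
             f (leaf x) * δ w + (S (onLeft x f) w + S (onRight x f) w) + mul (S τ[ x ]) (S f) w

  IsLastBlock : (op : (F h φ : Functional) → Functional) → (Weight → Functional) →
                Set (k ⊔ ℓk ⊔ ι)
  IsLastBlock op S = ∀ {f} → Multiplicative f → ∀ w → op moment (S f) moment w ≈ lastBlock f w

  -- The letter x as a binary vertex in the last block cancels x as the end of another block.
  treeSum-isLastBlock : ∀ {op mul S} → Peeling op mul → TreeSum mul S → IsLastBlock op S
  treeSum-isLastBlock {op} {mul} {S} peeling treeSum f-mult w = go _ f-mult w ℕ.≤-refl
    where
    open Peeling peeling
    open TreeSum treeSum
    -- The bound `n` gives the induction hypothesis at all words no longer than the tail, and at all
    -- multiplicative weights; `τ[ x ]`, `onLeft x f` and `onRight x f` are all needed.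
    go : ∀ n {f} → Multiplicative f → ∀ w → length w ≤ n →
         op moment (S f) moment w ≈ lastBlock f w
    go n {f} f-mult [] _ = begin
      op moment (S f) moment [] ≈⟨ op-[] _ _ _ ⟩
      S f [] * 1#               ≈⟨ *-congʳ (S-[] f) ⟩
      0# * 1#                   ≈⟨ zeroˡ _ ⟩
      0#                        ∎
    go (suc n) {f} f-mult (x ∷ w) (s≤s w≤n) = begin
      M (S f) (x ∷ w)
        ≈⟨ op-∷ moment (S f) x w refl ⟩
      op moment (S f) (moment ∘ (x ∷_)) w + M (S f ∘ (x ∷_)) w
        ≈⟨ +-cong x-outside x-inside ⟩
      - C + (c * moment w + (lastBlock (onLeft x f) w + lastBlock (onRight x f) w) + C)
        ≈⟨ +-congˡ (+-comm _ _) ⟩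
      - C + (C + lastBlock f (x ∷ w))
        ≈⟨ +-assoc _ _ _ ⟨
      - C + C + lastBlock f (x ∷ w)
        ≈⟨ +-congʳ (-‿inverseˡ C) ⟩
      0# + lastBlock f (x ∷ w)
        ≈⟨ +-identityˡ _ ⟩
      lastBlock f (x ∷ w) ∎
      where
      M : Functional → Functional
      M h = op moment h moment
      c = f (leaf x)
      C = op moment (S f) (M (S τ[ x ])) w

      -- `moment (x ∷ u)` is by definition `- lastBlock τ[ x ] u`. The induction hypothesis, used
      -- from right to left, turns this into a block sum over `S τ[ x ]`, the shape in which
      -- `op-mul` delivers the term with two subtrees.
      x-outside : op moment (S f) (moment ∘ (x ∷_)) w ≈ - C
      x-outside = trans
        (local-cong w (λ _ _ → refl) (λ _ → refl)
          (λ u u≤w → -‿cong (sym (go n (τ[]-multiplicative x) u (ℕ.≤-trans u≤w w≤n)))))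
        (op-negʳ moment (S f) _ w)

      x-inside : M (S f ∘ (x ∷_)) w ≈
               c * moment w + (lastBlock (onLeft x f) w + lastBlock (onRight x f) w) + C
      x-inside = begin
        M (S f ∘ (x ∷_)) w
          ≈⟨ local-cong w (λ _ _ → refl) (S-∷ f-mult x) (λ _ _ → refl) ⟩
        M (λ u → c * δ u + (S (onLeft x f) u + S (onRight x f) u) + mul (S τ[ x ]) (S f) u) w
          ≈⟨ op-+ _ _ _ _ w ⟩
        M (λ u → c * δ u + (S (onLeft x f) u + S (onRight x f) u)) w + M (mul (S τ[ x ]) (S f)) w
          ≈⟨ +-cong (trans (op-+ _ _ _ _ w) (+-congˡ (op-+ _ _ _ _ w)))
                    (op-mul _ _ _ _ w) ⟩
        M (λ u → c * δ u) w + (M (S (onLeft x f)) w + M (S (onRight x f)) w) + C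
          ≈⟨ +-congʳ (+-cong (op-δ _ c w) (+-cong
               (go n (onLeft-multiplicative x f-mult) w w≤n)
               (go n (onRight-multiplicative x f-mult) w w≤n))) ⟩
        c * moment w + (lastBlock (onLeft x f) w + lastBlock (onRight x f) w) + C ∎

  -- Nothing has to cancel. In an interval partition the next letter lies outside the last block
  -- only if that block is complete, and then the weight is `S f [] ≈ 0#`. The remaining recursion
  -- is that of `lastBlock`.
  branchSum-isLastBlock : ∀ {S} → (∀ f → S f [] ≈ 0#) →
    (∀ f x w → S f (x ∷ w) ≈ f (leaf x) * δ w + (S (onLeft x f) w + S (onRight x f) w)) →
    IsLastBlock (λ _ → _⊙_) S
  branchSum-isLastBlock {S} S-[] S-∷ _ w = go _ w
    where
    open BlockSum ⊙-blockSum
    go : ∀ f w → (S f ⊙ moment) w ≈ lastBlock f w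
    go f [] = trans (+-identityʳ _) (trans (*-congʳ (S-[] f)) (zeroˡ _))
    go f (x ∷ w) = begin
      (S f ⊙ moment) (x ∷ w)
        ≈⟨ ⊙-∷ (S f) moment x w ⟩
      S f [] * moment (x ∷ w) + ((S f ∘ (x ∷_)) ⊙ moment) w
        ≈⟨ +-congʳ (trans (*-congʳ (S-[] f)) (zeroˡ _)) ⟩
      0# + ((S f ∘ (x ∷_)) ⊙ moment) w
        ≈⟨ +-identityˡ _ ⟩
      ((S f ∘ (x ∷_)) ⊙ moment) w
        ≈⟨ ⊙-local-cong w (S-∷ f x) (λ _ _ → refl) ⟩
      ((λ u → f (leaf x) * δ u + (S (onLeft x f) u + S (onRight x f) u)) ⊙ moment) w
        ≈⟨ trans (op-+ moment _ _ _ w) (+-congˡ (op-+ moment _ _ _ w)) ⟩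
      ((λ u → f (leaf x) * δ u) ⊙ moment) w
        + ((S (onLeft x f) ⊙ moment) w + (S (onRight x f) ⊙ moment) w)
        ≈⟨ +-cong (⊙-δ (f (leaf x)) moment w) (+-cong (go _ w) (go _ w)) ⟩
      lastBlock f (x ∷ w) ∎

  -- From cumulants to moments, `F` and `moment` obey the same recursion, so induction on length
  -- applies. Conversely, the error in the cumulant formula has vanishing block sums, and
  -- `triangular` removes it length by length.
  cumulants⇔moments : ∀ {op S} → BlockSum op → IsLastBlock op S → (F κ : Functional) →
    F [] ≈ 1# → (∀ z w → F (z ∷ w) ≈ op F (κ ∘ (z ∷_)) F w) →
    (∀ z w → - κ (z ∷ w) ≈ S τ[ z ] w) ⇔ (∀ w → F w ≈ moment w)
  cumulants⇔moments {op} {S} blockSum isLastBlock F κ F1 F-∷ =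
    mk⇔ (λ κ≈ w → to κ≈ _ w ℕ.≤-refl) (λ F≈ z w → from F≈ z _ w ℕ.≤-refl)
    where
    open BlockSum blockSum

    to : (∀ z w → - κ (z ∷ w) ≈ S τ[ z ] w) → ∀ n w → length w ≤ n → F w ≈ moment w
    to κ≈ n []            _         = F1
    to κ≈ (suc n) (z ∷ w) (s≤s w≤n) = begin
      F (z ∷ w)
        ≈⟨ F-∷ z w ⟩
      op F (κ ∘ (z ∷_)) F w
        ≈⟨ local-cong w F≈ (λ u → trans (sym (-‿involutive _)) (-‿cong (κ≈ z u))) F≈ ⟩
      op moment (-_ ∘ S τ[ z ]) moment w
        ≈⟨ op-negˡ _ _ _ w ⟩
      - op moment (S τ[ z ]) moment w
        ≈⟨ -‿cong (isLastBlock (τ[]-multiplicative z) w) ⟩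
      moment (z ∷ w) ∎
      where
      F≈ : ∀ u → length u ≤ length w → F u ≈ moment u
      F≈ u u≤w = to κ≈ n u (ℕ.≤-trans u≤w w≤n)

    module _ (F≈ : ∀ w → F w ≈ moment w) (z : I) where
      -- The error of the claim `- κ ≈ S τ[ z ]`. Both of its parts have known block sums,
      -- `moment (z ∷ w)` and its negative.
      h : Functional
      h u = κ (z ∷ u) + S τ[ z ] u

      op-h : ∀ w → op moment h moment w ≈ 0#
      op-h w = begin
        op moment h moment w
          ≈⟨ op-+ _ _ _ _ w ⟩
        op moment (κ ∘ (z ∷_)) moment w + op moment (S τ[ z ]) moment w
          ≈⟨ +-cong (local-cong w (λ u _ → F≈ u) (λ _ → refl) (λ u _ → F≈ u))
                    (sym (isLastBlock (τ[]-multiplicative z) w)) ⟨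
        op F (κ ∘ (z ∷_)) F w + lastBlock τ[ z ] w
          ≈⟨ +-congʳ (trans (sym (F-∷ z w)) (F≈ (z ∷ w))) ⟩
        - lastBlock τ[ z ] w + lastBlock τ[ z ] w
          ≈⟨ -‿inverseˡ _ ⟩
        0# ∎

      h≈0 : ∀ n w → length w < n → h w ≈ 0#
      h≈0 (suc n) w (s≤s w≤n) = begin
        h w                  ≈⟨ *-identityʳ _ ⟨
        h w * 1#             ≈⟨ triangular moment h moment w refl
                                  (λ u u<w → h≈0 n u (ℕ.<-≤-trans u<w w≤n)) ⟨
        op moment h moment w ≈⟨ op-h w ⟩
        0#                   ∎

      from : ∀ n w → length w ≤ n → - κ (z ∷ w) ≈ S τ[ z ] w
      from n w w≤n = sym (+-inverseʳ-unique _ _ (h≈0 (suc n) w (s≤s w≤n)))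

-- Binary plane trees and branches

deconcatenationsE : (w : List A) → Enumeration (λ ((u , v) : List A × List A) → u ++ v ≡ w)
deconcatenationsE {A = A} w = record
  { elements = deconcatenations w ; unique = uniq w ; sound = snd w ; complete = cmp _ }
  where
  uniq : (w : List A) → Unique (deconcatenations w)
  uniq []      = [] ∷ []
  uniq (x ∷ w) = All.map⁺ (All.tabulate (λ _ ())) ∷ Unique.map⁺ (λ { ≡.refl → ≡.refl }) (uniq w)

  snd : ∀ w {uv} → uv ∈ deconcatenations w → uncurry _++_ uv ≡ w
  snd []      (here ≡.refl) = ≡.refl
  snd (x ∷ w) (here ≡.refl) = ≡.refl
  snd (x ∷ w) (there uv∈) with _ , uv′∈ , ≡.refl ← ∈.∈-map⁻ (map₁ (x ∷_)) uv∈ =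
    ≡.cong (x ∷_) (snd w uv′∈)

  cmp : ∀ u {v w} → u ++ v ≡ w → (u , v) ∈ deconcatenations w
  cmp []      {[]}    ≡.refl = here ≡.refl
  cmp []      {_ ∷ _} ≡.refl = here ≡.refl
  cmp (x ∷ u)         ≡.refl = there (∈.∈-map⁺ (map₁ (x ∷_)) (cmp u ≡.refl))

-- Postorder read from its end, so that the root is the head and a recursion on words peels it off.
backward : Tree A → List A
backward empty        = []
backward (node l x r) = x ∷ backward r ++ backward l

reverse-postorder : (T : Tree A) → reverse (postorder T) ≡ backward T
reverse-postorder empty        = ≡.refl
reverse-postorder (node l x r) = begin
  reverse (postorder l ++ postorder r ++ x ∷ [])
    ≡⟨ List.reverse-++ (postorder l) _ ⟩
  reverse (postorder r ++ x ∷ []) ++ reverse (postorder l)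
    ≡⟨ ≡.cong (_++ reverse (postorder l)) (List.reverse-++ (postorder r) _) ⟩
  x ∷ reverse (postorder r) ++ reverse (postorder l)
    ≡⟨ ≡.cong₂ (λ u v → x ∷ u ++ v) (reverse-postorder r) (reverse-postorder l) ⟩
  x ∷ backward r ++ backward l ∎
  where open ≡.≡-Reasoning

planarTreesE : (w : List A) → Enumeration (λ T → backward T ≡ w)
planarTreesE w = respE
  (λ { {T} eq → ≡.trans (≡.sym (reverse-postorder T))
      (≡.trans (≡.cong reverse eq) (List.reverse-involutive w)) })
  (λ { {T} ≡.refl →
      ≡.trans (≡.sym (List.reverse-involutive _)) (≡.cong reverse (reverse-postorder T)) })
  (treesE (reverse w))

planarTrees : List A → List (Tree A)
planarTrees w = elements (planarTreesE w)

-- A second list of the same trees, built by cutting at the root. `∑-unique` identifies the sums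
-- over both lists, which yields the root recursion for `planarTrees`.
planarTrees-∷E : (x : A) (w : List A) → Enumeration (λ T → backward T ≡ x ∷ w)
planarTrees-∷E x w = respE
  (λ { (_ , ≡.refl , _ , ≡.refl , _ , ≡.refl , ≡.refl) → ≡.refl })
  (λ { {node l _ r} ≡.refl → _ , ≡.refl , r , ≡.refl , l , ≡.refl , ≡.refl })
  (concatMapE (deconcatenationsE w) (λ (u , v) →
    concatMapE (planarTreesE u) (λ r →
      mapE (λ l → node l x r) (λ { ≡.refl → ≡.refl }) (planarTreesE v))
    λ { (_ , _ , ≡.refl) (_ , _ , ≡.refl) → ≡.refl })
  λ { (_ , ≡.refl , _ , ≡.refl , ≡.refl) (_ , ≡.refl , _ , ≡.refl , ≡.refl) → ≡.refl })

-- The leaf needs its own clause: branches are nonempty, so it does not arise by adding a root to a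
-- smaller branch.
branches : List A → List (Tree A)
branches []              = []
branches (x ∷ [])        = node empty x empty ∷ []
branches (x ∷ w@(_ ∷ _)) =
  List.map (λ T → node T x empty) (branches w) ++ List.map (node empty x) (branches w)

branch-nonempty : ∀ (w : List A) → All (_≢ empty) (branches w)
branch-nonempty []              = []
branch-nonempty (x ∷ [])        = (λ ()) ∷ []
branch-nonempty (x ∷ w@(_ ∷ _)) = All.++⁺
  (All.map⁺ (All.universal (λ _ ()) (branches w))) (All.map⁺ (All.universal (λ _ ()) (branches w)))

isBranch-leaf : (x : A) → IsBranch (node empty x empty)
isBranch-leaf x = (λ ()) , λ
  { root _ root () ; root _ (left ()) _ _ ; (left ()) _ _ _ _ ; (right ()) _ _ _ _ }

isBranch-left : ∀ {T : Tree A} {x} → IsBranch T → IsBranch (node T x empty)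
isBranch-left (T≢ , unary) = (λ ()) , λ
  { _ _ root     leftChild leftChild → ≡.refl
  ; _ _ (left w) (left p)  (left q)  → ≡.cong left (unary _ _ w p q) }

isBranch-right : ∀ {T : Tree A} {x} → IsBranch T → IsBranch (node empty x T)
isBranch-right (T≢ , unary) = (λ ()) , λ
  { _ _ root      rightChild rightChild → ≡.refl
  ; _ _ (right w) (right p)  (right q)  → ≡.cong right (unary _ _ w p q) }

isBranch-left⁻ : ∀ {T : Tree A} {x} → T ≢ empty → IsBranch (node T x empty) → IsBranch T
isBranch-left⁻ T≢ (_ , unary) =
  T≢ , λ u v w p q → left-injective (unary (left u) (left v) (left w) (left p) (left q))

isBranch-right⁻ : ∀ {T : Tree A} {x} → T ≢ empty → IsBranch (node empty x T) → IsBranch T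
isBranch-right⁻ T≢ (_ , unary) =
  T≢ , λ u v w p q → right-injective (unary (right u) (right v) (right w) (right p) (right q))

branchesE : (w : List A) → Enumeration (λ T → backward T ≡ w × IsBranch T)
branchesE {A = A} w = record
  { elements = branches w ; unique = uniq w ; sound = snd w
  ; complete = λ { {T} (≡.refl , isBranch) → cmp T isBranch } }
  where
  uniq : (w : List A) → Unique (branches w)
  uniq []              = []
  uniq (x ∷ [])        = [] ∷ []
  uniq (x ∷ w@(_ ∷ _)) = Unique.++⁺
    (Unique.map⁺ (λ { ≡.refl → ≡.refl }) (uniq w)) (Unique.map⁺ (λ { ≡.refl → ≡.refl }) (uniq w))
    λ (p , q) → let _ , _  , eq = ∈.∈-map⁻ _ p
                    T , T∈ , eq′ = ∈.∈-map⁻ (node empty x) q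
                in All.lookup (branch-nonempty w) T∈ (nodes-right (≡.trans (≡.sym eq′) eq))
    where
    nodes-right : ∀ {l r l′ r′ : Tree A} {x y} → node l x r ≡ node l′ y r′ → r ≡ r′
    nodes-right ≡.refl = ≡.refl

  snd : ∀ w {T} → T ∈ branches w → backward T ≡ w × IsBranch T
  snd (x ∷ [])        (here ≡.refl) = ≡.refl , isBranch-leaf x
  snd (x ∷ w@(_ ∷ _)) T∈ with ∈.∈-++⁻ (List.map (λ T → node T x empty) (branches w)) T∈
  ... | inj₁ T∈ˡ with _ , T′∈ , ≡.refl ← ∈.∈-map⁻ _ T∈ˡ =
    let eq , isBranch = snd w T′∈ in ≡.cong (x ∷_) eq , isBranch-left isBranch
  ... | inj₂ T∈ʳ with _ , T′∈ , ≡.refl ← ∈.∈-map⁻ _ T∈ʳ =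
    let eq , isBranch = snd w T′∈
    in ≡.cong (x ∷_) (≡.trans (List.++-identityʳ _) eq) , isBranch-right isBranch

  cmp : ∀ T → IsBranch T → T ∈ branches (backward T)
  cmp empty                              (T≢ , _) = ⊥-elim (T≢ ≡.refl)
  cmp (node empty x empty)               _        = here ≡.refl
  cmp (node T@(node _ _ _) x empty)      isBranch =
    ∈.∈-++⁺ˡ (∈.∈-map⁺ _ (cmp T (isBranch-left⁻ (λ ()) isBranch)))
  cmp (node empty x T@(node _ _ _))      isBranch =
    ≡.subst (λ u → node empty x T ∈ branches (x ∷ u)) (≡.sym (List.++-identityʳ (backward T)))
      (∈.∈-++⁺ʳ (List.map (λ S → node S x empty) (branches (backward T)))
        (∈.∈-map⁺ (node empty x) (cmp T (isBranch-right⁻ (λ ()) isBranch))))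
  cmp (node (node _ _ _) x (node _ _ _)) (_ , unary)
    with () ← unary (left root) (right root) root leftChild rightChild

-- Letters are listed from the largest label down, so the head is the root and each subtree receives
-- an arbitrary subword of the rest, in the same order. The bound `n` replaces structural recursion,
-- which unshuffles do not permit. Letters may repeat, and the trees are then listed with
-- multiplicity.
boundedDecreasingTrees : ℕ → List A → List (Tree A)
boundedDecreasingTrees n       []      = empty ∷ []
boundedDecreasingTrees zero    (_ ∷ _) = []
boundedDecreasingTrees (suc n) (x ∷ w) = concatMap (λ (u , v) →
  concatMap (λ r → List.map (λ l → node l x r) (boundedDecreasingTrees n v))
            (boundedDecreasingTrees n u))
  (unshuffles w)

decreasingTrees : List A → List (Tree A)
decreasingTrees w = boundedDecreasingTrees (length w) w

boundedDecreasingTrees-stable : ∀ {n m} (w : List A) → length w ≤ n → length w ≤ m →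
  boundedDecreasingTrees n w ≡ boundedDecreasingTrees m w
boundedDecreasingTrees-stable []      _         _         = ≡.refl
boundedDecreasingTrees-stable (x ∷ w) (s≤s w≤n) (s≤s w≤m) =
  ≡.cong List.concat (List.map-cong-local (All.map (λ {(u , v)} (u≤w , v≤w) →
    ≡.cong₂ (λ R L → concatMap (λ r → List.map (λ l → node l x r) L) R)
      (boundedDecreasingTrees-stable u (ℕ.≤-trans u≤w w≤n) (ℕ.≤-trans u≤w w≤m))
      (boundedDecreasingTrees-stable v (ℕ.≤-trans v≤w w≤n) (ℕ.≤-trans v≤w w≤m)))
    (unshuffles-length w)))

decreasingTrees-∷ : (x : A) (w : List A) → decreasingTrees (x ∷ w) ≡ concatMap (λ (u , v) →
  concatMap (λ r → List.map (λ l → node l x r) (decreasingTrees v)) (decreasingTrees u)) (unshuffles w)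
decreasingTrees-∷ x w = ≡.cong List.concat (List.map-cong-local (All.map
  (λ {(u , v)} (u≤w , v≤w) →
    ≡.cong₂ (λ R L → concatMap (λ r → List.map (λ l → node l x r) L) R)
      (boundedDecreasingTrees-stable u u≤w ℕ.≤-refl)
      (boundedDecreasingTrees-stable v v≤w ℕ.≤-refl))
  (unshuffles-length w)))

-- Root recursions for sums over trees

module TreeSums (𝕂 : CommutativeRing k ℓk) {I : Set ι} (τ : BPT I → CommutativeRing.Carrier 𝕂)
                (τ-troupe : IsWeightedTroupe 𝕂 τ) where
  open CommutativeRing 𝕂
  open Sum 𝕂
  open Words 𝕂 I
  open Troupe 𝕂 τ τ-troupe
  open import Relation.Binary.Reasoning.Setoid setoid

  -- The empty tree is excluded by hand, as a weight need not vanish on it: `onLeft x f empty` is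
  -- `f (leaf x)`. For `τ[ z ]` the exclusion changes nothing, by `τ-empty`.
  nonemptySum : (List I → List (Tree I)) → Weight → Functional
  nonemptySum trees f []      = 0#
  nonemptySum trees f (x ∷ w) = sum (trees (x ∷ w)) f

  nodeSum : (List I → List (Tree I)) → Weight → I → List I × List I → Carrier
  nodeSum trees f x (u , v) = sum (trees u) (λ r → sum (trees v) (λ l → f (node l x r)))

  -- Planar and decreasing trees differ only in the ways `pairs` of sharing the letters below the
  -- root between the right and the left subtree. `identityˡ` and `identityʳ` make `δ` a unit of the
  -- resulting product on either side.
  module _ (pairs : List I → List (List I × List I)) (trees : List I → List (Tree I))
    (identityˡ : ∀ (h : Functional) w → sum (pairs w) (λ (u , v) → δ u * h v) ≈ h w)
    (identityʳ : ∀ (h : Functional) w → sum (pairs w) (λ (u , v) → h u * δ v) ≈ h w)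
    (trees-[] : trees [] ≡ empty ∷ [])
    (trees-nonempty : ∀ x w → All (_≢ empty) (trees (x ∷ w)))
    (trees-∷ : ∀ f x w → sum (trees (x ∷ w)) f ≈ sum (pairs w) (nodeSum trees f x))
    where

    private
      S = nonemptySum trees

    sum-[] : ∀ g → sum (trees []) g ≈ g empty
    sum-[] g = trans (reflexive (≡.cong (λ ts → sum ts g) trees-[])) (+-identityʳ _)

    -- One formula for the four cases of empty and nonempty subtrees: `δ` vanishes off `[]` and `S`
    -- vanishes at `[]`, so only the summand of the case at hand is left.
    nodeSum-split : ∀ {f} → Multiplicative f → ∀ x u v → nodeSum trees f x (u , v) ≈
      δ u * (f (leaf x) * δ v) + (δ u * S (onLeft x f) v + S (onRight x f) u * δ v) + S τ[ x ] u * S f v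
    nodeSum-split {f} f-mult x [] [] = begin
      nodeSum trees f x ([] , [])      ≈⟨ trans (sum-[] _) (sum-[] _) ⟩
      f (leaf x)                       ≈⟨ trans (*-identityˡ _) (*-identityʳ _) ⟨
      1# * (f (leaf x) * 1#)           ≈⟨ +-identityʳ _ ⟨
      1# * (f (leaf x) * 1#) + 0#
        ≈⟨ +-congˡ (trans (+-cong (zeroʳ 1#) (zeroˡ 1#)) (+-identityʳ 0#)) ⟨
      1# * (f (leaf x) * 1#) + (1# * 0# + 0# * 1#) ≈⟨ +-identityʳ _ ⟨
      1# * (f (leaf x) * 1#) + (1# * 0# + 0# * 1#) + 0# ≈⟨ +-congˡ (zeroʳ 0#) ⟨
      1# * (f (leaf x) * 1#) + (1# * 0# + 0# * 1#) + 0# * 0# ∎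
    nodeSum-split {f} f-mult x [] v@(_ ∷ _) = begin
      nodeSum trees f x ([] , v)  ≈⟨ sum-[] _ ⟩
      L                           ≈⟨ *-identityˡ L ⟨
      1# * L                      ≈⟨ +-identityʳ _ ⟨
      1# * L + 0#                 ≈⟨ +-congˡ (zeroʳ 0#) ⟨
      1# * L + 0# * 0#            ≈⟨ +-identityˡ _ ⟨
      0# + (1# * L + 0# * 0#)     ≈⟨ +-congʳ (trans (*-identityˡ _) (zeroʳ _)) ⟨
      1# * (f (leaf x) * 0#) + (1# * L + 0# * 0#) ≈⟨ +-identityʳ _ ⟨
      1# * (f (leaf x) * 0#) + (1# * L + 0# * 0#) + 0# ≈⟨ +-congˡ (zeroˡ _) ⟨
      1# * (f (leaf x) * 0#) + (1# * L + 0# * 0#) + 0# * S f v ∎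
      where L = S (onLeft x f) v
    nodeSum-split {f} f-mult x u@(_ ∷ _) [] = begin
      nodeSum trees f x (u , [])  ≈⟨ sum-cong (trees u) (λ r → sum-[] _) ⟩
      R                           ≈⟨ *-identityʳ R ⟨
      R * 1#                      ≈⟨ +-identityˡ _ ⟨
      0# + R * 1#                 ≈⟨ +-congʳ (zeroˡ 0#) ⟨
      0# * 0# + R * 1#            ≈⟨ +-identityˡ _ ⟨
      0# + (0# * 0# + R * 1#)     ≈⟨ +-congʳ (zeroˡ _) ⟨
      0# * (f (leaf x) * 1#) + (0# * 0# + R * 1#) ≈⟨ +-identityʳ _ ⟨
      0# * (f (leaf x) * 1#) + (0# * 0# + R * 1#) + 0# ≈⟨ +-congˡ (zeroʳ _) ⟨
      0# * (f (leaf x) * 1#) + (0# * 0# + R * 1#) + S τ[ x ] u * 0# ∎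
      where R = S (onRight x f) u
    nodeSum-split {f} f-mult x u@(u₀ ∷ u′) v@(v₀ ∷ v′) = begin
      nodeSum trees f x (u , v)
        ≈⟨ sum-congᴬ (All.map (λ {r} r≢ → trans
             (sum-congᴬ (All.map (λ {l} l≢ → multiplicative-root f-mult x l≢ r≢) (trees-nonempty v₀ v′)))
             (trans (sum-*ʳ (trees v) (τ[ x ] r) f) (*-comm _ _))) (trees-nonempty u₀ u′)) ⟩
      sum (trees u) (λ r → τ[ x ] r * S f v)      ≈⟨ sum-*ʳ (trees u) (S f v) τ[ x ] ⟩
      S τ[ x ] u * S f v                          ≈⟨ +-identityˡ _ ⟨
      0# + S τ[ x ] u * S f v                     ≈⟨ +-congʳ (+-identityʳ 0#) ⟨
      0# + 0# + S τ[ x ] u * S f v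
        ≈⟨ +-congʳ (+-cong (zeroˡ _) (trans (+-cong (zeroˡ _) (zeroʳ _)) (+-identityʳ 0#))) ⟨
      0# * (f (leaf x) * 0#) + (0# * S (onLeft x f) v + S (onRight x f) u * 0#)
        + S τ[ x ] u * S f v ∎

    treeSum : TreeSum (λ g h w → sum (pairs w) (λ (u , v) → g u * h v)) S
    treeSum = record
      { S-[] = λ _ → refl
      ; S-∷  = λ {f} f-mult x w → begin
          sum (trees (x ∷ w)) f
            ≈⟨ trees-∷ f x w ⟩
          sum (pairs w) (nodeSum trees f x)
            ≈⟨ sum-cong (pairs w) (λ (u , v) → nodeSum-split f-mult x u v) ⟩
          sum (pairs w) (λ (u , v) →
            δ u * (f (leaf x) * δ v) + (δ u * S (onLeft x f) v + S (onRight x f) u * δ v)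
              + S τ[ x ] u * S f v)
            ≈⟨ trans (sum-+ (pairs w) _ _)
                 (+-congʳ (trans (sum-+ (pairs w) _ _) (+-congˡ (sum-+ (pairs w) _ _)))) ⟩
          sum (pairs w) (λ (u , v) → δ u * (f (leaf x) * δ v))
            + (sum (pairs w) (λ (u , v) → δ u * S (onLeft x f) v)
                + sum (pairs w) (λ (u , v) → S (onRight x f) u * δ v))
            + sum (pairs w) (λ (u , v) → S τ[ x ] u * S f v)
            ≈⟨ +-congʳ (+-cong (identityˡ _ w) (+-cong (identityˡ _ w) (identityʳ _ w))) ⟩
          f (leaf x) * δ w + (S (onLeft x f) w + S (onRight x f) w)
            + sum (pairs w) (λ (u , v) → S τ[ x ] u * S f v) ∎
      }

  planarSum decreasingSum branchSum : Weight → Functional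
  planarSum     = nonemptySum planarTrees
  decreasingSum = nonemptySum decreasingTrees
  branchSum f w = sum (branches w) f

  1*δ : ∀ w → δ w ≈ 1# * δ w
  1*δ w = sym (*-identityˡ _)

  planar-treeSum : TreeSum _⊙_ planarSum
  planar-treeSum = treeSum deconcatenations planarTrees
    (λ h w → trans (⊙-local-cong {φ = h} w 1*δ (λ _ _ → refl)) (trans (⊙-δ 1# h w) (*-identityˡ _)))
    ⊙-identityʳ ≡.refl
    (λ x w → All.tabulate λ {T} T∈ T≡ → ∷≢[]
      (≡.trans (≡.sym (sound (planarTreesE (x ∷ w)) T∈)) (≡.cong backward T≡)))
    λ f x w → trans (∑-unique (planarTreesE (x ∷ w)) (planarTrees-∷E x w) f)
      (trans (sum-concatMap _ (deconcatenations w) f) (sum-cong (deconcatenations w) λ (u , v) →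
        trans (sum-concatMap _ (planarTrees u) f)
          (sum-cong (planarTrees u) λ r → sum-map _ (planarTrees v) f)))
    where
    ∷≢[] : ∀ {x : I} {w : List I} → _≢_ {A = List I} (x ∷ w) []
    ∷≢[] ()
    ⊙-identityʳ : ∀ h w → (h ⊙ δ) w ≈ h w
    ⊙-identityʳ h []      = trans (+-identityʳ _) (*-identityʳ _)
    ⊙-identityʳ h (x ∷ w) = trans (⊙-∷ h δ x w)
      (trans (+-cong (zeroʳ _) (⊙-identityʳ (h ∘ (x ∷_)) w)) (+-identityˡ _))

  decreasing-treeSum : TreeSum _⧢_ decreasingSum
  decreasing-treeSum = treeSum unshuffles decreasingTrees
    (λ h w → trans (⧢-local-cong {φ = h} w 1*δ (λ _ _ → refl)) (trans (⧢-δ 1# h w) (*-identityˡ _)))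
    ⧢-identityʳ ≡.refl
    (λ x w → ≡.subst (All _) (≡.sym (decreasingTrees-∷ x w))
      (All.concat⁺ (All.map⁺ (All.universal (λ (u , v) →
        All.concat⁺ (All.map⁺ (All.universal (λ r →
          All.map⁺ (All.universal (λ _ ()) (decreasingTrees v))) (decreasingTrees u)))) (unshuffles w)))))
    λ f x w → trans (reflexive (≡.cong (λ ts → sum ts f) (decreasingTrees-∷ x w)))
      (trans (sum-concatMap _ (unshuffles w) f) (sum-cong (unshuffles w) λ (u , v) →
        trans (sum-concatMap _ (decreasingTrees u) f)
          (sum-cong (decreasingTrees u) λ r → sum-map _ (decreasingTrees v) f)))
    where
    ⧢-identityʳ : ∀ h w → (h ⧢ δ) w ≈ h w
    ⧢-identityʳ h []      = trans (+-identityʳ _) (*-identityʳ _)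
    ⧢-identityʳ h (x ∷ w) = trans (⧢-∷ h δ x w) (trans (+-cong (⧢-identityʳ (h ∘ (x ∷_)) w)
      (sum-0 (unshuffles w) λ _ → zeroʳ _)) (+-identityʳ _))

  branchSum-∷ : ∀ f x w → branchSum f (x ∷ w) ≈
    f (leaf x) * δ w + (branchSum (onLeft x f) w + branchSum (onRight x f) w)
  branchSum-∷ f x []        = +-cong (sym (*-identityʳ _)) (sym (+-identityʳ 0#))
  branchSum-∷ f x w@(_ ∷ _) = trans
    (trans (sum-++ (List.map (λ T → node T x empty) (branches w)) _ f)
           (+-cong (sum-map (λ T → node T x empty) (branches w) f) (sum-map (node empty x) (branches w) f)))
    (trans (sym (+-identityˡ _)) (+-congʳ (sym (zeroʳ _))))

  ∑-BPTs : ∀ {m} (i : Vec I (suc m)) →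
           ∑ 𝕂 (BPTs i) τ ≈ planarSum τ[ last i ] (reverse (toList (init i)))
  ∑-BPTs i = trans (∑-unique (BPTs i) E τ) (trans (sum-map (_, last i) (planarTrees w) τ) (nonempty w))
    where
    w = reverse (toList (init i))
    E : Enumeration (_∈BPT i)
    E = respE
      (λ { (T , eq , ≡.refl) → record
        { vertex-colours = List.reverse-injective (≡.trans (reverse-postorder T) eq)
        ; ⊟-colour = ≡.refl } })
      (λ { {T , _} record { vertex-colours = eq ; ⊟-colour = ≡.refl } →
        T , ≡.trans (≡.sym (reverse-postorder T)) (≡.cong reverse eq) , ≡.refl })
      (mapE (_, last i) (λ { ≡.refl → ≡.refl }) (planarTreesE w))

    nonempty : ∀ w → sum (planarTrees w) τ[ last i ] ≈ planarSum τ[ last i ] w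
    nonempty []      = trans (+-identityʳ _) (IsWeightedTroupe.τ-empty τ-troupe _)
    nonempty (_ ∷ _) = refl

  ∑-Branches : ∀ {m} (i : Vec I (suc m)) →
               ∑ 𝕂 (Branches i) τ ≈ branchSum τ[ last i ] (reverse (toList (init i)))
  ∑-Branches i = trans (∑-unique (Branches i) E τ) (sum-map (_, last i) (branches w) τ)
    where
    w = reverse (toList (init i))
    E : Enumeration (_∈Branch i)
    E = respE
      (λ { (T , (eq , isBranch) , ≡.refl) → record
        { vertex-colours = List.reverse-injective (≡.trans (reverse-postorder T) eq)
        ; ⊟-colour = ≡.refl } , isBranch })
      (λ { {T , _} (record { vertex-colours = eq ; ⊟-colour = ≡.refl } , isBranch) →
        T , (≡.trans (≡.sym (reverse-postorder T)) (≡.cong reverse eq) , isBranch) , ≡.refl })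
      (mapE (_, last i) (λ { ≡.refl → ≡.refl }) (branchesE w))

-- Decreasing trees

-- The list is a parameter, so a recursively defined list can be shown to enumerate a predicate. In
-- `concatMap-enumerates` the conditions on `f x` are required only where `P x` holds, in contrast
-- to `concatMapE`.
record _Enumerates_ {A : Set a} (xs : List A) (P : Pred A p) : Set (a ⊔ p) where
  constructor enumerates
  field
    uniq : Unique xs
    snd  : ∀ {x} → x ∈ xs → P x
    cmp  : ∀ {x} → P x → x ∈ xs

enumeration : {xs : List A} {P : Pred A p} → xs Enumerates P → Enumeration P
enumeration {xs = xs} (enumerates u s c) = record { elements = xs ; unique = u ; sound = s ; complete = c }

enumerates-resp : {xs : List A} {P : Pred A p} {Q : Pred A q} → P ⊆ Q → Q ⊆ P →
                  xs Enumerates P → xs Enumerates Q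
enumerates-resp P⊆Q Q⊆P (enumerates u s c) = enumerates u (P⊆Q ∘ s) (c ∘ Q⊆P)

concatMap-unique : {f : A → List B} {xs : List A} → Unique xs → (∀ {x} → x ∈ xs → Unique (f x)) →
  (∀ {x y z} → x ∈ xs → y ∈ xs → z ∈ f x → z ∈ f y → x ≡ y) → Unique (concatMap f xs)
concatMap-unique {xs = []} _ _ _ = []
concatMap-unique {f = f} {xs = x ∷ xs} (x≢ ∷ u) uf disj = Unique.++⁺
  (uf (here ≡.refl))
  (concatMap-unique u (uf ∘ there) (λ x∈ y∈ → disj (there x∈) (there y∈)))
  λ (z∈ , z∈′) → let y , y∈ , z∈y = find (∈.∈-concatMap⁻ f {xs = xs} z∈′)
                 in All.lookup x≢ y∈ (disj (here ≡.refl) (there y∈) z∈ z∈y)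

concatMap-enumerates : {f : A → List B} {xs : List A} {P : Pred A p} {Q : A → Pred B q} →
  xs Enumerates P → (∀ {x} → P x → f x Enumerates Q x) →
  (∀ {x y z} → P x → P y → Q x z → Q y z → x ≡ y) →
  concatMap f xs Enumerates (λ z → ∃ λ x → P x × Q x z)
concatMap-enumerates {f = f} {xs} (enumerates u s c) F disj = enumerates
  (concatMap-unique u (λ x∈ → uniq (F (s x∈)))
    (λ x∈ y∈ z∈ z∈′ → disj (s x∈) (s y∈) (snd (F (s x∈)) z∈) (snd (F (s y∈)) z∈′)))
  (λ z∈ → let x , x∈ , z∈x = find (∈.∈-concatMap⁻ f {xs = xs} z∈)
          in x , s x∈ , snd (F (s x∈)) z∈x)
  (λ (x , px , qz) → ∈.∈-concatMap⁺ f (lose (c px) (cmp (F px) qz)))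
  where open _Enumerates_

map-enumerates : {f : A → B} {xs : List A} {P : Pred A p} → (∀ {x y} → f x ≡ f y → x ≡ y) →
  xs Enumerates P → List.map f xs Enumerates (λ z → ∃ λ x → P x × z ≡ f x)
map-enumerates {f = f} inj (enumerates u s c) = enumerates (Unique.map⁺ inj u)
  (λ z∈ → let x , x∈ , eq = ∈.∈-map⁻ f z∈ in x , s x∈ , eq)
  (λ { (x , px , ≡.refl) → ∈.∈-map⁺ f (c px) })

AllPairs-resp-↭ : {R : A → A → Set p} → Symmetric R → {xs ys : List A} → xs ↭ ys →
                  AllPairs R xs → AllPairs R ys
AllPairs-resp-↭ {R = R} R-sym xs↭ys =
  SetoidPerm.AllPairs-resp-↭ (≡.setoid _) R-sym (≡.resp₂ R) (↭⇒↭ₛ xs↭ys)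

Unique-resp-↭ : {xs ys : List A} → xs ↭ ys → Unique xs → Unique ys
Unique-resp-↭ = AllPairs-resp-↭ ≡.≢-sym

Unique-++⁻ : (xs : List A) {ys : List A} → Unique (xs ++ ys) →
             Unique xs × Unique ys × (∀ {x} → x ∈ xs → ¬ x ∈ ys)
Unique-++⁻ []       u = [] , u , λ ()
Unique-++⁻ (x ∷ xs) (x≢ ∷ u) with uxs , uys , disj ← Unique-++⁻ xs u =
  All.++⁻ˡ xs x≢ ∷ uxs , uys ,
  λ { (here ≡.refl) x∈ → All.lookup (All.++⁻ʳ xs x≢) x∈ ≡.refl ; (there x∈) → disj x∈ }

-- Different heads would each lie in the tail of the other list and hence be related both ways.
sorted-unique : {R : A → A → Set p} → (∀ {x y} → R x y → ¬ R y x) → {xs ys : List A} →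
  AllPairs R xs → AllPairs R ys → xs ↭ ys → xs ≡ ys
sorted-unique asym {[]}     []         _          p = ≡.sym (Perm.↭-empty-inv (↭-sym p))
sorted-unique asym {x ∷ xs} {[]}     _ _          p with () ← Perm.↭-empty-inv p
sorted-unique asym {x ∷ xs} {y ∷ ys} (rx ∷ sx) (ry ∷ sy) p
  with Perm.∈-resp-↭ p (here ≡.refl) | Perm.∈-resp-↭ (↭-sym p) (here ≡.refl)
... | here ≡.refl | _           = ≡.cong (x ∷_) (sorted-unique asym sx sy (Perm.drop-∷ p))
... | _           | here ≡.refl = ≡.cong (x ∷_) (sorted-unique asym sx sy (Perm.drop-∷ p))
... | there x∈    | there y∈    = ⊥-elim (asym (All.lookup rx y∈) (All.lookup ry x∈))

unshuffle-↭ : ∀ (w : List A) {u v} → (u , v) ∈ unshuffles w → u ++ v ↭ w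
unshuffle-↭ []      (here ≡.refl) = ↭-refl
unshuffle-↭ (x ∷ w) uv∈ with ∈.∈-++⁻ (List.map (map₁ (x ∷_)) (unshuffles w)) uv∈
... | inj₁ uv∈ˡ with _ , uv∈w , ≡.refl ← ∈.∈-map⁻ _ uv∈ˡ = prep x (unshuffle-↭ w uv∈w)
... | inj₂ uv∈ʳ with (u , v) , uv∈w , ≡.refl ← ∈.∈-map⁻ _ uv∈ʳ =
  ↭-trans (Perm.shift x u v) (prep x (unshuffle-↭ w uv∈w))

-- Puts the letters of two subtrees back into the order they have in `w`; the head of `w` is traced
-- to `p` or to `q`.
↭-unshuffle : ∀ (w : List A) {p q} → p ++ q ↭ w →
  ∃ λ ((u , v) : List A × List A) → (u , v) ∈ unshuffles w × p ↭ u × q ↭ v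
↭-unshuffle []      {p} {q} pq↭ with eq ← Perm.↭-empty-inv pq↭
  rewrite List.++-conicalˡ p q eq | List.++-conicalʳ p q eq =
  ([] , []) , here ≡.refl , ↭-refl , ↭-refl
↭-unshuffle (x ∷ w) {p} {q} pq↭
  with ∈.∈-++⁻ p (Perm.∈-resp-↭ (↭-sym pq↭) (here ≡.refl))
... | inj₁ x∈p with p₁ , p₂ , ≡.refl ← ∈.∈-∃++ x∈p
  with uv , uv∈ , p↭ , q↭ ← ↭-unshuffle w {p₁ ++ p₂} {q} (Perm.drop-∷ (↭-trans
         (↭-sym (Perm.++⁺ʳ q (Perm.shift x p₁ p₂))) pq↭)) =
  map₁ (x ∷_) uv , ∈.∈-++⁺ˡ (∈.∈-map⁺ _ uv∈) , ↭-trans (Perm.shift x p₁ p₂) (prep x p↭) , q↭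
... | inj₂ x∈q with q₁ , q₂ , ≡.refl ← ∈.∈-∃++ x∈q
  with uv , uv∈ , p↭ , q↭ ← ↭-unshuffle w {p} {q₁ ++ q₂} (Perm.drop-∷ (↭-trans
         (↭-sym (↭-trans (Perm.++⁺ˡ p (Perm.shift x q₁ q₂)) (Perm.shift x p (q₁ ++ q₂)))) pq↭)) =
  map₂ (x ∷_) uv , ∈.∈-++⁺ʳ (List.map (map₁ (x ∷_)) (unshuffles w)) (∈.∈-map⁺ _ uv∈) ,
  p↭ , ↭-trans (Perm.shift x q₁ q₂) (prep x q↭)

unshuffle-AllPairs : {R : A → A → Set p} → ∀ w → AllPairs R w → ∀ {u v} → (u , v) ∈ unshuffles w →
                     AllPairs R u × AllPairs R v
unshuffle-AllPairs []      _        (here ≡.refl) = [] , []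
unshuffle-AllPairs (x ∷ w) (rx ∷ s) uv∈ with ∈.∈-++⁻ (List.map (map₁ (x ∷_)) (unshuffles w)) uv∈
... | inj₁ uv∈ˡ with (u , v) , uv∈w , ≡.refl ← ∈.∈-map⁻ _ uv∈ˡ =
  let su , sv = unshuffle-AllPairs w s uv∈w
  in All.++⁻ˡ u (Perm.All-resp-↭ (↭-sym (unshuffle-↭ w uv∈w)) rx) ∷ su , sv
... | inj₂ uv∈ʳ with (u , v) , uv∈w , ≡.refl ← ∈.∈-map⁻ _ uv∈ʳ =
  let su , sv = unshuffle-AllPairs w s uv∈w
  in su , All.++⁻ʳ u (Perm.All-resp-↭ (↭-sym (unshuffle-↭ w uv∈w)) rx) ∷ sv

unshuffles-unique : (w : List A) → Unique w → Unique (unshuffles w)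
unshuffles-unique []      _        = [] ∷ []
unshuffles-unique (x ∷ w) (x≢ ∷ u) = Unique.++⁺
  (Unique.map⁺ (λ { ≡.refl → ≡.refl }) (unshuffles-unique w u))
  (Unique.map⁺ (λ { ≡.refl → ≡.refl }) (unshuffles-unique w u))
  λ (p , q) → let _ , _ , eq = ∈.∈-map⁻ (map₁ (x ∷_)) p
                  _ , q′ , eq′ = ∈.∈-map⁻ (map₂ (x ∷_)) q
                  x∈ = ≡.subst (x ∈_) (≡.cong proj₁ (≡.trans (≡.sym eq) eq′)) (here ≡.refl)
              in All.lookup x≢ (Perm.∈-resp-↭ (unshuffle-↭ w q′) (∈.∈-++⁺ˡ x∈)) ≡.refl

module _ {A : Set a} (_⊐_ : A → A → Set p) where

  -- The root is compared with all letters below it, not just with its children. This form shows at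
  -- once that the root is the maximum; for labels, transitivity gives it from the condition on
  -- children.
  Decreasing : Tree A → Set (a ⊔ p)
  Decreasing empty        = Level.Lift _ ⊤
  Decreasing (node l x r) =
    (All (x ⊐_) (backward r) × All (x ⊐_) (backward l)) × Decreasing r × Decreasing l

  module _ (asym : ∀ {x y} → x ⊐ y → ¬ (y ⊐ x)) where

    -- In a sorted word the head is the maximum, so it is the root of every decreasing tree on these
    -- letters. The reading of such a tree need not be sorted, as labels may be shared between the
    -- subtrees in any way; hence `↭` instead of equality.
    decreasingTrees-enumerates : ∀ n (w : List A) → length w ≤ n → AllPairs _⊐_ w →
      boundedDecreasingTrees n w Enumerates (λ T → backward T ↭ w × Decreasing T)
    decreasingTrees-enumerates n [] _ _ = enumerates ([] ∷ [])
      (λ { (here ≡.refl) → ↭-refl , _ })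
      (λ { {empty} _ → here ≡.refl ; {node _ _ _} (p , _) → ⊥-elim (nonempty p) })
      where
      nonempty : ∀ {x : A} {xs} → ¬ (x ∷ xs ↭ [])
      nonempty p with () ← Perm.↭-empty-inv p
    decreasingTrees-enumerates (suc n) (x ∷ w) (s≤s w≤n) (x⊐ ∷ sorted) = enumerates-resp
      (λ { (_ , uv∈ , r , (r↭ , r-dec) , l , (l↭ , l-dec) , ≡.refl) →
        let below = Perm.All-resp-↭ (↭-sym (↭-trans (Perm.++⁺ r↭ l↭) (unshuffle-↭ w uv∈))) x⊐
        in prep x (↭-trans (Perm.++⁺ r↭ l↭) (unshuffle-↭ w uv∈)) ,
           (All.++⁻ˡ (backward r) below , All.++⁻ʳ (backward r) below) , r-dec , l-dec })
      (λ { {empty} (p , _) → ⊥-elim (nonempty p)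
         ; {node l y r} (p , (y⊐r , y⊐l) , r-dec , l-dec) →
             root-maximal l y r p (All.++⁺ y⊐r y⊐l) r-dec l-dec })
      (concatMap-enumerates {P = _∈ unshuffles w} pairs
        (λ {(u , v)} uv∈ → concatMap-enumerates (rec₁ uv∈)
          (λ {r} _ → map-enumerates {f = λ l → node l x r} (λ { ≡.refl → ≡.refl }) (rec₂ uv∈))
          (λ { _ _ (_ , _ , ≡.refl) (_ , _ , ≡.refl) → ≡.refl }))
        -- A tree determines its unshuffle: `u` and `v` are the sorted rearrangements of the
        -- readings of its right and left subtrees.
        (λ { uv∈ uv∈′ (_ , (r↭ , _) , _ , (l↭ , _) , ≡.refl) (_ , (r↭′ , _) , _ , (l↭′ , _) , ≡.refl) →
          let su , sv = unshuffle-AllPairs w sorted uv∈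
              su′ , sv′ = unshuffle-AllPairs w sorted uv∈′
          in ≡.cong₂ _,_ (sorted-unique asym su su′ (↭-trans (↭-sym r↭) r↭′))
                         (sorted-unique asym sv sv′ (↭-trans (↭-sym l↭) l↭′)) }))
      where
      nonempty : ∀ {x : A} {xs} → ¬ ([] ↭ x ∷ xs)
      nonempty p with () ← Perm.↭-empty-inv (↭-sym p)

      pairs : unshuffles w Enumerates (_∈ unshuffles w)
      pairs = enumerates
        (unshuffles-unique w (AllPairs.map (λ { x⊐x ≡.refl → asym x⊐x x⊐x }) sorted)) id id

      rec₁ : ∀ {u v} → (u , v) ∈ unshuffles w →
             boundedDecreasingTrees n u Enumerates (λ T → backward T ↭ u × Decreasing T)
      rec₁ uv∈ = decreasingTrees-enumerates n _
        (ℕ.≤-trans (proj₁ (All.lookup (unshuffles-length w) uv∈)) w≤n)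
        (proj₁ (unshuffle-AllPairs w sorted uv∈))

      rec₂ : ∀ {u v} → (u , v) ∈ unshuffles w →
             boundedDecreasingTrees n v Enumerates (λ T → backward T ↭ v × Decreasing T)
      rec₂ uv∈ = decreasingTrees-enumerates n _
        (ℕ.≤-trans (proj₂ (All.lookup (unshuffles-length w) uv∈)) w≤n)
        (proj₂ (unshuffle-AllPairs w sorted uv∈))

      root-maximal : ∀ l y r → y ∷ backward r ++ backward l ↭ x ∷ w →
        All (y ⊐_) (backward r ++ backward l) → Decreasing r → Decreasing l →
        ∃ λ ((u , v) : List A × List A) → (u , v) ∈ unshuffles w ×
          (∃ λ r′ → (backward r′ ↭ u × Decreasing r′) ×
           ∃ λ l′ → (backward l′ ↭ v × Decreasing l′) × node l y r ≡ node l′ x r′)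
      root-maximal l y r p y⊐ r-dec l-dec
        with Perm.∈-resp-↭ p (here ≡.refl) | Perm.∈-resp-↭ (↭-sym p) (here ≡.refl)
      ... | there y∈    | there x∈    = ⊥-elim (asym (All.lookup x⊐ y∈) (All.lookup y⊐ x∈))
      ... | there y∈    | here ≡.refl = ⊥-elim (asym (All.lookup x⊐ y∈) (All.lookup x⊐ y∈))
      ... | here ≡.refl | _ with uv , uv∈ , r↭ , l↭ ← ↭-unshuffle w (Perm.drop-∷ p) =
        uv , uv∈ , r , (r↭ , r-dec) , l , (l↭ , l-dec) , ≡.refl

at-∈ : (T : Tree A) (v : Vertex T) → at T v ∈ backward T
at-∈ (node l x r) root      = here ≡.refl
at-∈ (node l x r) (left v)  = there (∈.∈-++⁺ʳ (backward r) (at-∈ l v))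
at-∈ (node l x r) (right v) = there (∈.∈-++⁺ˡ (at-∈ r v))

∈-at : (T : Tree A) {x : A} → x ∈ backward T → ∃ λ v → at T v ≡ x
∈-at (node l x r) (here ≡.refl) = root , ≡.refl
∈-at (node l x r) (there x∈) with ∈.∈-++⁻ (backward r) x∈
... | inj₁ x∈r with v , eq ← ∈-at r x∈r = right v , eq
... | inj₂ x∈l with v , eq ← ∈-at l x∈l = left v , eq

at-injective⇒unique : (T : Tree A) → (∀ {u v} → at T u ≡ at T v → u ≡ v) → Unique (backward T)
at-injective⇒unique empty        inj = []
at-injective⇒unique (node l x r) inj =
  All.++⁺ (All.tabulate λ y∈ x≡y → let v , eq = ∈-at r y∈
            in root≢right (inj {root} {right v} (≡.trans x≡y (≡.sym eq))))
          (All.tabulate λ y∈ x≡y → let v , eq = ∈-at l y∈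
            in root≢left (inj {root} {left v} (≡.trans x≡y (≡.sym eq))))
  ∷ Unique.++⁺ (at-injective⇒unique r (right-injective ∘ inj))
      (at-injective⇒unique l (left-injective ∘ inj))
      λ (y∈r , y∈l) → let u , eq = ∈-at r y∈r
                          v , eq′ = ∈-at l y∈l
                      in left≢right (inj {left v} {right u} (≡.trans eq′ (≡.sym eq)))
  where
  root≢right : ∀ {v} → root {l = l} {x} {r} ≢ right v
  root≢right ()
  root≢left : ∀ {v} → root {l = l} {x} {r} ≢ left v
  root≢left ()
  left≢right : ∀ {u : Vertex l} {v : Vertex r} → _≢_ {A = Vertex (node l x r)} (left u) (right v)
  left≢right ()

unique⇒at-injective : (T : Tree A) → Unique (backward T) → ∀ u v → at T u ≡ at T v → u ≡ v
unique⇒at-injective (node l x r) (x≢ ∷ uq) = go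
  where
  uqr = proj₁ (Unique-++⁻ (backward r) uq)
  uql = proj₁ (proj₂ (Unique-++⁻ (backward r) uq))
  disj = proj₂ (proj₂ (Unique-++⁻ (backward r) uq))
  inL : ∀ v → at l v ∈ backward r ++ backward l
  inL v = ∈.∈-++⁺ʳ (backward r) (at-∈ l v)
  inR : ∀ v → at r v ∈ backward r ++ backward l
  inR v = ∈.∈-++⁺ˡ (at-∈ r v)
  go : ∀ u v → at (node l x r) u ≡ at (node l x r) v → u ≡ v
  go root      root      _  = ≡.refl
  go root      (left v)  eq = ⊥-elim (All.lookup x≢ (inL v) eq)
  go root      (right v) eq = ⊥-elim (All.lookup x≢ (inR v) eq)
  go (left u)  root      eq = ⊥-elim (All.lookup x≢ (inL u) (≡.sym eq))
  go (left u)  (left v)  eq = ≡.cong left (unique⇒at-injective l uql u v eq)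
  go (left u)  (right v) eq = ⊥-elim (disj (at-∈ r v) (≡.subst (_∈ backward l) eq (at-∈ l u)))
  go (right u) root      eq = ⊥-elim (All.lookup x≢ (inR u) (≡.sym eq))
  go (right u) (left v)  eq = ⊥-elim (disj (at-∈ r u) (≡.subst (_∈ backward l) (≡.sym eq) (at-∈ l v)))
  go (right u) (right v) eq = ≡.cong right (unique⇒at-injective r uqr u v eq)

unshuffles-map : (g : A → B) (w : List A) →
  unshuffles (List.map g w) ≡ List.map (λ (u , v) → List.map g u , List.map g v) (unshuffles w)
unshuffles-map g []      = ≡.refl
unshuffles-map g (x ∷ w) rewrite unshuffles-map g w = ≡.sym (≡.trans
  (List.map-++ (λ (u , v) → List.map g u , List.map g v) (List.map (map₁ (x ∷_)) (unshuffles w)) _)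
  (≡.cong₂ _++_ (≡.trans (≡.sym (List.map-∘ (unshuffles w))) (List.map-∘ (unshuffles w)))
                (≡.trans (≡.sym (List.map-∘ (unshuffles w))) (List.map-∘ (unshuffles w)))))

-- Holds even if `g` identifies letters. The enumeration can thus be proved on labelled letters,
-- which are distinct, and the labels forgotten afterwards without losing multiplicities.
boundedDecreasingTrees-map : (g : A → B) (n : ℕ) (w : List A) →
  boundedDecreasingTrees n (List.map g w) ≡ List.map (mapTree g) (boundedDecreasingTrees n w)
boundedDecreasingTrees-map g n       []      = ≡.refl
boundedDecreasingTrees-map g zero    (x ∷ w) = ≡.refl
boundedDecreasingTrees-map g (suc n) (x ∷ w) rewrite unshuffles-map g w = ≡.trans
  (List.concatMap-map _ _ (unshuffles w))
  (≡.trans (List.concatMap-cong (λ (u , v) → step u v) (unshuffles w))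
           (≡.sym (List.map-concatMap (mapTree g) _ (unshuffles w))))
  where
  step : ∀ u v →
    concatMap (λ r → List.map (λ l → node l (g x) r) (boundedDecreasingTrees n (List.map g v)))
              (boundedDecreasingTrees n (List.map g u)) ≡
    List.map (mapTree g) (concatMap (λ r → List.map (λ l → node l x r) (boundedDecreasingTrees n v))
                               (boundedDecreasingTrees n u))
  step u v rewrite boundedDecreasingTrees-map g n u | boundedDecreasingTrees-map g n v = ≡.trans
    (List.concatMap-map _ (mapTree g) (boundedDecreasingTrees n u))
    (≡.trans (List.concatMap-cong (λ r →
        ≡.trans (≡.sym (List.map-∘ (boundedDecreasingTrees n v))) (List.map-∘ (boundedDecreasingTrees n v)))
        (boundedDecreasingTrees n u))
      (≡.sym (List.map-concatMap (mapTree g) _ (boundedDecreasingTrees n u))))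

descending : ∀ m → List (Fin m)
descending zero    = []
descending (suc m) = List.map Fin.suc (descending m) ++ Fin.zero ∷ []

descending-sorted : ∀ m → AllPairs (λ x y → y Fin.< x) (descending m)
descending-sorted zero    = []
descending-sorted (suc m) = AllPairs.++⁺ (AllPairs.map⁺ (AllPairs.map s≤s (descending-sorted m)))
  ([] ∷ []) (All.map⁺ (All.universal (λ _ → s≤s z≤n ∷ []) (descending m)))

∈-descending : ∀ {m} (x : Fin m) → x ∈ descending m
∈-descending {suc m} Fin.zero    = ∈.∈-++⁺ʳ (List.map Fin.suc (descending m)) (here ≡.refl)
∈-descending {suc m} (Fin.suc x) = ∈.∈-++⁺ˡ (∈.∈-map⁺ Fin.suc (∈-descending x))

length-descending : ∀ m → length (descending m) ≡ m
length-descending zero    = ≡.refl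
length-descending (suc m) = ≡.trans (List.length-++ (List.map Fin.suc (descending m)))
  (≡.trans (ℕ.+-comm _ 1) (≡.cong suc
    (≡.trans (List.length-map Fin.suc (descending m)) (length-descending m))))

map-lookup-descending : ∀ {m} (c : Vec A m) → List.map (lookup c) (descending m) ≡ reverse (toList c)
map-lookup-descending []      = ≡.refl
map-lookup-descending (x ∷ c) = ≡.trans (List.map-++ _ (List.map Fin.suc (descending _)) _)
  (≡.trans (≡.cong (_++ x ∷ []) (≡.trans (≡.sym (List.map-∘ (descending _))) (map-lookup-descending c)))
           (≡.sym (List.unfold-reverse x (toList c))))

module _ {I : Set ι} {m : ℕ} where

  _⊐_ : I × Fin m → I × Fin m → Set
  x ⊐ y = proj₂ y Fin.< proj₂ x

  isDecreasing⇒Decreasing : (T : Tree (I × Fin m)) → IsDecreasing T → Decreasing _⊐_ T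
  isDecreasing⇒Decreasing empty        _   = _
  isDecreasing⇒Decreasing (node l x r) dec =
    (below r r-dec (λ { ≡.refl → dec (right root) root rightChild }) ,
     below l l-dec (λ { ≡.refl → dec (left root) root leftChild })) , r-dec , l-dec
    where
    r-dec = isDecreasing⇒Decreasing r (λ u v p → dec (right u) (right v) (right p))
    l-dec = isDecreasing⇒Decreasing l (λ u v p → dec (left u) (left v) (left p))
    below : ∀ T → Decreasing _⊐_ T → (∀ {s y t} → T ≡ node s y t → x ⊐ y) → All (x ⊐_) (backward T)
    below empty        _                   _    = []
    below (node s y t) ((y⊐t , y⊐s) , _) x⊐y =
      x⊐y ≡.refl ∷ All.map (λ z<y → Fin.<-trans z<y (x⊐y ≡.refl)) (All.++⁺ y⊐t y⊐s)

  Decreasing⇒isDecreasing : (T : Tree (I × Fin m)) → Decreasing _⊐_ T → IsDecreasing T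
  Decreasing⇒isDecreasing _ ((_ , x⊐ ∷ _) , _)     _ _ leftChild  = x⊐
  Decreasing⇒isDecreasing _ ((x⊐ ∷ _ , _) , _)     _ _ rightChild = x⊐
  Decreasing⇒isDecreasing _ (_ , _ , l-dec)        _ _ (left p)   = Decreasing⇒isDecreasing _ l-dec _ _ p
  Decreasing⇒isDecreasing _ (_ , r-dec , _)        _ _ (right p)  = Decreasing⇒isDecreasing _ r-dec _ _ p

  module _ (i : Vec I (suc m)) where

    decorate : Fin m → I × Fin m
    decorate l = lookup (init i) l , l

    letters : List (I × Fin m)
    letters = List.map decorate (descending m)

    letters-sorted : AllPairs _⊐_ letters
    letters-sorted = AllPairs.map⁺ (descending-sorted m)

    labelledTreesE : Enumeration (λ T → backward T ↭ letters × Decreasing _⊐_ T)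
    labelledTreesE = enumeration
      (decreasingTrees-enumerates _⊐_ Fin.<-asym (length letters) letters ℕ.≤-refl letters-sorted)

    -- Bijective labels together with colours prescribed by the labels mean that each decorated
    -- letter occurs exactly once.
    isDBPT⇒letters : ∀ {T c} → (T , c) ∈DBPT i → backward T ↭ letters × Decreasing _⊐_ T
    isDBPT⇒letters {T} record { standard = inj , sur ; decreasing = dec ; colours = col } =
      ∼bag⇒↭ (unique∧set⇒bag (at-injective⇒unique T (inj ∘ ≡.cong proj₂))
        (AllPairs.map (λ { x⊐x ≡.refl → Fin.<-irrefl ≡.refl x⊐x }) letters-sorted)
        (mk⇔ to from)) ,
      isDecreasing⇒Decreasing T dec
      where
      to : ∀ {x} → x ∈ backward T → x ∈ letters
      to x∈ with v , ≡.refl ← ∈-at T x∈ =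
        ≡.subst (_∈ letters) (≡.cong (_, label T v) (≡.sym (col v)))
          (∈.∈-map⁺ decorate (∈-descending (label T v)))

      from : ∀ {x} → x ∈ letters → x ∈ backward T
      from x∈ with l , _ , ≡.refl ← ∈.∈-map⁻ decorate x∈ with v , eq ← sur l with eq′ ← eq {v} ≡.refl =
        ≡.subst (_∈ backward T)
          (≡.cong₂ _,_ (≡.trans (col v) (≡.cong (lookup (init i)) eq′)) eq′) (at-∈ T v)

    letters⇒isDBPT : ∀ {T} → backward T ↭ letters × Decreasing _⊐_ T → (T , last i) ∈DBPT i
    letters⇒isDBPT {T} (T↭ , dec) = record
      { vertices   = ≡.trans (≡.sym (length-postorder T))
          (≡.trans (≡.sym (List.length-reverse (postorder T)))
          (≡.trans (≡.cong length (reverse-postorder T)) (≡.trans (Perm.↭-length T↭)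
            (≡.trans (List.length-map decorate (descending m)) (length-descending m)))))
      ; standard   = (λ {u} {v} eq → unique⇒at-injective T
            (Unique-resp-↭ (↭-sym T↭)
              (AllPairs.map (λ { x⊐x ≡.refl → Fin.<-irrefl ≡.refl x⊐x }) letters-sorted))
            u v (≡.cong₂ _,_ (≡.trans (col u) (≡.trans (≡.cong (lookup (init i)) eq) (≡.sym (col v)))) eq))
        , λ l → let v , eq = ∈-at T (Perm.∈-resp-↭ (↭-sym T↭) (∈.∈-map⁺ decorate (∈-descending l)))
                in v , λ { ≡.refl → ≡.cong proj₂ eq }
      ; decreasing = Decreasing⇒isDecreasing T dec
      ; colours    = col
      ; ⊟-colour   = ≡.refl
      }
      where
      col : ∀ v → colour T v ≡ lookup (init i) (label T v)
      col v with l , _ , eq ← ∈.∈-map⁻ decorate (Perm.∈-resp-↭ T↭ (at-∈ T v)) =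
        ≡.trans (≡.cong proj₁ eq) (≡.cong (lookup (init i)) (≡.sym (≡.cong proj₂ eq)))

    DBPTs′ : Enumeration (_∈DBPT i)
    DBPTs′ = respE
      (λ { (T , p , ≡.refl) → letters⇒isDBPT p })
      (λ { {T , _} T∈@(record { ⊟-colour = ≡.refl }) → T , isDBPT⇒letters T∈ , ≡.refl })
      (mapE (_, last i) (λ { ≡.refl → ≡.refl }) labelledTreesE)

module DBPTSum (𝕂 : CommutativeRing k ℓk) {I : Set ι} (τ : BPT I → CommutativeRing.Carrier 𝕂)
                (τ-troupe : IsWeightedTroupe 𝕂 τ) where
  open CommutativeRing 𝕂
  open Sum 𝕂
  open Words 𝕂 I
  open Troupe 𝕂 τ τ-troupe
  open TreeSums 𝕂 τ τ-troupe
  open import Relation.Binary.Reasoning.Setoid setoid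

  ∑-DBPTs : ∀ {m} (i : Vec I (suc m)) → ∑ 𝕂 (DBPTs i) (λ T → τ (underlying T)) ≈
            decreasingSum τ[ last i ] (reverse (toList (init i)))
  ∑-DBPTs {m} i = begin
    ∑ 𝕂 (DBPTs i) (τ ∘ underlying)
      ≈⟨ ∑-unique (DBPTs i) (DBPTs′ i) (τ ∘ underlying) ⟩
    sum (List.map (_, last i) (decreasingTrees (letters i))) (τ ∘ underlying)
      ≈⟨ sum-map (_, last i) (decreasingTrees (letters i)) (τ ∘ underlying) ⟩
    sum (decreasingTrees (letters i)) (τ[ last i ] ∘ mapTree proj₁)
      ≈⟨ sum-map (mapTree proj₁) (decreasingTrees (letters i)) τ[ last i ] ⟨
    sum (List.map (mapTree proj₁) (decreasingTrees (letters i))) τ[ last i ]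
      ≡⟨ ≡.cong (λ ts → sum ts τ[ last i ]) trees-eq ⟩
    sum (decreasingTrees (reverse (toList (init i)))) τ[ last i ]
      ≈⟨ nonempty (reverse (toList (init i))) ⟩
    decreasingSum τ[ last i ] (reverse (toList (init i))) ∎
    where
    word-eq : List.map proj₁ (letters i) ≡ reverse (toList (init i))
    word-eq = ≡.trans (≡.sym (List.map-∘ (descending m))) (map-lookup-descending (init i))

    trees-eq : List.map (mapTree proj₁) (decreasingTrees (letters i)) ≡
               decreasingTrees (reverse (toList (init i)))
    trees-eq = ≡.trans (≡.sym (boundedDecreasingTrees-map proj₁ (length (letters i)) (letters i)))
      (≡.trans (≡.cong (λ n → boundedDecreasingTrees n (List.map proj₁ (letters i)))
                       (≡.sym (List.length-map proj₁ (letters i))))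
               (≡.cong decreasingTrees word-eq))

    nonempty : ∀ w → sum (decreasingTrees w) τ[ last i ] ≈ decreasingSum τ[ last i ] w
    nonempty []      = trans (+-identityʳ _) (IsWeightedTroupe.τ-empty τ-troupe _)
    nonempty (_ ∷ _) = refl

-- Set partitions and the removal of the element 0

-- A list with a focus: the entries before it, the focus itself, the entries after it.
Pointed : Set a → Set a
Pointed A = List A × A × List A

focus : Pointed A → A
focus (_ , x , _) = x

others : Pointed A → List A
others (xs , _ , ys) = xs ++ ys

shiftʳ : A → Pointed A → Pointed A
shiftʳ x (xs , y , ys) = x ∷ xs , y , ys

pointings : List A → List (Pointed A)
pointings []       = []
pointings (x ∷ xs) = ([] , x , xs) ∷ List.map (shiftʳ x) (pointings xs)

∈-pointings⁻ : ∀ xs {z : Pointed A} → z ∈ pointings xs → xs ≡ proj₁ z ++ focus z ∷ proj₂ (proj₂ z)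
∈-pointings⁻ (x ∷ xs) (here ≡.refl) = ≡.refl
∈-pointings⁻ (x ∷ xs) (there z∈) with _ , z′∈ , ≡.refl ← ∈.∈-map⁻ (shiftʳ x) z∈ =
  ≡.cong (x ∷_) (∈-pointings⁻ xs z′∈)

∈-pointings⁺ : ∀ xs {y : A} {ys} → (xs , y , ys) ∈ pointings (xs ++ y ∷ ys)
∈-pointings⁺ []       = here ≡.refl
∈-pointings⁺ (x ∷ xs) = there (∈.∈-map⁺ (shiftʳ x) (∈-pointings⁺ xs))

pointing-↭ : ∀ {xs} {z : Pointed A} → z ∈ pointings xs → xs ↭ focus z ∷ others z
pointing-↭ {xs = xs} {ys , x , zs} z∈ rewrite ∈-pointings⁻ xs z∈ = Perm.shift x ys zs

pointings-distinct : ∀ {xs : List A} → Unique xs → AllPairs (λ y z → focus y ≢ focus z) (pointings xs)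
pointings-distinct {xs = []}     _        = []
pointings-distinct {xs = x ∷ xs} (x≢ ∷ u) =
  All.map⁺ (All.tabulate λ z∈ → All.lookup x≢ (Perm.∈-resp-↭ (↭-sym (pointing-↭ z∈)) (here ≡.refl)))
  ∷ AllPairs.map⁺ (pointings-distinct u)

AllPairs-++⁻ : {R : A → A → Set p} (xs : List A) {ys : List A} → AllPairs R (xs ++ ys) →
               AllPairs R xs × AllPairs R ys × All (λ x → All (R x) ys) xs
AllPairs-++⁻ []       s       = [] , s , []
AllPairs-++⁻ (x ∷ xs) (r ∷ s) with s₁ , s₂ , r₁₂ ← AllPairs-++⁻ xs s =
  All.++⁻ˡ xs r ∷ s₁ , s₂ , All.++⁻ʳ xs r ∷ r₁₂

Dis : Subset n → Subset n → Set
Dis U V = Empty (U ∩ V)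

Dis⁻ : {U V : Subset n} → Dis U V → ∀ {x} → x ∈ₛ U → ¬ x ∈ₛ V
Dis⁻ dis x∈U x∈V = dis (_ , Subset.x∈p∩q⁺ (x∈U , x∈V))

Dis⁺ : {U V : Subset n} → (∀ {x} → x ∈ₛ U → ¬ x ∈ₛ V) → Dis U V
Dis⁺ {U = U} {V} disj (x , x∈) = let x∈U , x∈V = Subset.x∈p∩q⁻ U V x∈ in disj x∈U x∈V

Dis-sym : {U V : Subset n} → Dis U V → Dis V U
Dis-sym dis = Dis⁺ λ x∈V x∈U → Dis⁻ dis x∈U x∈V

Dis-∷⁺ : ∀ s (U V : Subset n) → Dis U V → Dis (s ∷ U) (outside ∷ V)
Dis-∷⁺ s U V dis = Dis⁺ {U = s ∷ U} {outside ∷ V}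
  λ { (Vec.there x∈) (Vec.there y∈) → Dis⁻ {U = U} {V} dis x∈ y∈ }

Dis-∷⁻ : ∀ s t (U V : Subset n) → Dis (s ∷ U) (t ∷ V) → Dis U V
Dis-∷⁻ s t U V dis =
  Dis⁺ {U = U} {V} λ x∈ y∈ → Dis⁻ {U = s ∷ U} {t ∷ V} dis (Vec.there x∈) (Vec.there y∈)

share⇒≡ : {π : List (Subset n)} → AllPairs Dis π → ∀ {U V x} → U ∈ π → V ∈ π →
          x ∈ₛ U → x ∈ₛ V → U ≡ V
share⇒≡ (d ∷ ds) (here ≡.refl) (here ≡.refl) x∈U x∈V = ≡.refl
share⇒≡ (d ∷ ds) (here ≡.refl) (there V∈)    x∈U x∈V = ⊥-elim (Dis⁻ (All.lookup d V∈) x∈U x∈V)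
share⇒≡ (d ∷ ds) (there U∈)    (here ≡.refl) x∈U x∈V = ⊥-elim (Dis⁻ (All.lookup d U∈) x∈V x∈U)
share⇒≡ (d ∷ ds) (there U∈)    (there V∈)    x∈U x∈V = share⇒≡ ds U∈ V∈ x∈U x∈V

least : (U : Subset n) → Nonempty U → ∃ λ x → x ∈ₛ U × ∀ y → y ∈ₛ U → x Fin.≤ y
least (inside ∷ U)  _       = Fin.zero , Vec.here , λ _ _ → z≤n
least (outside ∷ U) (Fin.suc x , Vec.there x∈)
  with y , y∈ , y≤ ← least U (x , x∈) =
  Fin.suc y , Vec.there y∈ , λ { (Fin.suc z) (Vec.there z∈) → s≤s (y≤ z z∈) }

≺-asym : {U V : Subset n} → U ≺ V → ¬ V ≺ U
≺-asym (x , x∈ , x<) (y , y∈ , y<) = Fin.<-asym (x< y y∈) (y< x x∈)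

≺-trans : {U V W : Subset n} → U ≺ V → V ≺ W → U ≺ W
≺-trans (x , x∈ , x<) (y , y∈ , y<) = x , x∈ , λ z z∈ → Fin.<-trans (x< y y∈) (y< z z∈)

≺-total : {U V : Subset n} → Nonempty U → Nonempty V → Dis U V → U ≺ V ⊎ V ≺ U
≺-total {U = U} {V} U≠∅ V≠∅ dis with x , x∈ , x≤ ← least U U≠∅ | y , y∈ , y≤ ← least V V≠∅
  with Fin.<-cmp x y
... | tri< x<y _ _  = inj₁ (x , x∈ , λ z z∈ → ℕ.<-≤-trans x<y (y≤ z z∈))
... | tri≈ _ ≡.refl _ = ⊥-elim (Dis⁻ dis x∈ y∈)
... | tri> _ _ y<x  = inj₂ (y , y∈ , λ z z∈ → ℕ.<-≤-trans y<x (x≤ z z∈))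

partition-unique : {π : List (Subset n)} → IsPartition π → Unique π
partition-unique P = AllPairs.map (λ { U≺U ≡.refl → ≺-asym U≺U U≺U }) (IsPartition.ordered P)

partition-↭ : {π π′ : List (Subset n)} → IsPartition π → IsPartition π′ → π ↭ π′ → π ≡ π′
partition-↭ P P′ = sorted-unique ≺-asym (IsPartition.ordered P) (IsPartition.ordered P′)

lift : List (Subset n) → List (Subset (suc n))
lift = List.map (outside ∷_)

cons₀ : Subset n → List (Subset n) → List (Subset (suc n))
cons₀ V ρ = (inside ∷ V) ∷ lift ρ

fresh : List (Subset n) → List (Subset (suc n))
fresh = cons₀ Subset.⊥

-- The extended block moves to the front because it now contains the least element.
glue : Pointed (Subset n) → List (Subset (suc n))
glue z = cons₀ (focus z) (others z)

lift-injective : {ρ ρ′ : List (Subset n)} → lift ρ ≡ lift ρ′ → ρ ≡ ρ′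
lift-injective = List.map-injective Vec.∷-injectiveʳ

cons₀-injective : {U V : Subset n} {ρ ρ′ : List (Subset n)} → cons₀ U ρ ≡ cons₀ V ρ′ → U ≡ V × ρ ≡ ρ′
cons₀-injective eq = Vec.∷-injectiveʳ (List.∷-injectiveˡ eq) , lift-injective (List.∷-injectiveʳ eq)

-- What is left of a partition when 0 is removed from its first block. That block may become empty,
-- and its rank among the others is no longer known, so `nonempty` and `ordered` concern `ρ` alone.
record PrePartition (V : Subset n) (ρ : List (Subset n)) : Set where
  field
    nonempty : All Nonempty ρ
    disjoint : AllPairs Dis (V ∷ ρ)
    covering : ∀ x → Any (x ∈ₛ_) (V ∷ ρ)
    ordered  : AllPairs _≺_ ρ

isPartition-cons₀⁺ : {V : Subset n} {ρ : List (Subset n)} → PrePartition V ρ → IsPartition (cons₀ V ρ)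
isPartition-cons₀⁺ {V = V} {ρ} P = record
  { nonempty = (Fin.zero , Vec.here) ∷ All.map⁺ (All.map (λ (x , x∈) → Fin.suc x , Vec.there x∈) nonempty)
  ; disjoint = case disjoint of λ { (d ∷ ds) →
      All.map⁺ (All.map (λ {W} → Dis-∷⁺ inside V W) d)
      ∷ AllPairs.map⁺ (AllPairs.map (λ {U} {W} → Dis-∷⁺ outside U W) ds) }
  ; covering = λ { Fin.zero → here Vec.here ; (Fin.suc x) → cover x (covering x) }
  ; ordered  = All.map⁺ (All.universal (λ W → Fin.zero , Vec.here , λ { _ (Vec.there _) → s≤s z≤n }) ρ)
      ∷ AllPairs.map⁺ (AllPairs.map (λ (x , x∈ , x<) →
          Fin.suc x , Vec.there x∈ , λ { _ (Vec.there y∈) → s≤s (x< _ y∈) }) ordered)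
  }
  where
  open PrePartition P
  cover : ∀ x → Any (x ∈ₛ_) (V ∷ ρ) → Any (Fin.suc x ∈ₛ_) (cons₀ V ρ)
  cover x (here x∈)  = here (Vec.there x∈)
  cover x (there x∈) = there (Any.map⁺ (Any.map Vec.there x∈))

isPartition-cons₀⁻ : {V : Subset n} {ρ : List (Subset n)} → IsPartition (cons₀ V ρ) → PrePartition V ρ
isPartition-cons₀⁻ {V = V} {ρ}
  record { nonempty = _ ∷ ne ; disjoint = d ∷ ds ; covering = cov ; ordered = _ ∷ ord } = record
  { nonempty = All.map (λ { (_ , Vec.there x∈) → _ , x∈ }) (All.map⁻ ne)
  ; disjoint = All.map (λ {W} → Dis-∷⁻ inside outside V W) (All.map⁻ d)
      ∷ AllPairs.map (λ {U} {W} → Dis-∷⁻ outside outside U W) (AllPairs.map⁻ ds)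
  ; covering = λ x → cover x (cov (Fin.suc x))
  ; ordered  = AllPairs.map (λ { (_ , Vec.there x∈ , x<) →
        _ , x∈ , λ y y∈ → ℕ.s<s⁻¹ (x< (Fin.suc y) (Vec.there y∈)) })
      (AllPairs.map⁻ ord)
  }
  where
  cover : ∀ x → Any (Fin.suc x ∈ₛ_) (cons₀ V ρ) → Any (x ∈ₛ_) (V ∷ ρ)
  cover x (here (Vec.there x∈)) = here x∈
  cover x (there x∈)            = there (Any.map (λ { (Vec.there y∈) → y∈ }) (Any.map⁻ x∈))

-- The order by least elements puts the block of 0 first, and disjointness keeps 0 out of the
-- others.
isPartition⇒cons₀ : {σ : List (Subset (suc n))} → IsPartition σ → ∃ λ V → ∃ λ ρ → σ ≡ cons₀ V ρ
isPartition⇒cons₀ {σ = []} P with () ← IsPartition.covering P Fin.zero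
isPartition⇒cons₀ {σ = (outside ∷ U) ∷ σ} record { covering = cov ; ordered = U≺ ∷ _ } with cov Fin.zero
... | there 0∈ with W , W∈ , 0∈W ← find 0∈ with x , _ , x< ← All.lookup U≺ W∈ with () ← x< Fin.zero 0∈W
isPartition⇒cons₀ {σ = (inside ∷ V) ∷ σ} record { disjoint = d ∷ _ } = V , lower σ d
  where
  lower : ∀ σ → All (Dis (inside ∷ V)) σ → ∃ λ ρ → (inside ∷ V) ∷ σ ≡ cons₀ V ρ
  lower []                    []        = [] , ≡.refl
  lower ((inside ∷ W) ∷ σ)  (dis ∷ _) = ⊥-elim (Dis⁻ dis Vec.here Vec.here)
  lower ((outside ∷ W) ∷ σ) (_ ∷ d) with ρ , eq ← lower σ d =
    W ∷ ρ , ≡.cong (λ τ → (inside ∷ V) ∷ (outside ∷ W) ∷ τ) (List.∷-injectiveʳ eq)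

fresh-prePartition : {π : List (Subset n)} → IsPartition π → PrePartition Subset.⊥ π
fresh-prePartition {π = π} P = record
  { nonempty = nonempty ; disjoint = All.universal (λ _ → Dis⁺ λ x∈ _ → Subset.∉⊥ x∈) π ∷ disjoint
  ; covering = there ∘ covering ; ordered = ordered }
  where open IsPartition P

prePartition-fresh : {π : List (Subset n)} → PrePartition Subset.⊥ π → IsPartition π
prePartition-fresh P = record
  { nonempty = nonempty ; disjoint = AllPairs.tail disjoint ; ordered = ordered
  ; covering = λ x → Any.tail Subset.∉⊥ (covering x) }
  where open PrePartition P

glue-prePartition : {π : List (Subset n)} {z : Pointed (Subset n)} → IsPartition π → z ∈ pointings π →
                    PrePartition (focus z) (others z)
glue-prePartition {π = π} {xs , V , ys} P z∈ = record
  { nonempty = All.tail (Perm.All-resp-↭ π↭ nonempty)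
  ; disjoint = AllPairs-resp-↭ Dis-sym π↭ disjoint
  ; covering = λ x → Perm.Any-resp-↭ π↭ (covering x)
  ; ordered  = remove (≡.subst (AllPairs _≺_) (∈-pointings⁻ π z∈) ordered)
  }
  where
  open IsPartition P
  π↭ = pointing-↭ z∈
  remove : AllPairs _≺_ (xs ++ V ∷ ys) → AllPairs _≺_ (xs ++ ys)
  remove s with s₁ , _ ∷ s₂ , r ← AllPairs-++⁻ xs s = AllPairs.++⁺ s₁ s₂ (All.map All.tail r)

-- Once 0 is removed, its block must return to the place given by its new least element; this undoes
-- the move to the front in `glue`.
insertBlock : (V : Subset n) (ρ : List (Subset n)) → All (λ W → V ≺ W ⊎ W ≺ V) ρ → AllPairs _≺_ ρ →
  ∃ λ ((xs , ys) : List (Subset n) × List (Subset n)) → xs ++ ys ≡ ρ × AllPairs _≺_ (xs ++ V ∷ ys)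
insertBlock V []      _                 _ = ([] , []) , ≡.refl , [] ∷ []
insertBlock V (W ∷ ρ) (inj₁ V≺W ∷ _)    s@(W≺ ∷ _) =
  ([] , W ∷ ρ) , ≡.refl , (V≺W ∷ All.map (≺-trans V≺W) W≺) ∷ s
insertBlock V (W ∷ ρ) (inj₂ W≺V ∷ cmp′) (W≺ ∷ s)
  with (xs , ys) , ≡.refl , s′ ← insertBlock V ρ cmp′ s =
  (W ∷ xs , ys) , ≡.refl , All.++⁺ (All.++⁻ˡ xs W≺) (W≺V ∷ All.++⁻ʳ xs W≺) ∷ s′

prePartition-glue : {V : Subset n} {ρ : List (Subset n)} → PrePartition V ρ → Nonempty V →
  ∃ λ π → ∃ λ z → IsPartition π × z ∈ pointings π × focus z ≡ V × others z ≡ ρ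
prePartition-glue {V = V} {ρ} P V≠∅
  with (xs , ys) , ≡.refl , s ← insertBlock V ρ
         (All.zipWith (λ (W≠∅ , dis) → ≺-total V≠∅ W≠∅ dis)
           (PrePartition.nonempty P , AllPairs.head (PrePartition.disjoint P)))
         (PrePartition.ordered P) =
  xs ++ V ∷ ys , (xs , V , ys) , record
    { nonempty = Perm.All-resp-↭ ↭π (V≠∅ ∷ nonempty)
    ; disjoint = AllPairs-resp-↭ Dis-sym ↭π disjoint
    ; covering = λ x → Perm.Any-resp-↭ ↭π (covering x)
    ; ordered  = s
    } , ∈-pointings⁺ xs , ≡.refl , ≡.refl
  where
  open PrePartition P
  ↭π : V ∷ xs ++ ys ↭ xs ++ V ∷ ys
  ↭π = ↭-sym (Perm.shift V xs ys)

children : (List (Subset n) → List (Pointed (Subset n))) →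
           List (Subset n) → List (List (Subset (suc n)))
children allowed π = fresh π ∷ List.map glue (allowed π)

-- A class of partitions stable under removal of the element 0 from its block; allowed π lists the
-- blocks of π to which 0 may be added.
record IsHereditary (P : ∀ {n} → Pred (List (Subset n)) p)
                    (allowed : ∀ {n} → List (Subset n) → List (Pointed (Subset n))) : Set p where
  field
    isPartition : ∀ {n} {π : List (Subset n)} → P π → IsPartition π
    P-[]        : P {0} []
    allowed⊆    : ∀ {n} {π : List (Subset n)} {z} → z ∈ allowed π → z ∈ pointings π
    distinct    : ∀ {n} {π : List (Subset n)} → Unique π →
                  AllPairs (λ y z → focus y ≢ focus z) (allowed π)
    fresh⁺      : ∀ {n} {π : List (Subset n)} → P π → P (fresh π)
    fresh⁻      : ∀ {n} {π : List (Subset n)} → P (fresh π) → P π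
    glue⁺       : ∀ {n} {π : List (Subset n)} {z} → P π → z ∈ allowed π → P (glue z)
    glue⁻       : ∀ {n} {π : List (Subset n)} {z} → IsPartition π → z ∈ pointings π → P (glue z) →
                  P π × z ∈ allowed π

partitionsBy : (∀ {n} → List (Subset n) → List (Pointed (Subset n))) → ∀ n → List (List (Subset n))
partitionsBy allowed zero    = [] ∷ []
partitionsBy allowed (suc n) = concatMap (children allowed) (partitionsBy allowed n)

module _ {P : ∀ {n} → Pred (List (Subset n)) p}
         {allowed : ∀ {n} → List (Subset n) → List (Pointed (Subset n))}
         (hereditary : IsHereditary P allowed) where
  open IsHereditary hereditary

  focus≢⊥ : {π : List (Subset n)} → P π → ∀ {z} → z ∈ allowed π → Subset.⊥ ≢ focus z
  focus≢⊥ Pπ z∈ ⊥≡ =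
    let x , x∈ = All.head (Perm.All-resp-↭ (pointing-↭ (allowed⊆ z∈))
                                           (IsPartition.nonempty (isPartition Pπ)))
    in Subset.∉⊥ (≡.subst (x ∈ₛ_) (≡.sym ⊥≡) x∈)

  children-enumerates : {π : List (Subset n)} → P π →
    children allowed π Enumerates (λ σ → P σ × (σ ≡ fresh π ⊎ ∃ λ z → z ∈ allowed π × σ ≡ glue z))
  children-enumerates {π = π} Pπ = enumerates
    (All.map⁺ (All.tabulate (λ {z} z∈ eq → focus≢⊥ Pπ z∈ (proj₁ (cons₀-injective eq))))
      ∷ AllPairs.map⁺ (AllPairs.map (λ ≢ eq → ≢ (proj₁ (cons₀-injective eq)))
          (distinct (partition-unique (isPartition Pπ)))))
    (λ { (here ≡.refl) → fresh⁺ Pπ , inj₁ ≡.refl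
       ; (there σ∈) → let z , z∈ , eq = ∈.∈-map⁻ glue σ∈
                      in ≡.subst P (≡.sym eq) (glue⁺ Pπ z∈) , inj₂ (z , z∈ , eq) })
    (λ { (_ , inj₁ ≡.refl) → here ≡.refl ; (_ , inj₂ (z , z∈ , ≡.refl)) → there (∈.∈-map⁺ glue z∈) })

  -- Every partition arises from exactly one parent, obtained by removing 0. It is `fresh` if 0 was
  -- a singleton and `glue` otherwise; as blocks are nonempty, the two cannot coincide.
  partitionsBy-enumerates : ∀ n → partitionsBy allowed n Enumerates P
  partitionsBy-enumerates zero    = enumerates ([] ∷ []) (λ { (here ≡.refl) → P-[] })
    (λ { {[]} _ → here ≡.refl
       ; {U ∷ π} Pπ → ⊥-elim (no-blocks (All.head (IsPartition.nonempty (isPartition Pπ)))) })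
    where
    no-blocks : {U : Subset 0} → ¬ Nonempty U
    no-blocks (() , _)
  partitionsBy-enumerates (suc n) = enumerates-resp (λ (_ , _ , Pσ , _) → Pσ) remove₀
    (concatMap-enumerates (partitionsBy-enumerates n) children-enumerates parent-unique)
    where
    parent-unique : ∀ {π π′ σ} → P π → P π′ →
      P σ × (σ ≡ fresh π ⊎ ∃ λ z → z ∈ allowed π × σ ≡ glue z) →
      P σ × (σ ≡ fresh π′ ⊎ ∃ λ z → z ∈ allowed π′ × σ ≡ glue z) → π ≡ π′
    parent-unique Pπ Pπ′ (_ , inj₁ ≡.refl) (_ , inj₁ eq) = proj₂ (cons₀-injective eq)
    parent-unique Pπ Pπ′ (_ , inj₁ ≡.refl) (_ , inj₂ (z , z∈ , eq)) =
      ⊥-elim (focus≢⊥ Pπ′ z∈ (proj₁ (cons₀-injective eq)))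
    parent-unique Pπ Pπ′ (_ , inj₂ (z , z∈ , ≡.refl)) (_ , inj₁ eq) =
      ⊥-elim (focus≢⊥ Pπ z∈ (≡.sym (proj₁ (cons₀-injective eq))))
    -- Both parents consist of the same blocks, and a partition is determined by its blocks up to
    -- order.
    parent-unique Pπ Pπ′ (_ , inj₂ (z , z∈ , ≡.refl)) (_ , inj₂ (z′ , z′∈ , eq)) =
      let focus≡ , others≡ = cons₀-injective eq
      in partition-↭ (isPartition Pπ) (isPartition Pπ′) (↭-trans (pointing-↭ (allowed⊆ z∈))
           (↭-trans (↭-reflexive (≡.cong₂ _∷_ focus≡ others≡)) (↭-sym (pointing-↭ (allowed⊆ z′∈)))))

    remove₀ : ∀ {σ} → P σ →
      ∃ λ π → P π × P σ × (σ ≡ fresh π ⊎ ∃ λ z → z ∈ allowed π × σ ≡ glue z)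
    remove₀ Pσ with V , ρ , ≡.refl ← isPartition⇒cons₀ (isPartition Pσ) with Subset.nonempty? V
    ... | no V≡∅ with ≡.refl ← Subset.Empty-unique V≡∅ = ρ , fresh⁻ Pσ , Pσ , inj₁ ≡.refl
    ... | yes V≠∅ with π , z , Pπ , z∈ , ≡.refl , ≡.refl ←
            prePartition-glue (isPartition-cons₀⁻ (isPartition Pσ)) V≠∅ =
      let Pπ′ , z∈′ = glue⁻ Pπ z∈ Pσ in π , Pπ′ , Pσ , inj₂ (z , z∈′ , ≡.refl)

-- All, interval and noncrossing partitions

isPartition-[] : IsPartition {0} []
isPartition-[] = record { nonempty = [] ; disjoint = [] ; covering = λ () ; ordered = [] }

Π-hereditary : IsHereditary IsPartition pointings
Π-hereditary = record
  { isPartition = id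
  ; P-[]        = isPartition-[]
  ; allowed⊆    = id
  ; distinct    = pointings-distinct
  ; fresh⁺      = isPartition-cons₀⁺ ∘ fresh-prePartition
  ; fresh⁻      = prePartition-fresh ∘ isPartition-cons₀⁻
  ; glue⁺       = λ P z∈ → isPartition-cons₀⁺ (glue-prePartition P z∈)
  ; glue⁻       = λ P z∈ _ → P , z∈
  }

-- The only block of an interval partition next to the new least element is the first one.
first : ∀ {a} {A : Set a} → List A → List (Pointed A)
first []       = []
first (x ∷ xs) = ([] , x , xs) ∷ []

Convex : Subset n → Set
Convex U = ∀ a b c → a Fin.≤ b → b Fin.≤ c → a ∈ₛ U → c ∈ₛ U → b ∈ₛ U

convex-outside : {U : Subset n} → Convex U → Convex (outside ∷ U)
convex-outside cvx (Fin.suc a) (Fin.suc b) (Fin.suc c) (s≤s a≤b) (s≤s b≤c) (Vec.there a∈) (Vec.there c∈) =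
  Vec.there (cvx a b c a≤b b≤c a∈ c∈)

convex-tail : ∀ {s} {U : Subset n} → Convex (s ∷ U) → Convex U
convex-tail cvx a b c a≤b b≤c a∈ c∈ =
  Subset.drop-there (cvx (Fin.suc a) (Fin.suc b) (Fin.suc c) (s≤s a≤b) (s≤s b≤c)
                         (Vec.there a∈) (Vec.there c∈))

Int-hereditary : IsHereditary IsInterval first
Int-hereditary = record
  { isPartition = proj₁
  ; P-[]        = isPartition-[] , []
  ; allowed⊆    = λ { {π = _ ∷ _} (here ≡.refl) → here ≡.refl }
  ; distinct    = λ { {π = []} _ → [] ; {π = _ ∷ _} _ → [] ∷ [] }
  ; fresh⁺      = λ (P , cvx) → fresh⁺ P , convex-inside-⊥ ∷ All.map⁺ (All.map convex-outside cvx)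
  ; fresh⁻      = λ { (P , _ ∷ cvx) → fresh⁻ P , All.map convex-tail (All.map⁻ cvx) }
  ; glue⁺       = λ { {π = V ∷ ρ} (P , cvx-V ∷ cvx) (here ≡.refl) →
      glue⁺ P (here ≡.refl) , convex-inside P cvx-V ∷ All.map⁺ (All.map convex-outside cvx) }
  ; glue⁻       = λ { {π = π} {z} P z∈ (_ , cvx-V ∷ cvx) →
      (P , Perm.All-resp-↭ (↭-sym (pointing-↭ z∈))
             (convex-tail cvx-V ∷ All.map convex-tail (All.map⁻ cvx)))
      , first-∈ P z∈ cvx-V }
  }
  where
  open IsHereditary Π-hereditary using (fresh⁺; fresh⁻; glue⁺; glue⁻)

  convex-inside-⊥ : Convex (inside ∷ Subset.⊥ {n})
  convex-inside-⊥ _ Fin.zero    _           _ _ _ _              = Vec.here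
  convex-inside-⊥ _ (Fin.suc _) (Fin.suc _) _ _ _ (Vec.there c∈) = ⊥-elim (Subset.∉⊥ c∈)

  -- If some `b` below `c` were in a later block, the first block `V` would contain an element below
  -- `b` as well as `c`, so convexity puts `b` into `V`.
  convex-inside : {V : Subset n} {ρ : List (Subset n)} → IsPartition (V ∷ ρ) → Convex V → Convex (inside ∷ V)
  convex-inside P cvx _ Fin.zero    _           _ _         _ _ = Vec.here
  convex-inside P cvx _ (Fin.suc b) (Fin.suc c) _ (s≤s b≤c) _ (Vec.there c∈) with IsPartition.covering P b
  ... | here b∈  = Vec.there b∈
  ... | there b∈ with W , W∈ , b∈W ← find b∈
                 with x , x∈ , x< ← All.lookup (AllPairs.head (IsPartition.ordered P)) W∈ =
    Vec.there (cvx x b c (ℕ.<⇒≤ (x< b b∈W)) b≤c x∈ c∈)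

  -- If the extended block is not first, the first block has an element `w` below all of it;
  -- convexity with 0 would force `w` into both.
  first-∈ : {π : List (Subset n)} → IsPartition π → ∀ {z} → z ∈ pointings π →
            Convex (inside ∷ focus z) → z ∈ first π
  first-∈ {π = V ∷ ρ} P (here ≡.refl) _ = here ≡.refl
  first-∈ {π = W ∷ ρ} P (there z∈)  cvx
    with z , z∈′ , ≡.refl ← ∈.∈-map⁻ (shiftʳ W) z∈ =
    ⊥-elim (Dis⁻ {U = W} (All.lookup (AllPairs.head (IsPartition.disjoint P)) V∈ρ) w∈ (Subset.drop-there
      (cvx Fin.zero (Fin.suc w) (Fin.suc v) z≤n (s≤s (ℕ.<⇒≤ (w< v v∈))) Vec.here (Vec.there v∈))))
    where
    V∈ρ : focus z ∈ ρ
    V∈ρ = Perm.∈-resp-↭ (↭-sym (pointing-↭ z∈′)) (here ≡.refl)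
    w≺ = All.lookup (AllPairs.head (IsPartition.ordered P)) V∈ρ
    w = proj₁ w≺
    w∈ = proj₁ (proj₂ w≺)
    w< = proj₂ (proj₂ w≺)
    V≠∅ = All.lookup (All.tail (IsPartition.nonempty P)) V∈ρ
    v = proj₁ V≠∅
    v∈ = proj₂ V≠∅

-- `W` has elements on both sides of an element of `V`. If 0 joins `V`, then 0 followed by `b`, `c`,
-- `d` is a crossing.
Covers : Subset n → Subset n → Set
Covers {n} W V = ∃ λ (b : Fin n) → ∃ λ (c : Fin n) → ∃ λ (d : Fin n) →
  (b Fin.< c × c Fin.< d) × b ∈ₛ W × c ∈ₛ V × d ∈ₛ W

Covered : List (Subset n) → Subset n → Set
Covered π V = Any (λ W → W ≢ V × Covers W V) π

outer? : (π : List (Subset n)) (V : Subset n) → Dec (¬ Covered π V)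
outer? π V = ¬? (Any.any? (λ W → ¬? (Vec.≡-dec Bool._≟_ W V) ×-dec
  Fin.any? λ b → Fin.any? λ c → Fin.any? λ d →
    ((b Fin.<? c) ×-dec (c Fin.<? d)) ×-dec
    (b Subset.∈? W) ×-dec (c Subset.∈? V) ×-dec (d Subset.∈? W)) π)

outers : List (Subset n) → List (Pointed (Subset n))
outers π = filter (outer? π ∘ focus) (pointings π)

covers-∷⁺ : ∀ {s t} {U V : Subset n} → Covers U V → Covers (s ∷ U) (t ∷ V)
covers-∷⁺ (b , c , d , (b<c , c<d) , b∈ , c∈ , d∈) =
  Fin.suc b , Fin.suc c , Fin.suc d , (s≤s b<c , s≤s c<d) , Vec.there b∈ , Vec.there c∈ , Vec.there d∈

-- Relates a partition π of {1, …, n} to the partition cons₀ V ρ obtained by adding 0 to its block V,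
-- or as a singleton if V is empty.
module Cons₀ {V : Subset n} {ρ π : List (Subset n)}
  (disjoint : AllPairs Dis (cons₀ V ρ))
  (tail-∈ : ∀ {W x} → W ∈ cons₀ V ρ → x ∈ₛ Vec.tail W → Vec.tail W ∈ π)
  (∈-tail : ∀ {W} → W ∈ π → ∃ λ W′ → W′ ∈ cons₀ V ρ × Vec.tail W′ ≡ W)
  where

  tail-injective : ∀ {U W x} → U ∈ cons₀ V ρ → W ∈ cons₀ V ρ → x ∈ₛ Vec.tail U →
                   Vec.tail U ≡ Vec.tail W → U ≡ W
  tail-injective {_ ∷ U} {_ ∷ W} {x} U∈ W∈ x∈ ≡.refl =
    share⇒≡ disjoint U∈ W∈ (Vec.there x∈) (Vec.there x∈)

  crossing⁺ : Crossing π → Crossing (cons₀ V ρ)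
  crossing⁺ (a , b , c , d , (a<b , b<c , c<d) , cr)
    with U , U∈ , (a∈ , c∈) , cr′ ← find cr
    with W , W∈ , W≢U , b∈ , d∈ ← find cr′
    with (_ ∷ _) , U′∈ , ≡.refl ← ∈-tail U∈
    with (_ ∷ _) , W′∈ , ≡.refl ← ∈-tail W∈ =
    Fin.suc a , Fin.suc b , Fin.suc c , Fin.suc d , (s≤s a<b , s≤s b<c , s≤s c<d) ,
    lose U′∈ ((Vec.there a∈ , Vec.there c∈) ,
      lose W′∈ ((λ eq → W≢U (≡.cong Vec.tail eq)) , Vec.there b∈ , Vec.there d∈))

  -- In a crossing 0 can only be the least of the four elements. Its block is then the extended one,
  -- and the other block covers `V`.
  crossing⁻ : Crossing (cons₀ V ρ) → Crossing π ⊎ Covered π V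
  crossing⁻ (a , Fin.suc b , Fin.suc c , Fin.suc d , (a<b , s≤s b<c , s≤s c<d) , cr)
    with U , U∈ , (a∈ , Vec.there c∈) , cr′ ← find cr
    with W , W∈ , W≢U , Vec.there b∈ , Vec.there d∈ ← find cr′ = go a a<b a∈ U∈
    where
    tailW≢ : Vec.tail W ≢ Vec.tail U
    tailW≢ eq = W≢U (tail-injective W∈ U∈ b∈ eq)
    go : ∀ a → a Fin.< Fin.suc b → a ∈ₛ U → U ∈ cons₀ V ρ → Crossing π ⊎ Covered π V
    go (Fin.suc a) (s≤s a<b) (Vec.there a∈) U∈ = inj₁ (a , b , c , d , (a<b , b<c , c<d) ,
      lose (tail-∈ U∈ c∈) ((a∈ , c∈) , lose (tail-∈ W∈ b∈) (tailW≢ , b∈ , d∈)))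
    go Fin.zero _ _ (here ≡.refl) =
      inj₂ (lose (tail-∈ W∈ b∈) (tailW≢ , b , c , d , (b<c , c<d) , b∈ , c∈ , d∈))
    go Fin.zero _ 0∈ (there U∈) with _ , _ , ≡.refl ← ∈.∈-map⁻ (outside ∷_) U∈ with () ← 0∈

  covered⇒crossing : Covered π V → Crossing (cons₀ V ρ)
  covered⇒crossing cov
    with W , W∈ , W≢V , b , c , d , (b<c , c<d) , b∈ , c∈ , d∈ ← find cov
    with (_ ∷ _) , W′∈ , ≡.refl ← ∈-tail W∈ =
    Fin.zero , Fin.suc b , Fin.suc c , Fin.suc d , (s≤s z≤n , s≤s b<c , s≤s c<d) ,
    here ((Vec.here , Vec.there c∈) ,
      lose W′∈ ((λ eq → W≢V (≡.cong Vec.tail eq)) , Vec.there b∈ , Vec.there d∈))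

  covered-head : Covered (cons₀ V ρ) (inside ∷ V) → Covered π V
  covered-head (here (≢ , _)) = ⊥-elim (≢ ≡.refl)
  covered-head (there cov)
    with W′ , W′∈ , W′≢ , b , c , d , (b<c , c<d) , b∈ , c∈ , d∈ ← find cov
    with W , W∈ , ≡.refl ← ∈.∈-map⁻ (outside ∷_) W′∈
    with Vec.there b∈ ← b∈ | Vec.there c∈ ← c∈ | Vec.there d∈ ← d∈ =
    lose (tail-∈ (there W′∈) b∈) ((λ eq → W′≢ (tail-injective (there W′∈) (here ≡.refl) b∈ eq)) ,
      _ , _ , _ , (ℕ.s<s⁻¹ b<c , ℕ.s<s⁻¹ c<d) , b∈ , c∈ , d∈)

  covered-outside⁺ : ∀ {W} → Covered π W → Covered (cons₀ V ρ) (outside ∷ W)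
  covered-outside⁺ cov
    with X , X∈ , X≢W , X-covers ← find cov
    with (_ ∷ _) , X′∈ , ≡.refl ← ∈-tail X∈ =
    lose X′∈ ((λ eq → X≢W (≡.cong Vec.tail eq)) , covers-∷⁺ X-covers)

  -- The only new way to cover `W` is by the extended block with 0 as left end. The hypothesis
  -- replaces 0 by an element of `V`; it holds if `V` precedes `W`, and vacuously if `V` is empty.
  covered-outside⁻ : ∀ {W} → W ∈ ρ → (∀ {c d} → c ∈ₛ W → d ∈ₛ V → ∃ λ b → b ∈ₛ V × b Fin.< c) →
                     Covered (cons₀ V ρ) (outside ∷ W) → Covered π W
  covered-outside⁻ {W} W∈ V<W cov
    with X , X∈ , X≢W , b , Fin.suc c , Fin.suc d , (b<c , s≤s c<d) ,
         b∈ , Vec.there c∈ , Vec.there d∈ ← find cov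
    = go X∈ b b<c b∈
    where
    W′∈ : outside ∷ W ∈ cons₀ V ρ
    W′∈ = there (∈.∈-map⁺ (outside ∷_) W∈)

    tailX≢W : Vec.tail X ≢ W
    tailX≢W eq = X≢W (tail-injective X∈ W′∈ d∈ eq)

    go : X ∈ cons₀ V ρ → ∀ b → b Fin.< Fin.suc c → b ∈ₛ X → Covered π W
    go _ (Fin.suc b) (s≤s b<c) (Vec.there b∈) =
      lose (tail-∈ X∈ d∈) (tailX≢W , b , c , d , (b<c , c<d) , b∈ , c∈ , d∈)
    go (here ≡.refl) Fin.zero _ _ with b , b∈ , b<c ← V<W c∈ d∈ =
      lose (tail-∈ X∈ d∈) (tailX≢W , b , c , d , (b<c , c<d) , b∈ , c∈ , d∈)
    go (there X∈′) Fin.zero _ 0∈ with _ , _ , ≡.refl ← ∈.∈-map⁻ (outside ∷_) X∈′ with () ← 0∈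

module Fresh {π : List (Subset n)} (P : IsPartition π) where

  private
    tail-∈ : ∀ {W x} → W ∈ fresh π → x ∈ₛ Vec.tail W → Vec.tail W ∈ π
    tail-∈ (here ≡.refl) x∈ = ⊥-elim (Subset.∉⊥ x∈)
    tail-∈ (there W∈)    _ with _ , W∈π , ≡.refl ← ∈.∈-map⁻ (outside ∷_) W∈ = W∈π

    ∈-tail : ∀ {W} → W ∈ π → ∃ λ W′ → W′ ∈ fresh π × Vec.tail W′ ≡ W
    ∈-tail W∈ = _ , there (∈.∈-map⁺ (outside ∷_) W∈) , ≡.refl

  open Cons₀ {V = Subset.⊥} {π} {π}
    (IsPartition.disjoint (isPartition-cons₀⁺ (fresh-prePartition P))) tail-∈ ∈-tail public

  ⊥-outer : ¬ Covered π Subset.⊥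
  ⊥-outer cov with _ , _ , _ , _ , _ , _ , _ , _ , c∈ , _ ← find cov = Subset.∉⊥ c∈

module Glue {π : List (Subset n)} {z} (P : IsPartition π) (z∈ : z ∈ pointings π) where

  private
    tail-∈ : ∀ {W x} → W ∈ glue z → x ∈ₛ Vec.tail W → Vec.tail W ∈ π
    tail-∈ (here ≡.refl) _ = Perm.∈-resp-↭ (↭-sym (pointing-↭ z∈)) (here ≡.refl)
    tail-∈ (there W∈)    _ with _ , W∈ρ , ≡.refl ← ∈.∈-map⁻ (outside ∷_) W∈ =
      Perm.∈-resp-↭ (↭-sym (pointing-↭ z∈)) (there W∈ρ)

    ∈-tail : ∀ {W} → W ∈ π → ∃ λ W′ → W′ ∈ glue z × Vec.tail W′ ≡ W
    ∈-tail W∈ with Perm.∈-resp-↭ (pointing-↭ z∈) W∈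
    ... | here ≡.refl = _ , here ≡.refl , ≡.refl
    ... | there W∈ρ   = _ , there (∈.∈-map⁺ (outside ∷_) W∈ρ) , ≡.refl

  open Cons₀ {V = focus z} {others z} {π}
    (IsPartition.disjoint (isPartition-cons₀⁺ (glue-prePartition P z∈))) tail-∈ ∈-tail public

NC-hereditary : IsHereditary IsNoncrossing outers
NC-hereditary = record
  { isPartition = proj₁
  ; P-[]        = isPartition-[] , λ ()
  ; allowed⊆    = λ {_} {π} z∈ → proj₁ (∈.∈-filter⁻ (outer? π ∘ focus) z∈)
  ; distinct    = λ {_} {π} u → AllPairs.filter⁺ (outer? π ∘ focus) (pointings-distinct u)
  ; fresh⁺      = λ (P , ¬cr) → fresh⁺ P , [ ¬cr , Fresh.⊥-outer P ]′ ∘ Fresh.crossing⁻ P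
  ; fresh⁻      = λ (P , ¬cr) → fresh⁻ P , ¬cr ∘ Fresh.crossing⁺ (fresh⁻ P)
  ; glue⁺       = λ {_} {π} (P , ¬cr) z∈ → let z∈π , outer = ∈.∈-filter⁻ (outer? π ∘ focus) z∈
      in glue⁺ P z∈π , [ ¬cr , outer ]′ ∘ Glue.crossing⁻ P z∈π
  ; glue⁻       = λ {_} {π} P z∈ (_ , ¬cr) → (P , ¬cr ∘ Glue.crossing⁺ P z∈) ,
      ∈.∈-filter⁺ (outer? π ∘ focus) z∈ (¬cr ∘ Glue.covered⇒crossing P z∈)
  }
  where
  open IsHereditary Π-hereditary using (fresh⁺; fresh⁻; glue⁺; glue⁻)

-- A block flagged true is outer, that is, adding 0 to it creates no crossing; adding 0 to an outer
-- block covers exactly the blocks preceding it in the list.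
flag : List (Subset n) → Subset n → Bool × Subset n
flag π V = does (outer? π V) , V

flagged : List (Subset n) → List (Bool × Subset n)
flagged π = List.map (flag π) π

lift′ : List (Bool × Subset n) → List (Bool × Subset (suc n))
lift′ = List.map (map₂ (outside ∷_))

flagged-fresh : {π : List (Subset n)} → IsPartition π →
  flagged (fresh π) ≡ (true , inside ∷ Subset.⊥) ∷ lift′ (flagged π)
flagged-fresh {π = π} P = ≡.cong₂ _∷_
  (≡.cong (_, inside ∷ Subset.⊥) (dec-true (outer? (fresh π) _) (⊥-outer ∘ covered-head)))
  (≡.trans (≡.sym (List.map-∘ π)) (≡.trans
    (List.map-cong-local (All.tabulate λ {W} W∈ → ≡.cong (_, _)
      (does-⇔ (mk⇔ (_∘ covered-outside⁺) (_∘ covered-outside⁻ W∈ λ _ d∈ → ⊥-elim (Subset.∉⊥ d∈)))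
        (outer? (fresh π) (outside ∷ W)) (outer? π W))))
    (List.map-∘ π)))
  where open Fresh P

flagged-glue : {π : List (Subset n)} → IsPartition π → ∀ {U V W} → (U , V , W) ∈ outers π →
  flagged (glue (U , V , W)) ≡ (true , inside ∷ V) ∷ lift′ (List.map (false ,_) U ++ List.map (flag π) W)
flagged-glue {π = π} P {U} {V} {W} z∈ = ≡.cong₂ _∷_
  (≡.cong (_, inside ∷ V) (dec-true (outer? σ _) (outer ∘ covered-head)))
  (≡.trans (≡.trans (≡.sym (List.map-∘ (U ++ W))) (List.map-++ _ U W))
    (≡.trans (≡.cong₂ _++_
      (≡.trans (List.map-cong-local (All.tabulate λ {X} X∈ → ≡.cong (_, _)
          (dec-false (outer? σ (outside ∷ X)) λ ¬cov → ¬cov (hidden X∈)))) (List.map-∘ U))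
      (≡.trans (List.map-cong-local (All.tabulate λ {X} X∈ → ≡.cong (_, _)
          (does-⇔ (mk⇔ (_∘ covered-outside⁺) 
            (_∘ covered-outside⁻ (∈.∈-++⁺ʳ U X∈) (λ c∈ _ → behind X∈ c∈)))
            (outer? σ (outside ∷ X)) (outer? π X)))) (List.map-∘ W)))
      (≡.sym (List.map-++ (map₂ (outside ∷_)) (List.map (false ,_) U) _))))
  where
  z∈π = proj₁ (∈.∈-filter⁻ (outer? π ∘ focus) z∈)
  outer = proj₂ (∈.∈-filter⁻ (outer? π ∘ focus) {xs = pointings π} z∈)
  open Glue P z∈π
  σ = glue (U , V , W)

  ordered = AllPairs-++⁻ U (≡.subst (AllPairs _≺_) (∈-pointings⁻ π z∈π) (IsPartition.ordered P))

  -- A block before `V` has an element below all of `V`, so that element lies between 0 and any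
  -- element of `V`.
  hidden : ∀ {X} → X ∈ U → Covered σ (outside ∷ X)
  hidden X∈
    with c , c∈ , c< ← All.head (All.lookup (proj₂ (proj₂ ordered)) X∈)
    with d , d∈ ← All.head (Perm.All-resp-↭ (pointing-↭ z∈π) (IsPartition.nonempty P)) =
    here ((λ ()) , Fin.zero , Fin.suc c , Fin.suc d , (s≤s z≤n , s≤s (c< d d∈)) ,
          Vec.here , Vec.there c∈ , Vec.there d∈)

  behind : ∀ {X c} → X ∈ W → c ∈ₛ X → ∃ λ b → b ∈ₛ V × b Fin.< c
  behind X∈ c∈ with b , b∈ , b< ← All.lookup (AllPairs.head (proj₁ (proj₂ ordered))) X∈ = b , b∈ , b< _ c∈

-- Pointed and flagged lists

mapPointed : (A → B) → Pointed A → Pointed B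
mapPointed g (xs , y , zs) = List.map g xs , g y , List.map g zs

pointings-map : (g : A → B) (xs : List A) →
  pointings (List.map g xs) ≡ List.map (mapPointed g) (pointings xs)
pointings-map g []       = ≡.refl
pointings-map g (x ∷ xs) = ≡.cong₂ _∷_ ≡.refl
  (≡.trans (≡.cong (List.map (shiftʳ (g x))) (pointings-map g xs))
  (≡.trans (≡.sym (List.map-∘ (pointings xs))) (List.map-∘ (pointings xs))))

first-map : (g : A → B) (xs : List A) → first (List.map g xs) ≡ List.map (mapPointed g) (first xs)
first-map g []      = ≡.refl
first-map g (_ ∷ _) = ≡.refl

-- The choices of an outer block to receive the next letter, each with the other blocks as they are
-- afterwards: those before the chosen block are enclosed and so flagged `false`, those after it
-- keep their flag.
reopen : List (Bool × A) → List (A × List (Bool × A))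
reopen []               = []
reopen ((false , x) ∷ xs) = List.map (map₂ ((false , x) ∷_)) (reopen xs)
reopen ((true  , x) ∷ xs) = (x , xs) ∷ List.map (map₂ ((false , x) ∷_)) (reopen xs)

close : List (Bool × A) → List (Bool × A)
close xs = List.map (false ,_) (List.map proj₂ xs)

reopen-map : (g : A → B) (xs : List (Bool × A)) →
  reopen (List.map (map₂ g) xs) ≡ List.map (λ (y , ys) → g y , List.map (map₂ g) ys) (reopen xs)
reopen-map g [] = ≡.refl
reopen-map g ((false , x) ∷ xs) = ≡.trans (≡.cong (List.map _) (reopen-map g xs))
  (≡.trans (≡.sym (List.map-∘ (reopen xs))) (List.map-∘ (reopen xs)))
reopen-map g ((true , x) ∷ xs) = ≡.cong₂ _∷_ ≡.refl (≡.trans (≡.cong (List.map _) (reopen-map g xs))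
  (≡.trans (≡.sym (List.map-∘ (reopen xs))) (List.map-∘ (reopen xs))))

reopen-++-closed : (xs : List (Bool × A)) (ys : List A) →
  reopen (xs ++ List.map (false ,_) ys) ≡ List.map (map₂ (_++ List.map (false ,_) ys)) (reopen xs)
reopen-++-closed []                 []       = ≡.refl
reopen-++-closed []                 (y ∷ ys) = ≡.cong (List.map _) (reopen-++-closed [] ys)
reopen-++-closed ((false , x) ∷ xs) ys       = ≡.trans (≡.cong (List.map _) (reopen-++-closed xs ys))
  (≡.trans (≡.sym (List.map-∘ (reopen xs))) (List.map-∘ (reopen xs)))
reopen-++-closed ((true , x) ∷ xs)  ys       =
  ≡.cong₂ _∷_ ≡.refl (≡.trans (≡.cong (List.map _) (reopen-++-closed xs ys))
  (≡.trans (≡.sym (List.map-∘ (reopen xs))) (List.map-∘ (reopen xs))))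

reopen-∷ʳ-open : (xs : List (Bool × A)) (y : A) →
  reopen (xs ++ (true , y) ∷ []) ≡ List.map (map₂ (_++ (true , y) ∷ [])) (reopen xs) ++ (y , close xs) ∷ []
reopen-∷ʳ-open []                 y = ≡.refl
reopen-∷ʳ-open ((false , x) ∷ xs) y = ≡.trans (≡.cong (List.map _) (reopen-∷ʳ-open xs y))
  (≡.trans (List.map-++ _ (List.map _ (reopen xs)) _)
    (≡.cong (λ zs → zs ++ (y , close ((false , x) ∷ xs)) ∷ [])
      (≡.trans (≡.sym (List.map-∘ (reopen xs))) (List.map-∘ (reopen xs)))))
reopen-∷ʳ-open ((true , x) ∷ xs)  y =
  ≡.cong₂ _∷_ ≡.refl (≡.trans (≡.cong (List.map _) (reopen-∷ʳ-open xs y))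
  (≡.trans (List.map-++ _ (List.map _ (reopen xs)) _)
    (≡.cong (λ zs → zs ++ (y , close ((true , x) ∷ xs)) ∷ [])
      (≡.trans (≡.sym (List.map-∘ (reopen xs))) (List.map-∘ (reopen xs))))))

filter-map : {Q : Pred B p} (Q? : Decidable Q) (f : A → B) (xs : List A) →
  filter Q? (List.map f xs) ≡ List.map f (filter (Q? ∘ f) xs)
filter-map Q? f [] = ≡.refl
filter-map Q? f (x ∷ xs) with does (Q? (f x))
... | true  = ≡.cong (f x ∷_) (filter-map Q? f xs)
... | false = filter-map Q? f xs

module _ {Q : Pred A p} (Q? : Decidable Q) where

  flags : List A → List (Bool × A)
  flags = List.map (λ x → does (Q? x) , x)

  reopenAt : Pointed A → A × List (Bool × A)
  reopenAt (us , x , vs) = x , List.map (false ,_) us ++ flags vs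

  reopen-later : (x : A) (xs : List A) →
    reopen (flags xs) ≡ List.map reopenAt (filter (Q? ∘ focus) (pointings xs)) →
    List.map (map₂ ((false , x) ∷_)) (reopen (flags xs)) ≡
    List.map reopenAt (filter (Q? ∘ focus) (List.map (shiftʳ x) (pointings xs)))
  reopen-later x xs eq = ≡.trans (≡.cong (List.map (map₂ ((false , x) ∷_))) eq)
    (≡.trans (≡.sym (List.map-∘ (filter (Q? ∘ focus) (pointings xs))))
      (≡.trans (List.map-∘ (filter (Q? ∘ focus) (pointings xs)))
        (≡.cong (List.map reopenAt) (≡.sym (filter-map (Q? ∘ focus) (shiftʳ x) (pointings xs))))))

  -- Flags alone determine the admissible extensions, so the scan for noncrossing partitions can
  -- forget which positions the blocks occupy.
  reopen-flags : (xs : List A) → reopen (flags xs) ≡ List.map reopenAt (filter (Q? ∘ focus) (pointings xs))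
  reopen-flags [] = ≡.refl
  reopen-flags (x ∷ xs) with does (Q? x)
  ... | true  = ≡.cong₂ _∷_ ≡.refl (reopen-later x xs (reopen-flags xs))
  ... | false = reopen-later x xs (reopen-flags xs)

subword : Vec A n → Subset n → List A
subword xs U = toList (restrict U xs)

subword-⊥ : (xs : Vec A n) → subword xs Subset.⊥ ≡ []
subword-⊥ []       = ≡.refl
subword-⊥ (x ∷ xs) = subword-⊥ xs

-- Moments as sums over the last block

blocks : List (Subset n) → Vec A n → List (List A)
blocks π xs = List.map (subword xs) π

flaggedBlocks : List (Subset n) → Vec A n → List (Bool × List A)
flaggedBlocks π xs = List.map (map₂ (subword xs)) (flagged π)

blocks-cons₀ : ∀ V (ρ : List (Subset n)) (xs : Vec A n) x →
  blocks (cons₀ V ρ) (x ∷ xs) ≡ (x ∷ subword xs V) ∷ blocks ρ xs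
blocks-cons₀ V ρ xs x = ≡.cong₂ _∷_ ≡.refl (≡.sym (List.map-∘ ρ))

blocks-fresh : ∀ (π : List (Subset n)) (xs : Vec A n) x →
  blocks (fresh π) (x ∷ xs) ≡ (x ∷ []) ∷ blocks π xs
blocks-fresh π xs x = ≡.trans (blocks-cons₀ Subset.⊥ π xs x)
  (≡.cong (λ u → (x ∷ u) ∷ blocks π xs) (subword-⊥ xs))

blocks-glue : ∀ z (xs : Vec A n) x → blocks (glue z) (x ∷ xs) ≡
  (x ∷ focus (mapPointed (subword xs) z)) ∷ others (mapPointed (subword xs) z)
blocks-glue z@(U , V , W) xs x = ≡.trans (blocks-cons₀ V (others z) xs x)
  (≡.cong ((x ∷ subword xs V) ∷_) (List.map-++ (subword xs) U W))

flaggedBlocks-fresh : ∀ {π : List (Subset n)} → IsPartition π → (xs : Vec A n) → ∀ x →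
  flaggedBlocks (fresh π) (x ∷ xs) ≡ (true , x ∷ []) ∷ flaggedBlocks π xs
flaggedBlocks-fresh {π = π} P xs x =
  ≡.trans (≡.cong (List.map (map₂ (subword (x ∷ xs)))) (flagged-fresh P))
    (≡.cong₂ _∷_ (≡.cong (λ u → true , x ∷ u) (subword-⊥ xs)) (≡.sym (List.map-∘ (flagged π))))

flaggedBlocks-glue : ∀ {π : List (Subset n)} → IsPartition π → (xs : Vec A n) → ∀ x {z} → z ∈ outers π →
  flaggedBlocks (glue z) (x ∷ xs) ≡ (true , x ∷ subword xs (focus z)) ∷
    List.map (map₂ (subword xs)) (proj₂ (reopenAt (outer? π) z))
flaggedBlocks-glue {π = π} P xs x {z} z∈ =
  ≡.trans (≡.cong (List.map (map₂ (subword (x ∷ xs)))) (flagged-glue P z∈))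
    (≡.cong₂ _∷_ ≡.refl (≡.sym (List.map-∘ (proj₂ (reopenAt (outer? π) z)))))

-- Building partitions letter by letter, and the block containing the last letter

module BlockWeights (𝕂 : CommutativeRing k ℓk) {I : Set ι} (c : List I → CommutativeRing.Carrier 𝕂) where
  open CommutativeRing 𝕂
  open Sum 𝕂
  open Words 𝕂 I
  open SemigroupProperties *-commutativeSemigroup using () renaming (x∙yz≈y∙xz to *-swapˡ)
  open SemigroupProperties +-commutativeSemigroup using () renaming (x∙yz≈y∙xz to +-swapˡ)
  open import Relation.Binary.Reasoning.Setoid setoid

  weight : List (List I) → Carrier
  weight s = foldr _*_ 1# (List.map c s)

  -- The state `s` is the list of blocks formed by the letters read so far. Each new letter opens a
  -- block or is put in front of an admissible one, and `weight` is taken when no letters remain.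
  classicalScan booleanScan : List (List I) → Functional
  classicalScan s []      = weight s
  classicalScan s (x ∷ w) = classicalScan ((x ∷ []) ∷ s) w
    + sum (pointings s) (λ z → classicalScan ((x ∷ focus z) ∷ others z) w)
  booleanScan s []        = weight s
  booleanScan s (x ∷ w)   = booleanScan ((x ∷ []) ∷ s) w
    + sum (first s) (λ z → booleanScan ((x ∷ focus z) ∷ others z) w)

  freeScan : List (Bool × List I) → Functional
  freeScan s []      = weight (List.map proj₂ s)
  freeScan s (x ∷ w) = freeScan ((true , x ∷ []) ∷ s) w
    + sum (reopen s) (λ (b , t) → freeScan ((true , x ∷ b) ∷ t) w)

  module _ {S : Set s} {P : ∀ {n} → Pred (List (Subset n)) p}
    {allowed : ∀ {n} → List (Subset n) → List (Pointed (Subset n))} (hereditary : IsHereditary P allowed)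
    (view : ∀ {n} → List (Subset n) → Vec I n → S) (scan : S → Functional)
    (scan-∷ : ∀ {n} {π : List (Subset n)} → P π → ∀ (xs : Vec I n) x w → scan (view π xs) (x ∷ w) ≈
      scan (view (fresh π) (x ∷ xs)) w + sum (allowed π) (λ z → scan (view (glue z) (x ∷ xs)) w))
    where

    -- The unread letters `w` are kept general so that the induction can pass the head of `xs` over
    -- to them.
    sum-partitionsBy : ∀ (xs : Vec I n) w →
      sum (partitionsBy allowed n) (λ π → scan (view π xs) w) ≈ scan (view [] []) (toList xs ʳ++ w)
    sum-partitionsBy []       w = +-identityʳ _
    sum-partitionsBy {suc n} (x ∷ xs) w = begin
      sum (concatMap (children allowed) (partitionsBy allowed n)) (λ π → scan (view π (x ∷ xs)) w)
        ≈⟨ sum-concatMap (children allowed) (partitionsBy allowed n) _ ⟩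
      sum (partitionsBy allowed n) (λ π → sum (children allowed π) (λ σ → scan (view σ (x ∷ xs)) w))
        ≈⟨ sum-congᴬ (All.tabulate λ {π} π∈ → trans (+-congˡ (sum-map glue (allowed π) _))
             (sym (scan-∷ (_Enumerates_.snd (partitionsBy-enumerates hereditary n) π∈) xs x w))) ⟩
      sum (partitionsBy allowed n) (λ π → scan (view π xs) (x ∷ w))
        ≈⟨ sum-partitionsBy xs (x ∷ w) ⟩
      scan (view [] []) (toList xs ʳ++ (x ∷ w)) ∎

    ∑-partitions : (E : Enumeration (P {n})) (xs : Vec I n) →
      ∑ 𝕂 E (λ π → scan (view π xs) []) ≈ scan (view [] []) (reverse (toList xs))
    ∑-partitions E xs = trans (∑-unique E (enumeration (partitionsBy-enumerates hereditary _)) _)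
      (sum-partitionsBy xs [])

  ∑-Π : (xs : Vec I n) → ∑ 𝕂 (Π n) (λ π → weight (blocks π xs)) ≈ classicalScan [] (reverse (toList xs))
  ∑-Π {n} = ∑-partitions Π-hereditary blocks classicalScan
    (λ {_} {π} _ xs x w → +-cong
      (reflexive (≡.cong (λ s → classicalScan s w) (≡.sym (blocks-fresh π xs x))))
      (trans (reflexive (≡.cong (λ zs → sum zs _) (pointings-map (subword xs) π)))
        (trans (sum-map (mapPointed (subword xs)) (pointings π) _) (sum-cong (pointings π) λ z →
          reflexive (≡.cong (λ s → classicalScan s w) (≡.sym (blocks-glue z xs x)))))))
    (Π n)

  ∑-Int : (xs : Vec I n) → ∑ 𝕂 (Int n) (λ π → weight (blocks π xs)) ≈ booleanScan [] (reverse (toList xs))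
  ∑-Int {n} = ∑-partitions Int-hereditary blocks booleanScan
    (λ {_} {π} _ xs x w → +-cong
      (reflexive (≡.cong (λ s → booleanScan s w) (≡.sym (blocks-fresh π xs x))))
      (trans (reflexive (≡.cong (λ zs → sum zs _) (first-map (subword xs) π)))
        (trans (sum-map (mapPointed (subword xs)) (first π) _) (sum-cong (first π) λ z →
          reflexive (≡.cong (λ s → booleanScan s w) (≡.sym (blocks-glue z xs x)))))))
    (Int n)

  ∑-NC : (xs : Vec I n) → ∑ 𝕂 (NC n) (λ π → weight (blocks π xs)) ≈ freeScan [] (reverse (toList xs))
  ∑-NC {n} xs = trans
    (sum-cong (elements (NC n)) λ π → reflexive (≡.cong weight (≡.sym (unflag π))))
    (∑-partitions NC-hereditary flaggedBlocks freeScan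
      (λ {_} {π} (P , _) xs x w → +-cong
        (reflexive (≡.cong (λ s → freeScan s w) (≡.sym (flaggedBlocks-fresh P xs x))))
        (trans (reflexive (≡.cong (λ zs → sum zs _)
                 (≡.trans (reopen-map (subword xs) (flagged π))
                   (≡.trans (≡.cong (List.map _) (reopen-flags (outer? π) π))
                     (≡.sym (List.map-∘ (outers π)))))))
          (trans (sum-map _ (outers π) _) (sum-congᴬ (All.tabulate λ {z} z∈ →
            reflexive (≡.cong (λ s → freeScan s w) (≡.sym (flaggedBlocks-glue P xs x z∈))))))))
      (NC n) xs)
    where
    unflag : ∀ π → List.map proj₂ (flaggedBlocks π xs) ≡ blocks π xs
    unflag π = ≡.trans (≡.sym (List.map-∘ (flagged π))) (≡.sym (List.map-∘ π))

  -- The cumulant of block `b` after it has received the letters `u`. They were read backwards, so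
  -- they appear reversed in front of `b`.
  extend : List I → Functional
  extend b u = c (u ʳ++ b)

  pointedSum : (List I → List (List I) → Carrier) → List (List I) → Carrier
  pointedSum h s = sum (pointings s) (λ z → h (focus z) (others z))

  pointedSum-∷ : ∀ h x s → pointedSum h (x ∷ s) ≈ h x s + pointedSum (λ b t → h b (x ∷ t)) s
  pointedSum-∷ h x s = +-congˡ (sum-map (shiftʳ x) (pointings s) _)

  pointedSum-↭ : ∀ {h s t} → (∀ b {u v} → u ↭ v → h b u ≈ h b v) → s ↭ t →
                 pointedSum h s ≈ pointedSum h t
  pointedSum-↭ h-↭ Perm.refl         = refl
  pointedSum-↭ {h} h-↭ (prep {s} {t} x s↭t)    = trans (pointedSum-∷ h x s)
    (trans (+-cong (h-↭ x s↭t) (pointedSum-↭ (λ b u↭v → h-↭ b (prep x u↭v)) s↭t))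
           (sym (pointedSum-∷ h x t)))
  pointedSum-↭ {h} h-↭ (swap {s} {t} x y s↭t)  = begin
    pointedSum h (x ∷ y ∷ s)
      ≈⟨ trans (pointedSum-∷ h x _) (+-congˡ (pointedSum-∷ _ y s)) ⟩
    h x (y ∷ s) + (h y (x ∷ s) + pointedSum (λ b u → h b (x ∷ y ∷ u)) s)
      ≈⟨ +-swapˡ _ _ _ ⟩
    h y (x ∷ s) + (h x (y ∷ s) + pointedSum (λ b u → h b (x ∷ y ∷ u)) s)
      ≈⟨ +-cong (h-↭ y (prep x s↭t)) (+-cong (h-↭ x (prep y s↭t)) (trans
           (sum-cong (pointings s) (λ z → h-↭ (focus z) (swap x y ↭-refl)))
           (pointedSum-↭ (λ b u↭v → h-↭ b (prep y (prep x u↭v))) s↭t))) ⟩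
    h y (x ∷ t) + (h x (y ∷ t) + pointedSum (λ b u → h b (y ∷ x ∷ u)) t)
      ≈⟨ trans (pointedSum-∷ h y _) (+-congˡ (pointedSum-∷ _ x t)) ⟨
    pointedSum h (y ∷ x ∷ t) ∎
  pointedSum-↭ h-↭ (Perm.trans p q)  = trans (pointedSum-↭ h-↭ p) (pointedSum-↭ h-↭ q)

  weight-↭ : ∀ {s t} → s ↭ t → weight s ≈ weight t
  weight-↭ Perm.refl        = refl
  weight-↭ (prep b p)       = *-congˡ (weight-↭ p)
  weight-↭ (swap b b′ p)    = trans (*-congˡ (*-congˡ (weight-↭ p))) (*-swapˡ _ _ _)
  weight-↭ (Perm.trans p q) = trans (weight-↭ p) (weight-↭ q)

  -- Each step moves a block to the front; this brings a distinguished block back to the head.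
  classicalScan-↭ : ∀ w {s t} → s ↭ t → classicalScan s w ≈ classicalScan t w
  classicalScan-↭ []      s↭t = weight-↭ s↭t
  classicalScan-↭ (x ∷ w) s↭t = +-cong (classicalScan-↭ w (prep _ s↭t))
    (pointedSum-↭ (λ b u↭v → classicalScan-↭ w (prep _ u↭v)) s↭t)

  ⧢-sumʳ : ∀ h (xs : List A) (φ : A → Functional) w →
           (h ⧢ (λ u → sum xs (λ x → φ x u))) w ≈ sum xs (λ x → (h ⧢ φ x) w)
  ⧢-sumʳ h []       φ w = sum-0 (unshuffles w) λ _ → zeroʳ _
  ⧢-sumʳ h (x ∷ xs) φ w = trans (⧢-+ʳ h (φ x) _ w) (+-congˡ (⧢-sumʳ h xs φ w))

  -- The letters joining `b` form an arbitrary subword, and the others are scanned as if `b` were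
  -- absent.
  classicalScan-block : ∀ b s w → classicalScan (b ∷ s) w ≈ (extend b ⧢ classicalScan s) w
  classicalScan-block b s []      = sym (+-identityʳ _)
  classicalScan-block b s (x ∷ w) = begin
    classicalScan ((x ∷ []) ∷ b ∷ s) w
      + sum (pointings (b ∷ s)) (λ z → classicalScan ((x ∷ focus z) ∷ others z) w)
      ≈⟨ +-cong (classicalScan-↭ w (swap _ _ ↭-refl))
                (trans (pointedSum-∷ (λ a t → classicalScan ((x ∷ a) ∷ t) w) b s)
                  (+-congˡ (sum-cong (pointings s) λ z → classicalScan-↭ w (swap _ _ ↭-refl)))) ⟩
    classicalScan (b ∷ (x ∷ []) ∷ s) w
      + (classicalScan ((x ∷ b) ∷ s) w
        + sum (pointings s) (λ z → classicalScan (b ∷ (x ∷ focus z) ∷ others z) w))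
      ≈⟨ +-swapˡ _ _ _ ⟩
    classicalScan ((x ∷ b) ∷ s) w + (classicalScan (b ∷ (x ∷ []) ∷ s) w
        + sum (pointings s) (λ z → classicalScan (b ∷ (x ∷ focus z) ∷ others z) w))
      ≈⟨ +-cong (classicalScan-block (x ∷ b) s w) (+-cong (classicalScan-block b _ w)
           (trans (sum-cong (pointings s) λ z → classicalScan-block b _ w)
             (sym (⧢-sumʳ (extend b) (pointings s) _ w)))) ⟩
    (extend (x ∷ b) ⧢ classicalScan s) w + ((extend b ⧢ classicalScan ((x ∷ []) ∷ s)) w
        + (extend b ⧢ (λ u → sum (pointings s) (λ z → classicalScan ((x ∷ focus z) ∷ others z) u))) w)
      ≈⟨ +-congˡ (⧢-+ʳ (extend b) _ _ w) ⟨
    (extend (x ∷ b) ⧢ classicalScan s) w + (extend b ⧢ (classicalScan s ∘ (x ∷_))) w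
      ≈⟨ ⧢-∷ (extend b) (classicalScan s) x w ⟨
    (extend b ⧢ classicalScan s) (x ∷ w) ∎

  gapSum-sumʳ : ∀ F h (xs : List A) (φ : A → Functional) w →
                gapSum F h (λ u → sum xs (λ x → φ x u)) w ≈ sum xs (λ x → gapSum F h (φ x) w)
  gapSum-sumʳ F h []       φ w = trans (gapSum-cong w (λ _ → refl) (λ _ → sym (zeroˡ 0#)))
    (trans (gapSum-*ʳ F h 0# (λ _ → 0#) w) (zeroˡ _))
  gapSum-sumʳ F h (x ∷ xs) φ w = trans (gapSum-+ʳ F h (φ x) _ w) (+-congˡ (gapSum-sumʳ F h xs φ w))

  weight-++ : ∀ s t → weight (s ++ t) ≈ weight s * weight t
  weight-++ []      t = sym (*-identityˡ _)
  weight-++ (b ∷ s) t = trans (*-congˡ (weight-++ s t)) (sym (*-assoc _ _ _))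

  unclose : (t : List (List I)) → List.map proj₂ (List.map (false ,_) t) ≡ t
  unclose t = ≡.trans (≡.sym (List.map-∘ t)) (List.map-id t)

  -- Closed blocks receive no further letters, so they only contribute their final weight.
  freeScan-closed : ∀ s t w → freeScan (s ++ List.map (false ,_) t) w ≈ freeScan s w * weight t
  freeScan-closed s t [] = trans
    (reflexive (≡.cong weight (≡.trans (List.map-++ proj₂ s _)
      (≡.cong (List.map proj₂ s ++_) (unclose t)))))
    (weight-++ (List.map proj₂ s) t)
  freeScan-closed s t (x ∷ w) = trans
    (+-cong (freeScan-closed ((true , x ∷ []) ∷ s) t w)
      (trans (reflexive (≡.cong (λ rs → sum rs _) (reopen-++-closed s t)))
        (trans (sum-map (map₂ (_++ List.map (false ,_) t)) (reopen s) _)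
          (trans (sum-cong (reopen s) λ (b , r) → freeScan-closed ((true , x ∷ b) ∷ r) t w)
            (sum-*ʳ (reopen s) (weight t) _)))))
    (sym (distribʳ _ _ _))

  -- Letters read before `b` is first extended interact with `s` only, which gives the functional of
  -- the first gap. Extending `b` closes all blocks before it, so each later gap starts afresh with
  -- `freeScan []`.
  freeScan-block : ∀ b s w → freeScan (s ++ (true , b) ∷ []) w ≈
                   gapSum (freeScan []) (extend b) (freeScan s) w
  freeScan-block b s [] = trans
    (trans (reflexive (≡.cong weight (List.map-++ proj₂ s _))) (weight-++ (List.map proj₂ s) (b ∷ [])))
    (trans (*-congˡ (*-identityʳ _)) (*-comm _ _))
  freeScan-block b s (x ∷ w) = begin
    freeScan ((true , x ∷ []) ∷ s ++ (true , b) ∷ []) w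
      + sum (reopen (s ++ (true , b) ∷ [])) step
      ≈⟨ +-congˡ (trans (reflexive (≡.cong (λ rs → sum rs step) (reopen-∷ʳ-open s b)))
           (trans (sum-++ (List.map (map₂ (_++ (true , b) ∷ [])) (reopen s)) _ step)
             (+-cong (sum-map (map₂ (_++ (true , b) ∷ [])) (reopen s) step) (+-identityʳ _)))) ⟩
    freeScan ((true , x ∷ []) ∷ s ++ (true , b) ∷ []) w
      + (sum (reopen s) (λ (a , r) → freeScan ((true , x ∷ a) ∷ r ++ (true , b) ∷ []) w)
        + freeScan ((true , x ∷ b) ∷ close s) w)
      ≈⟨ +-assoc _ _ _ ⟨
    freeScan ((true , x ∷ []) ∷ s ++ (true , b) ∷ []) w
      + sum (reopen s) (λ (a , r) → freeScan ((true , x ∷ a) ∷ r ++ (true , b) ∷ []) w)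
      + freeScan ((true , x ∷ b) ∷ close s) w
      ≈⟨ +-cong
           (+-cong (freeScan-block b ((true , x ∷ []) ∷ s) w)
             (trans (sum-cong (reopen s) λ (a , r) → freeScan-block b ((true , x ∷ a) ∷ r) w)
               (sym (gapSum-sumʳ _ _ (reopen s) _ w))))
           (trans (freeScan-closed ((true , x ∷ b) ∷ []) (List.map proj₂ s) w)
             (trans (*-congʳ (freeScan-block (x ∷ b) [] w)) (*-comm _ _))) ⟩
    gapSum F (extend b) (freeScan ((true , x ∷ []) ∷ s)) w
      + gapSum F (extend b) (λ u → sum (reopen s) (λ (a , r) → freeScan ((true , x ∷ a) ∷ r) u)) w
      + freeScan s [] * gapSum F (extend (x ∷ b)) F w
      ≈⟨ +-congʳ (gapSum-+ʳ _ _ _ _ w) ⟨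
    gapSum F (extend b) (freeScan s) (x ∷ w) ∎
    where
    F = freeScan []
    step : List I × List (Bool × List I) → Carrier
    step (a , r) = freeScan ((true , x ∷ a) ∷ r) w

  -- Only the first block can still grow, so the blocks of `s` are final.
  booleanScan-tail : ∀ b s w → booleanScan (b ∷ s) w ≈ booleanScan (b ∷ []) w * weight s
  booleanScan-tail b s []      = *-congʳ (sym (*-identityʳ _))
  booleanScan-tail b s (x ∷ w) = begin
    booleanScan ((x ∷ []) ∷ b ∷ s) w + (booleanScan ((x ∷ b) ∷ s) w + 0#)
      ≈⟨ +-cong (booleanScan-tail (x ∷ []) (b ∷ s) w)
                (trans (+-identityʳ _) (booleanScan-tail (x ∷ b) s w)) ⟩
    booleanScan ((x ∷ []) ∷ []) w * (c b * weight s) + booleanScan ((x ∷ b) ∷ []) w * weight s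
      ≈⟨ +-cong (trans (*-congʳ (booleanScan-tail (x ∷ []) (b ∷ []) w))
                  (trans (*-assoc _ _ _) (*-congˡ (*-congʳ (*-identityʳ _)))))
                (*-congʳ (+-identityʳ _)) ⟨
    booleanScan ((x ∷ []) ∷ b ∷ []) w * weight s + (booleanScan ((x ∷ b) ∷ []) w + 0#) * weight s
      ≈⟨ distribʳ _ _ _ ⟨
    booleanScan (b ∷ []) (x ∷ w) * weight s ∎

  -- The block grows along an initial piece of `w`; the first letter to open a new block completes
  -- it for good.
  booleanScan-block : ∀ b w → booleanScan (b ∷ []) w ≈ (extend b ⊙ booleanScan []) w
  booleanScan-block b []      = sym (+-identityʳ _)
  booleanScan-block b (x ∷ w) = begin
    booleanScan ((x ∷ []) ∷ b ∷ []) w + (booleanScan ((x ∷ b) ∷ []) w + 0#)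
      ≈⟨ +-cong (trans (booleanScan-tail (x ∷ []) (b ∷ []) w)
                  (trans (*-comm _ _) (*-cong (*-identityʳ _) (sym (+-identityʳ _)))))
                (trans (+-identityʳ _) (booleanScan-block (x ∷ b) w)) ⟩
    c b * booleanScan [] (x ∷ w) + (extend (x ∷ b) ⊙ booleanScan []) w
      ≈⟨ ⊙-∷ (extend b) (booleanScan []) x w ⟨
    (extend b ⊙ booleanScan []) (x ∷ w) ∎

  classicalScan-∷ : ∀ z w → classicalScan [] (z ∷ w) ≈ (extend (z ∷ []) ⧢ classicalScan []) w
  classicalScan-∷ z w = trans (+-identityʳ _) (classicalScan-block (z ∷ []) [] w)

  freeScan-∷ : ∀ z w → freeScan [] (z ∷ w) ≈ gapSum (freeScan []) (extend (z ∷ [])) (freeScan []) w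
  freeScan-∷ z w = trans (+-identityʳ _) (freeScan-block (z ∷ []) [] w)

  booleanScan-∷ : ∀ z w → booleanScan [] (z ∷ w) ≈ (extend (z ∷ []) ⊙ booleanScan []) w
  booleanScan-∷ z w = trans (+-identityʳ _) (booleanScan-block (z ∷ []) w)

-- The three equivalences

restrict-map : (g : A → B) (U : Subset n) (xs : Vec A n) → restrict U (map g xs) ≡ map g (restrict U xs)
restrict-map g []            []       = ≡.refl
restrict-map g (inside ∷ U)  (x ∷ xs) = ≡.cong (g x ∷_) (restrict-map g U xs)
restrict-map g (outside ∷ U) (x ∷ xs) = restrict-map g U xs

onLists : (∀ n → Vec A n → B) → List A → B
onLists C w = C (length w) (fromList w)

onLists-toList : (C : ∀ n → Vec A n → B) (xs : Vec A n) → onLists C (toList xs) ≡ C n xs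
onLists-toList C []       = ≡.refl
onLists-toList C (x ∷ xs) = onLists-toList (λ n → C (suc n) ∘ (x ∷_)) xs

reverse-last-init : (i : Vec A (suc m)) → reverse (last i ∷ reverse (toList (init i))) ≡ toList i
reverse-last-init i with is , z , ≡.refl ← Vec.initLast i =
  ≡.trans (List.unfold-reverse z (reverse (toList is)))
    (≡.trans (≡.cong (_++ z ∷ []) (List.reverse-involutive (toList is))) (≡.sym (Vec.toList-∷ʳ z is)))

fromReversed : A → (w : List A) → Vec A (suc (length (reverse w)))
fromReversed z w = fromList (reverse w) ∷ʳ z

init-fromReversed : (z : A) (w : List A) → reverse (toList (init (fromReversed z w))) ≡ w
init-fromReversed z w = ≡.trans
  (≡.cong (reverse ∘ toList) (Vec.init-∷ʳ z (fromList (reverse w))))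
  (≡.trans (≡.cong reverse (Vec.toList∘fromList (reverse w))) (List.reverse-involutive w))

last-fromReversed : (z : A) (w : List A) → last (fromReversed z w) ≡ z
last-fromReversed z w = Vec.last-∷ʳ z (fromList (reverse w))

toList-fromReversed : (z : A) (w : List A) → toList (fromReversed z w) ≡ reverse (z ∷ w)
toList-fromReversed z w = ≡.trans (Vec.toList-∷ʳ z (fromList (reverse w)))
  (≡.trans (≡.cong (_++ z ∷ []) (Vec.toList∘fromList (reverse w))) (≡.sym (List.unfold-reverse z w)))

module Cumulants {𝕂 : CommutativeRing k ℓk} (𝓐 : NCProbabilitySpace 𝕂 a ℓ) {I : Set ι}
         (X : I → NCProbabilitySpace.Carrier 𝓐) where
  open CommutativeRing 𝕂
  private module 𝓐 = NCProbabilitySpace 𝓐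
  open Words 𝕂 I
  open import Relation.Binary.Reasoning.Setoid setoid

  moments : Functional
  moments w = 𝓐.φ (foldr (𝓐._*_ ∘ X) 𝓐.1# (reverse w))

  product-toList : (i : Vec I n) →
    Vec.foldr _ 𝓐._*_ 𝓐.1# (map X i) ≡ foldr (𝓐._*_ ∘ X) 𝓐.1# (toList i)
  product-toList []      = ≡.refl
  product-toList (x ∷ i) = ≡.cong (X x 𝓐.*_) (product-toList i)

  module _ (C : Functionals 𝓐) where

    cumulant : Functional
    cumulant = onLists (λ n i → C n (map X i))

    cumulant-toList : (i : Vec I n) → cumulant (toList i) ≡ C n (map X i)
    cumulant-toList = onLists-toList (λ n i → C n (map X i))

    open BlockWeights 𝕂 cumulant

    at-partition-weight : (π : List (Subset n)) (i : Vec I n) →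
      _at-partition_ 𝓐 C π (map X i) ≡ weight (blocks π i)
    at-partition-weight π i = ≡.cong (foldr _*_ 1#) (≡.trans
      (List.map-cong (λ U → ≡.trans (≡.cong (C ∣ U ∣) (restrict-map X U i))
        (≡.sym (cumulant-toList (restrict U i)))) π)
      (List.map-∘ π))

    moments-scan : ∀ {p} {P : ∀ n → Pred (List (Subset n)) p} {E : ∀ n → Enumeration (P n)}
      (scan : Functional) → scan [] ≈ 1# →
      (∀ {n} (i : Vec I n) → ∑ 𝕂 (E n) (λ π → weight (blocks π i)) ≈ scan (reverse (toList i))) →
      IsCumulants 𝓐 E C → ∀ w → moments w ≈ scan w
    -- The moment formula speaks only of words with at least one letter; the empty word is settled
    -- by `φ-unital`.
    moments-scan scan scan-[] ∑-scan cumulants []      = trans 𝓐.φ-unital (sym scan-[])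
    moments-scan {E = E} scan scan-[] ∑-scan cumulants (z ∷ w) = begin
      𝓐.φ (foldr (𝓐._*_ ∘ X) 𝓐.1# (reverse (z ∷ w)))
        ≡⟨ ≡.cong (𝓐.φ ∘ foldr (𝓐._*_ ∘ X) 𝓐.1#) (toList-fromReversed z w) ⟨
      𝓐.φ (foldr (𝓐._*_ ∘ X) 𝓐.1# (toList i))
        ≡⟨ ≡.cong 𝓐.φ (product-toList i) ⟨
      𝓐.φ (Vec.foldr _ 𝓐._*_ 𝓐.1# (map X i))
        ≈⟨ IsCumulants.moment-formula cumulants _ (map X i) ⟩
      ∑ 𝕂 (E _) (λ π → _at-partition_ 𝓐 C π (map X i))
        ≈⟨ Sum.sum-cong 𝕂 (elements (E _)) (λ π → reflexive (at-partition-weight π i)) ⟩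
      ∑ 𝕂 (E _) (λ π → weight (blocks π i))
        ≈⟨ ∑-scan i ⟩
      scan (reverse (toList i))
        ≡⟨ ≡.cong scan (≡.trans (≡.cong reverse (toList-fromReversed z w))
             (List.reverse-involutive (z ∷ w))) ⟩
      scan (z ∷ w) ∎
      where i = fromReversed z w

    -- Passes from colour vectors to reversed words: `z` is the last colour, the one of ⊟, and `w`
    -- lists the vertex colours backwards.
    onWords : (T : ∀ {m} → Vec I (suc m) → Carrier) (S : I → Functional) →
      (∀ {m} (i : Vec I (suc m)) → T i ≈ S (last i) (reverse (toList (init i)))) →
      (∀ m (i : Vec I (suc m)) → - C (suc m) (map X i) ≈ T i) ⇔
      (∀ z w → - cumulant (reverse (z ∷ w)) ≈ S z w)
    onWords T S T≈S = mk⇔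
      (λ C≈T z w → let i = fromReversed z w in begin
        - cumulant (reverse (z ∷ w))           ≡⟨ ≡.cong (-_ ∘ cumulant) (toList-fromReversed z w) ⟨
        - cumulant (toList i)                  ≡⟨ ≡.cong -_ (cumulant-toList i) ⟩
        - C _ (map X i)                        ≈⟨ C≈T _ i ⟩
        T i                                    ≈⟨ T≈S i ⟩
        S (last i) (reverse (toList (init i))) ≡⟨ ≡.cong₂ S (last-fromReversed z w) (init-fromReversed z w) ⟩
        S z w                                  ∎)
      (λ κ≈S m i → begin
        - C (suc m) (map X i)
          ≡⟨ ≡.cong -_ (cumulant-toList i) ⟨
        - cumulant (toList i)
          ≡⟨ ≡.cong (-_ ∘ cumulant) (reverse-last-init i) ⟨
        - cumulant (reverse (last i ∷ reverse (toList (init i))))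
          ≈⟨ κ≈S (last i) _ ⟩
        S (last i) (reverse (toList (init i)))
          ≈⟨ T≈S i ⟨
        T i ∎)

    module _ (τ : BPT I → Carrier) (τ-troupe : IsWeightedTroupe 𝕂 τ) where
      open Troupe 𝕂 τ τ-troupe

      formula⇔moments : ∀ {p} {P : ∀ n → Pred (List (Subset n)) p} {E : ∀ n → Enumeration (P n)}
        {op S} → BlockSum op → IsLastBlock op S → (scan : Functional) → scan [] ≈ 1# →
        (∀ {n} (i : Vec I n) → ∑ 𝕂 (E n) (λ π → weight (blocks π i)) ≈ scan (reverse (toList i))) →
        (∀ z w → scan (z ∷ w) ≈ op scan (extend (z ∷ [])) scan w) →
        (T : ∀ {m} → Vec I (suc m) → Carrier) →
        (∀ {m} (i : Vec I (suc m)) → T i ≈ S τ[ last i ] (reverse (toList (init i)))) →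
        IsCumulants 𝓐 E C →
        (∀ m (i : Vec I (suc m)) → - C (suc m) (map X i) ≈ T i) ⇔ (∀ w → moments w ≈ moment w)
      formula⇔moments {S = S} blockSum isLastBlock scan scan-[] ∑-scan scan-∷ T T≈S cumulants =
        mk⇔ (λ scan≈ w → trans (moments≈ w) (scan≈ w)) (λ F≈ w → trans (sym (moments≈ w)) (F≈ w))
          ⇔-∘ (cumulants⇔moments blockSum isLastBlock scan (cumulant ∘ reverse) scan-[] scan-∷
          ⇔-∘ onWords T (S ∘ τ[_]) T≈S)
        where moments≈ = moments-scan scan scan-[] ∑-scan cumulants

theorem4p1 : ∀ {k ℓk a ℓ ι : Level}
    (𝕂 : CommutativeRing k ℓk) (𝓐 : NCProbabilitySpace 𝕂 a ℓ)
    {I : Set ι} (X : I → NCProbabilitySpace.Carrier 𝓐)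
    (τ : BPT I → CommutativeRing.Carrier 𝕂) → IsWeightedTroupe 𝕂 τ →
    (K R B : Functionals 𝓐) →
    IsClassicalCumulants 𝓐 K → IsFreeCumulants 𝓐 R → IsBooleanCumulants 𝓐 B →
    let open CommutativeRing 𝕂 in
    ((∀ m (i : Vec I (suc m)) → - K (suc m) (map X i) ≈ ∑ 𝕂 (DBPTs i) (λ T → τ (underlying T)))
    ⇔ (∀ m (i : Vec I (suc m)) → - R (suc m) (map X i) ≈ ∑ 𝕂 (BPTs i) τ))
    × ((∀ m (i : Vec I (suc m)) → - R (suc m) (map X i) ≈ ∑ 𝕂 (BPTs i) τ)
    ⇔ (∀ m (i : Vec I (suc m)) → - B (suc m) (map X i) ≈ ∑ 𝕂 (Branches i) τ))
theorem4p1 𝕂 𝓐 {I} X τ τ-troupe K R B K-cumulants R-cumulants B-cumulants =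
  (⇔-sym free ⇔-∘ classical) , (⇔-sym boolean ⇔-∘ free)
  where
  open CommutativeRing 𝕂
  open Words 𝕂 I
  open Troupe 𝕂 τ τ-troupe
  open TreeSums 𝕂 τ τ-troupe
  open DBPTSum 𝕂 τ τ-troupe
  open Cumulants 𝓐 X
  module K = BlockWeights 𝕂 (cumulant K)
  module R = BlockWeights 𝕂 (cumulant R)
  module B = BlockWeights 𝕂 (cumulant B)

  classical : (∀ m (i : Vec I (suc m)) →
                - K (suc m) (map X i) ≈ ∑ 𝕂 (DBPTs i) (λ T → τ (underlying T))) ⇔
              (∀ w → moments w ≈ moment w)
  classical = formula⇔moments K τ τ-troupe (Peeling.blockSum ⧢-peeling)
    (treeSum-isLastBlock ⧢-peeling decreasing-treeSum) (K.classicalScan []) refl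
    K.∑-Π K.classicalScan-∷
    (λ i → ∑ 𝕂 (DBPTs i) (λ T → τ (underlying T))) ∑-DBPTs K-cumulants

  free : (∀ m (i : Vec I (suc m)) → - R (suc m) (map X i) ≈ ∑ 𝕂 (BPTs i) τ) ⇔
         (∀ w → moments w ≈ moment w)
  free = formula⇔moments R τ τ-troupe (Peeling.blockSum gapSum-peeling)
    (treeSum-isLastBlock gapSum-peeling planar-treeSum) (R.freeScan []) refl R.∑-NC R.freeScan-∷
    (λ i → ∑ 𝕂 (BPTs i) τ) ∑-BPTs R-cumulants

  boolean : (∀ m (i : Vec I (suc m)) → - B (suc m) (map X i) ≈ ∑ 𝕂 (Branches i) τ) ⇔
            (∀ w → moments w ≈ moment w)
  boolean = formula⇔moments B τ τ-troupe {S = branchSum} ⊙-blockSum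
    (branchSum-isLastBlock {S = branchSum} (λ _ → refl) branchSum-∷) (B.booleanScan []) refl
    B.∑-Int B.booleanScan-∷
    (λ i → ∑ 𝕂 (Branches i) τ) ∑-Branches B-cumulants
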